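{- Fix an integer $k\geq 2$. If $t=t(n)=\omega(n^{2-1/k})$, then there exists $b=n^{2k-1+o(1)}/t^{k-1}$ for which there is a successful $(t,b)$-strategy for the $k$-th power of a Hamilton cycle.
   Context: Budget-constrained random graph process: let $M=\binom{n}{2}$. The edges of $K_n$ on vertex set $[n]$ are put in a uniformly random order $e_1,e_2,\ldots,e_M$. Builder is presented $e_1,\ldots,e_t$ one by one (with $t\leq M$) and, as each edge is presented and without knowledge of future edges, must irrevocably decide (possibly using additional randomness) whether to purchase it; she may purchase at most $b$ edges in total. A $(t,b)$-strategy is a rule for these decisions; $B_t$ denotes the graph of purchased edges after time $t$. A strategy is successful for a property $\mathcal{P}$ if $B_t$ satisfies $\mathcal{P}$ with probability tending to $1$ as $n\to\infty$. The $k$-th power of a graph $G$ is obtained from $G$ by joining every pair of vertices at distance at most $k$ in $G$; the property considered is that $B_t$ contains the $k$-th power of a cycle through all $n$ vertices. -}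

module Defs where

open import Data.Nat.Base using (ℕ; zero; suc; _+_; _*_; _∸_; _^_; _≤_; _≤ᵇ_; _<ᵇ_; _≡ᵇ_)
open import Data.Bool.Base using (Bool; true; false; if_then_else_; _∧_; _∨_)
open import Data.Fin.Base using (Fin; toℕ)
open import Data.List.Base using (List; []; _∷_; [_]; map; concatMap; allFin; upTo; take; _∷ʳ_; length)
open import Data.Bool.ListAction using (all; any)
open import Data.Nat.ListAction using (sum)
open import Data.Product.Base using (_×_; _,_; ∃)

-- An edge of K_n on vertex set Fin n, stored as (i , j) with i < j.
Edge : ℕ → Set
Edge n = Fin n × Fin n

allEdges : (n : ℕ) → List (Edge n)
allEdges n = concatMap (λ i → concatMap (λ j → if toℕ i <ᵇ toℕ j then [ (i , j) ] else []) (allFin n)) (allFin n)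

insertAll : {A : Set} → A → List A → List (List A)
insertAll x [] = (x ∷ []) ∷ []
insertAll x (y ∷ ys) = (x ∷ y ∷ ys) ∷ map (y ∷_) (insertAll x ys)

perms : {A : Set} → List A → List (List A)
perms [] = [] ∷ []
perms (x ∷ xs) = concatMap (insertAll x) (perms xs)

-- Uniformly random orderings of the edges of K_n: all M! orderings.
orderings : (n : ℕ) → List (List (Edge n))
orderings n = perms (allEdges n)

adj : {n : ℕ} → List (Edge n) → Fin n → Fin n → Bool
adj G u v = any (λ e → let (a , b) = e in
  ((toℕ a ≡ᵇ toℕ u) ∧ (toℕ b ≡ᵇ toℕ v)) ∨ ((toℕ a ≡ᵇ toℕ v) ∧ (toℕ b ≡ᵇ toℕ u))) G

at : {A : Set} → List A → ℕ → List A
at [] _ = []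
at (x ∷ xs) zero = x ∷ []
at (x ∷ xs) (suc i) = at xs i

powerCycleOn : (k : ℕ) {n : ℕ} → List (Edge n) → List (Fin n) → Bool
powerCycleOn k {n} G p =
  all (λ i → all (λ j →
    if (i <ᵇ j) ∧ (((j ∸ i) ≤ᵇ k) ∨ ((n ∸ (j ∸ i)) ≤ᵇ k))
    then all (λ u → all (λ v → adj G u v) (at p j)) (at p i)
    else true) (upTo n)) (upTo n)

hasPowHamCycle : (k n : ℕ) → List (Edge n) → Bool
hasPowHamCycle k n G = any (powerCycleOn k G) (perms (allFin n))

-- A (possibly randomised) online strategy on K_n: given the random seed and
-- the history of presented edges (ending with the currently presented edge),
-- decide whether to purchase the current edge.
Strategy : ℕ → Set
Strategy n = ℕ → List (Edge n) → Bool

runFrom : {n : ℕ} → Strategy n → ℕ → ℕ → List (Edge n) → List (Edge n) → List (Edge n)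
runFrom S s zero hist es = []
runFrom S s (suc b) hist [] = []
runFrom S s (suc b) hist (e ∷ es) =
  if S s (hist ∷ʳ e)
  then e ∷ runFrom S s b (hist ∷ʳ e) es
  else runFrom S s (suc b) (hist ∷ʳ e) es

purchased : {n : ℕ} → Strategy n → (s t b : ℕ) → List (Edge n) → List (Edge n)
purchased S s t b σ = runFrom S s b [] (take t σ)

count : {A : Set} → (A → Bool) → List A → ℕ
count p xs = sum (map (λ x → if p x then 1 else 0) xs)

-- Number of (seed, ordering) pairs (seeds uniform in {0..R}) for which B_t
-- contains the k-th power of a Hamilton cycle, and the total number of pairs.
successes : (k n R t b : ℕ) → Strategy n → ℕ
successes k n R t b S =
  sum (map (λ s → count (λ σ → hasPowHamCycle k n (purchased S s t b σ)) (orderings n)) (upTo (suc R)))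

total : (n R : ℕ) → ℕ
total n R = suc R * length (orderings n)

-- Successful (t,b)-strategy family: probability of success tends to 1,
-- i.e. for every m, eventually  P(fail) ≤ 1/(m+1).
Successful : (k : ℕ) (t b R : ℕ → ℕ) (S : (n : ℕ) → Strategy n) → Set
Successful k t b R S =
  ∀ (m : ℕ) → ∃ λ (N : ℕ) → ∀ (n : ℕ) → N ≤ n →
    suc m * (total n (R n) ∸ successes k n (R n) (t n) (b n) (S n)) ≤ total n (R n)

-- t = ω(n^{2-1/k}), i.e. t^k / n^{2k-1} → ∞.
OmegaBound : (k : ℕ) → (ℕ → ℕ) → Set
OmegaBound k t = ∀ (C : ℕ) → ∃ λ (N : ℕ) → ∀ (n : ℕ) → N ≤ n →
  C * n ^ (2 * k ∸ 1) ≤ t n ^ k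

-- b = n^{2k-1+o(1)} / t^{k-1}, i.e. b·t^{k-1} = n^{2k-1+f(n)} with f(n) → 0:
-- for every rational ε = p/q > 0, eventually
-- n^{2k-1-ε} ≤ b·t^{k-1} ≤ n^{2k-1+ε}  (raised to the q-th power).
BudgetBound : (k : ℕ) → (t b : ℕ → ℕ) → Set
BudgetBound k t b = ∀ (p q : ℕ) → ∃ λ (N : ℕ) → ∀ (n : ℕ) → N ≤ n →
  ((b n * t n ^ (k ∸ 1)) ^ suc q ≤ n ^ ((2 * k ∸ 1) * suc q + suc p))
  × (n ^ ((2 * k ∸ 1) * suc q) ≤ (b n * t n ^ (k ∸ 1)) ^ suc q * n ^ suc p)

{-# OPTIONS --safe #-}
module Submission where

-- Write p = t / n².  Cut the vertex set into consecutive blocks of size about m = p⁻ᵏ n^o(1)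
-- (one block when p is near n^(-1/k)) and buy the presented edges joining vertices at cyclic
-- distance O(m): there are about n m p = n^(2k-1+o(1)) / t^(k-1) of them.  The claim is that the
-- random graph contains one of the copies of the k-th power of the cycle which permute each block.
--
-- Expose the random graph in rounds.  Given a random set W and a random copy S, let X be a
-- smallest difference S′ ∖ W, over copies S′ ⊆ W ∪ S.  Then X lies in every copy S″ ⊆ W ∪ X, so
-- it is a subset of a copy chosen from W ∪ X alone, and the pairs (W , X) with |X| large are rare
-- as soon as Σ (λ/p)^|X| P(X ⊆ S), taken over subsets X of a fixed copy U, is small.  This sum is
-- an exponential moment of |U ∩ S|.  Reading U in its cyclic order, a vertex whose position in S
-- is near that of a recent predecessor (probability O(1/m)) closes at most k edges, worth p⁻ᵏ ≪ m,
-- but the first such vertex of a run closes only one, worth p⁻¹ ≤ √m.  So runs cost 1/√m each,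
-- X has O(|U|/√m) edges, and replacing copies by such fragments and repeating removes a factor
-- √m per round.  With one block three rounds suffice, which leaves no logarithmic loss.

open import Defs
open import Data.Nat.Base using (ℕ; zero; suc; pred; _+_; _*_; _∸_; _^_; _≤_; _<_; _⊔_; _⊓_; _≤ᵇ_; _<ᵇ_; _≡ᵇ_; z≤n; s≤s; z<s; _!; NonZero; nonZero; >-nonZero; s≤s⁻¹; _/_; _%_)
open import Data.Nat.Properties
open import Data.Nat.DivMod using (m≡m%n+[m/n]*n; m/n*n≤m; m%n<n; m/n≤m; m*n/n≡m; /-monoˡ-≤)
open import Data.Nat.Tactic.RingSolver using (solve-∀)
open import Data.Bool.Base using (Bool; true; false; if_then_else_; _∧_; _∨_; not; T)
open import Data.Bool.Properties using (T?; T-≡)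
open import Data.Bool.ListAction using (all; any)
open import Data.Nat.ListAction using (sum)
open import Data.Fin.Base using (Fin; toℕ)
open import Data.Fin.Properties using (toℕ<n)
open import Data.List.Base using (List; []; _∷_; [_]; map; concatMap; concat; allFin; upTo; applyUpTo; take; drop; _∷ʳ_; length; _++_; filter; replicate; tabulate)
open import Data.List.Properties using (length-map; length-++; length-upTo; ++-assoc; take++drop≡id; length-take; length-drop; length-replicate; map-∘; map-tabulate; map-upTo; length-applyUpTo; filter-++; filter-accept; length-filter; take-map; take-all)
open import Data.List.Membership.Propositional using (_∈_; find; lose)
open import Data.List.Membership.Propositional.Properties using (∈-∃++; ∈-map⁺; ∈-map⁻; ∈-concatMap⁺; ∈-concatMap⁻; ∈-upTo⁺; ∈-upTo⁻; ∈-++⁺ˡ; ∈-++⁺ʳ; ∈-concat⁺′; ∈-applyUpTo⁻; ∈-allFin)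
open import Data.List.Relation.Unary.Any using (here; there)
open import Data.List.Relation.Unary.Any.Properties using (any⁺; any⁻)
open import Data.List.Relation.Binary.Pointwise.Properties using (Pointwise-length)
open import Data.List.Relation.Unary.All.Properties using () renaming (filter⁺ to All-filter⁺)
open import Algebra.Properties.CommutativeSemigroup *-commutativeSemigroup using (x∙yz≈y∙xz; x∙yz≈yx∙z; xy∙z≈y∙xz; interchange)
open import Data.List.Relation.Binary.Pointwise.Base using (Pointwise; []; _∷_)
open import Data.List.Relation.Unary.All using (All; []; _∷_) renaming (map to mapᴬ; lookup to lookupᴬ; tabulate to tabulateᴬ)
open import Data.List.Relation.Unary.Unique.Propositional using (Unique; []; _∷_)
open import Data.List.Relation.Binary.Permutation.Propositional using (_↭_; ↭-sym; ↭-trans; ↭-refl; ↭-prep; ↭-swap; prep; swap; ↭⇒↭ₛ) renaming (refl to ↭ε; trans to _↭↭_)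
open import Data.List.Relation.Binary.Permutation.Propositional.Properties using (↭-length; ∈-resp-↭; ↭-empty-inv; drop-mid; ↭-map-inv; ++⁺; ++-comm)
open import Data.Vec.Base using (Vec; []; _∷_)
open import Data.Product.Base using (_×_; _,_; ∃; ∃₂; proj₁; proj₂)
open import Data.Sum.Base using (_⊎_; inj₁; inj₂) renaming (swap to ⊎-swap)
open import Relation.Binary.Definitions using (tri<; tri≈; tri>)
open import Data.Empty using (⊥; ⊥-elim)
open import Data.Unit.Base using (⊤; tt)
open import Function.Base using (_∘_; id; case_of_)
open import Function.Bundles using (Equivalence)
open import Relation.Nullary using (¬_; Dec; yes; no; contradiction)
open import Relation.Binary.PropositionalEquality using (_≡_; _≢_; refl; sym; trans; cong; cong₂; subst; subst₂; _≗_; module ≡-Reasoning)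
open import Data.List.Relation.Unary.Unique.Propositional.Properties using (upTo⁺) renaming (filter⁺ to Unique-filter⁺)
open import Relation.Binary.PropositionalEquality.Properties using (setoid)
open import Data.List.Relation.Binary.Permutation.Setoid.Properties using (Unique-resp-↭)

-- The number `a` of rounds separates two ranges of density. With blocks of length r², a copy is
-- used up once r^a exceeds its number of edges, and `a` rounds cost a factor of order a³ in the
-- density. Near the threshold only an unspecified constant factor is available, so `a` has to stay
-- bounded; there the budget exceeds t and purchases are no constraint. For larger t the blocks must
-- be short, r can be as small as n^o(1) and `a` must grow, but then t^k exceeds n^(2k-1) by the
-- factor `gap`, which outgrows every fixed power of `a`. The moment estimate wants independent
-- positions read along a line, while the positions of a copy form a permutation and its structure
-- is cyclic. The first defect costs a constant factor per touched vertex, the second a cut that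
-- misses at most a k/n fraction of the edges. Probabilities appear throughout as natural-number
-- weights, so estimates are stated with denominators cleared.

infixr 8 _·_
_·_ : ∀ {a b c d} → a ≤ b → c ≤ d → a * c ≤ b * d
_·_ = *-mono-≤

-- Indicators and Boolean quantifiers.

𝟙 : Bool → ℕ
𝟙 b = if b then 1 else 0

𝟙≤1 : ∀ b → 𝟙 b ≤ 1
𝟙≤1 true  = ≤-refl
𝟙≤1 false = z≤n

𝟙-T : ∀ {b} → T b → 𝟙 b ≡ 1
𝟙-T {true} _ = refl

𝟙-⇒ : ∀ {b x} → (T b → 1 ≤ x) → 𝟙 b ≤ x
𝟙-⇒ {true}  h = h tt
𝟙-⇒ {false} h = z≤n

𝟙-mono : ∀ {b c} → (T b → T c) → 𝟙 b ≤ 𝟙 c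
𝟙-mono {b} {c} h = 𝟙-⇒ {b} λ p → ≤-reflexive (sym (𝟙-T (h p)))

𝟙-∧ : ∀ b c → 𝟙 (b ∧ c) ≡ 𝟙 b * 𝟙 c
𝟙-∧ true  c = sym (*-identityˡ _)
𝟙-∧ false c = refl

𝟙-+not : ∀ b → 𝟙 b + 𝟙 (not b) ≡ 1
𝟙-+not true  = refl
𝟙-+not false = refl

T-∧⁺ : ∀ {b c} → T b → T c → T (b ∧ c)
T-∧⁺ {true} {true} _ _ = tt

T-∧⁻ : ∀ {b c} → T (b ∧ c) → T b × T c
T-∧⁻ {true} {true} _ = tt , tt

T-∨⁻ : ∀ {b c} → T (b ∨ c) → T b ⊎ T c
T-∨⁻ {true}  _ = inj₁ tt
T-∨⁻ {false} p = inj₂ p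

T-∨⁺ˡ : ∀ {b c} → T b → T (b ∨ c)
T-∨⁺ˡ {true} _ = tt

T-∨⁺ʳ : ∀ {b c} → T c → T (b ∨ c)
T-∨⁺ʳ {true}  _ = tt
T-∨⁺ʳ {false} p = p

T-not⁺ : ∀ {b} → ¬ T b → T (not b)
T-not⁺ {true}  h = h tt
T-not⁺ {false} h = tt

T-not⁻ : ∀ {b} → T (not b) → ¬ T b
T-not⁻ {false} _ ()

module _ {A : Set} where
  T-any⁺ : ∀ (p : A → Bool) {xs x} → x ∈ xs → T (p x) → T (any p xs)
  T-any⁺ p m h = any⁺ p (lose m h)

  T-any⁻ : ∀ (p : A → Bool) xs → T (any p xs) → ∃ λ x → x ∈ xs × T (p x)
  T-any⁻ p xs h = find (any⁻ p xs h)

  T-all⁺ : ∀ (p : A → Bool) xs → (∀ {x} → x ∈ xs → T (p x)) → T (all p xs)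
  T-all⁺ p []       h = tt
  T-all⁺ p (x ∷ xs) h = T-∧⁺ (h (here refl)) (T-all⁺ p xs (h ∘ there))

  T-all⁻ : ∀ (p : A → Bool) {xs x} → T (all p xs) → x ∈ xs → T (p x)
  T-all⁻ p {x ∷ xs} h (here refl) = proj₁ (T-∧⁻ {p x} h)
  T-all⁻ p {x ∷ xs} h (there m)   = T-all⁻ p (proj₂ (T-∧⁻ {p x} h)) m

-- Sums

module _ {A : Set} where
  ∑ : List A → (A → ℕ) → ℕ
  ∑ []       f = 0
  ∑ (x ∷ xs) f = f x + ∑ xs f

  ∑-≡sum : ∀ xs (f : A → ℕ) → sum (map f xs) ≡ ∑ xs f
  ∑-≡sum []       f = refl
  ∑-≡sum (x ∷ xs) f = cong (f x +_) (∑-≡sum xs f)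

  ∑-mono∈ : ∀ xs {f g : A → ℕ} → (∀ {x} → x ∈ xs → f x ≤ g x) → ∑ xs f ≤ ∑ xs g
  ∑-mono∈ []       h = z≤n
  ∑-mono∈ (x ∷ xs) h = +-mono-≤ (h (here refl)) (∑-mono∈ xs (h ∘ there))

  ∑-mono : ∀ xs {f g : A → ℕ} → (∀ x → f x ≤ g x) → ∑ xs f ≤ ∑ xs g
  ∑-mono xs h = ∑-mono∈ xs λ {x} _ → h x

  ∑-cong∈ : ∀ xs {f g : A → ℕ} → (∀ {x} → x ∈ xs → f x ≡ g x) → ∑ xs f ≡ ∑ xs g
  ∑-cong∈ []       h = refl
  ∑-cong∈ (x ∷ xs) h = cong₂ _+_ (h (here refl)) (∑-cong∈ xs (h ∘ there))

  ∑-cong : ∀ xs {f g : A → ℕ} → f ≗ g → ∑ xs f ≡ ∑ xs g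
  ∑-cong xs h = ∑-cong∈ xs λ {x} _ → h x

  ∑-const : ∀ xs c → ∑ xs (λ _ → c) ≡ length xs * c
  ∑-const []       c = refl
  ∑-const (x ∷ xs) c = cong (c +_) (∑-const xs c)

  ∑-zero : ∀ xs → ∑ xs (λ _ → 0) ≡ 0
  ∑-zero xs = trans (∑-const xs 0) (*-zeroʳ (length xs))

  ∑-+ : ∀ xs (f g : A → ℕ) → ∑ xs (λ x → f x + g x) ≡ ∑ xs f + ∑ xs g
  ∑-+ []       f g = refl
  ∑-+ (x ∷ xs) f g rewrite ∑-+ xs f g = lemma (f x) (g x) (∑ xs f) (∑ xs g)
    where lemma : ∀ a b c d → a + b + (c + d) ≡ a + c + (b + d)
          lemma = solve-∀

  ∑-*ˡ : ∀ xs c (f : A → ℕ) → ∑ xs (λ x → c * f x) ≡ c * ∑ xs f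
  ∑-*ˡ []       c f = sym (*-zeroʳ c)
  ∑-*ˡ (x ∷ xs) c f = trans (cong (c * f x +_) (∑-*ˡ xs c f)) (sym (*-distribˡ-+ c (f x) _))

  ∑-*ʳ : ∀ xs c (f : A → ℕ) → ∑ xs (λ x → f x * c) ≡ ∑ xs f * c
  ∑-*ʳ xs c f = trans (∑-cong xs λ x → *-comm (f x) c) (trans (∑-*ˡ xs c f) (*-comm c _))

  ∑-++ : ∀ xs ys (f : A → ℕ) → ∑ (xs ++ ys) f ≡ ∑ xs f + ∑ ys f
  ∑-++ []       ys f = refl
  ∑-++ (x ∷ xs) ys f = trans (cong (f x +_) (∑-++ xs ys f)) (sym (+-assoc (f x) _ _))

  ∑-∈ : ∀ {xs x} (f : A → ℕ) → x ∈ xs → f x ≤ ∑ xs f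
  ∑-∈ f (here refl) = m≤m+n _ _
  ∑-∈ {y ∷ xs} f (there m) = ≤-trans (∑-∈ f m) (m≤n+m _ (f y))

  ∑-↭ : ∀ {xs ys} (f : A → ℕ) → xs ↭ ys → ∑ xs f ≡ ∑ ys f
  ∑-↭ f ↭ε = refl
  ∑-↭ f (prep x p) = cong (f x +_) (∑-↭ f p)
  ∑-↭ {_ ∷ _ ∷ xs} f (swap x y p) =
    trans (cong (λ z → f x + (f y + z)) (∑-↭ f p)) (lemma (f x) (f y) _)
    where lemma : ∀ a b c → a + (b + c) ≡ b + (a + c)
          lemma = solve-∀
  ∑-↭ f (p ↭↭ q) = trans (∑-↭ f p) (∑-↭ f q)

  length-∑1 : ∀ (xs : List A) → length xs ≡ ∑ xs (λ _ → 1)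
  length-∑1 xs = sym (trans (∑-const xs 1) (*-identityʳ _))

module _ {A B : Set} where
  ∑-map : ∀ (g : A → B) xs (f : B → ℕ) → ∑ (map g xs) f ≡ ∑ xs (f ∘ g)
  ∑-map g []       f = refl
  ∑-map g (x ∷ xs) f = cong (f (g x) +_) (∑-map g xs f)

  ∑-concatMap : ∀ (g : A → List B) xs (f : B → ℕ) → ∑ (concatMap g xs) f ≡ ∑ xs (λ x → ∑ (g x) f)
  ∑-concatMap g []       f = refl
  ∑-concatMap g (x ∷ xs) f = trans (∑-++ (g x) _ f) (cong (∑ (g x) f +_) (∑-concatMap g xs f))

  ∑-swap : ∀ xs ys (f : A → B → ℕ) → ∑ xs (λ x → ∑ ys (f x)) ≡ ∑ ys (λ y → ∑ xs (λ x → f x y))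
  ∑-swap []       ys f = sym (∑-zero ys)
  ∑-swap (x ∷ xs) ys f = trans (cong (∑ ys (f x) +_) (∑-swap xs ys f)) (sym (∑-+ ys (f x) _))

module _ {A B : Set} (g : B → List A) where
  ∈-concatMap-intro : ∀ {x xs y} → x ∈ xs → y ∈ g x → y ∈ concatMap g xs
  ∈-concatMap-intro m h = ∈-concatMap⁺ g (lose m h)

  ∈-concatMap-elim : ∀ xs {y} → y ∈ concatMap g xs → ∃ λ x → x ∈ xs × y ∈ g x
  ∈-concatMap-elim xs m = find (∈-concatMap⁻ g {xs = xs} m)

count-≡∑ : ∀ {A : Set} (p : A → Bool) xs → count p xs ≡ ∑ xs (λ x → 𝟙 (p x))
count-≡∑ p xs = ∑-≡sum xs _

-- wsum α β F / (α + β) ^ M is the expectation of F at a random subset of an M-element set which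
-- contains each element independently with probability α / (α + β).
wsum : ℕ → ℕ → ∀ {M} → (Vec Bool M → ℕ) → ℕ
wsum α β {zero}  F = F []
wsum α β {suc M} F = α * wsum α β (λ v → F (true ∷ v)) + β * wsum α β (λ v → F (false ∷ v))

module _ (α β : ℕ) where
  wsum-mono : ∀ {M} {F G : Vec Bool M → ℕ} → (∀ v → F v ≤ G v) → wsum α β F ≤ wsum α β G
  wsum-mono {zero}  h = h []
  wsum-mono {suc M} h = +-mono-≤ (*-monoʳ-≤ α (wsum-mono λ v → h (true ∷ v))) (*-monoʳ-≤ β (wsum-mono λ v → h (false ∷ v)))

  wsum-cong : ∀ {M} {F G : Vec Bool M → ℕ} → (∀ v → F v ≡ G v) → wsum α β F ≡ wsum α β G
  wsum-cong {zero}  h = h []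
  wsum-cong {suc M} h = cong₂ _+_ (cong (α *_) (wsum-cong λ v → h (true ∷ v))) (cong (β *_) (wsum-cong λ v → h (false ∷ v)))

  wsum-const : ∀ M c → wsum α β {M} (λ _ → c) ≡ (α + β) ^ M * c
  wsum-const zero    c = sym (+-identityʳ c)
  wsum-const (suc M) c rewrite wsum-const M c = lemma α β ((α + β) ^ M) c
    where lemma : ∀ a b p c → a * (p * c) + b * (p * c) ≡ (a + b) * p * c
          lemma = solve-∀

  wsum-+ : ∀ {M} (F G : Vec Bool M → ℕ) → wsum α β (λ v → F v + G v) ≡ wsum α β F + wsum α β G
  wsum-+ {zero}  F G = refl
  wsum-+ {suc M} F G
    rewrite wsum-+ (λ v → F (true ∷ v)) (λ v → G (true ∷ v))
          | wsum-+ (λ v → F (false ∷ v)) (λ v → G (false ∷ v))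
    = lemma α β (wsum α β λ v → F (true ∷ v)) (wsum α β λ v → G (true ∷ v)) (wsum α β λ v → F (false ∷ v)) (wsum α β λ v → G (false ∷ v))
    where lemma : ∀ a b p q r s → a * (p + q) + b * (r + s) ≡ a * p + b * r + (a * q + b * s)
          lemma = solve-∀

  wsum-*ˡ : ∀ {M} c (F : Vec Bool M → ℕ) → wsum α β (λ v → c * F v) ≡ c * wsum α β F
  wsum-*ˡ {zero}  c F = refl
  wsum-*ˡ {suc M} c F
    rewrite wsum-*ˡ c (λ v → F (true ∷ v)) | wsum-*ˡ c (λ v → F (false ∷ v))
    = lemma α β c (wsum α β λ v → F (true ∷ v)) (wsum α β λ v → F (false ∷ v))
    where lemma : ∀ a b c p q → a * (c * p) + b * (c * q) ≡ c * (a * p + b * q)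
          lemma = solve-∀

  wsum-lin : ∀ {M} c d (F G : Vec Bool M → ℕ) → wsum α β (λ v → c * F v + d * G v) ≡ c * wsum α β F + d * wsum α β G
  wsum-lin {M} c d F G = trans (wsum-+ {M} _ _) (cong₂ _+_ (wsum-*ˡ {M} c F) (wsum-*ˡ {M} d G))

  wsum-∑ : ∀ {M} {A : Set} (xs : List A) (F : Vec Bool M → A → ℕ) →
           wsum α β (λ v → ∑ xs (F v)) ≡ ∑ xs (λ x → wsum α β (λ v → F v x))
  wsum-∑ {M} []       F = trans (wsum-const M 0) (*-zeroʳ ((α + β) ^ M))
  wsum-∑ (x ∷ xs) F = trans (wsum-+ (λ v → F v x) _) (cong (wsum α β (λ v → F v x) +_) (wsum-∑ xs F))

-- `wsum 1 1` is the unweighted sum over all subsets, so this serves as a union bound over possible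
-- fragments.
wsum-term : ∀ {M} (F : Vec Bool M → ℕ) v → F v ≤ wsum 1 1 F
wsum-term F [] = ≤-refl
wsum-term F (true ∷ v) = ≤-trans (wsum-term (λ v → F (true ∷ v)) v) (≤-trans (≤-reflexive (sym (*-identityˡ _))) (m≤m+n _ _))
wsum-term F (false ∷ v) = ≤-trans (wsum-term (λ v → F (false ∷ v)) v) (≤-trans (≤-reflexive (sym (*-identityˡ _))) (m≤n+m _ (1 * wsum 1 1 λ v → F (true ∷ v))))

-- Subsets as bit vectors, and weighted sums over them.

size : ∀ {M} → Vec Bool M → ℕ
size []      = 0
size (b ∷ v) = 𝟙 b + size v

size≤ : ∀ {M} (v : Vec Bool M) → size v ≤ M
size≤ []      = z≤n
size≤ (b ∷ v) = +-mono-≤ (𝟙≤1 b) (size≤ v)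

infix 5 _⊑ᵇ_
_⊑ᵇ_ : ∀ {M} → Vec Bool M → Vec Bool M → Bool
[]      ⊑ᵇ []      = true
(a ∷ u) ⊑ᵇ (b ∷ v) = (not a ∨ b) ∧ (u ⊑ᵇ v)

disj : ∀ {M} → Vec Bool M → Vec Bool M → Bool
disj []      []      = true
disj (a ∷ u) (b ∷ v) = not (a ∧ b) ∧ disj u v

infixl 7 _∪_ _∩_ _∖_
_∪_ _∩_ _∖_ : ∀ {M} → Vec Bool M → Vec Bool M → Vec Bool M
[]      ∪ []      = []
(a ∷ u) ∪ (b ∷ v) = (a ∨ b) ∷ (u ∪ v)
[]      ∩ []      = []
(a ∷ u) ∩ (b ∷ v) = (a ∧ b) ∷ (u ∩ v)
[]      ∖ []      = []
(a ∷ u) ∖ (b ∷ v) = (a ∧ not b) ∷ (u ∖ v)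

∅ : ∀ {M} → Vec Bool M
∅ {zero}  = []
∅ {suc M} = false ∷ ∅

-- A tilt by c for each element can be moved into the weight of membership. It is used with c = Λ
-- for an exponential Markov bound and with c = 16 to absorb the constant of `cnt-spread`.
wsum-scale : ∀ c x {M} (F : Vec Bool M → ℕ) → wsum (c * x) 1 F ≡ wsum x 1 (λ v → c ^ size v * F v)
wsum-scale c x {zero}  F = sym (+-identityʳ _)
wsum-scale c x {suc M} F
  rewrite wsum-scale c x (λ v → F (true ∷ v)) | wsum-scale c x (λ v → F (false ∷ v))
  = cong₂ _+_ (trans (lemma c x _) (cong (x *_) (trans (sym (wsum-*ˡ x 1 {M} c _)) (wsum-cong x 1 {M} λ v → sym (*-assoc c (c ^ size v) (F (true ∷ v))))))) refl
  where lemma : ∀ c x w → c * x * w ≡ x * (c * w)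
        lemma = solve-∀

-- Only subsets of U ∩ C survive, each with weight y to its size, so this is the binomial theorem.
-- It turns a sum over possible fragments into an exponential moment of an overlap.
wsum-binomial : ∀ y {M} (U C : Vec Bool M) →
  wsum y 1 (λ v → 𝟙 (v ⊑ᵇ U) * 𝟙 (v ⊑ᵇ C)) ≡ (1 + y) ^ size (U ∩ C)
wsum-binomial y []      []      = refl
wsum-binomial y {suc M} (a ∷ U) (b ∷ C) = go a b (wsum-binomial y U C)
  where
  Z : ℕ
  Z = wsum y 1 {M} (λ v → 0)
  Z≡0 : Z ≡ 0
  Z≡0 = trans (wsum-const y 1 M 0) (*-zeroʳ ((y + 1) ^ M))
  Z≡0′ : ∀ (F : Vec Bool M → ℕ) → wsum y 1 (λ v → F v * 0) ≡ 0
  Z≡0′ F = trans (wsum-cong y 1 λ v → *-zeroʳ (F v)) Z≡0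
  lem0 : ∀ y s → y * 0 + 1 * s ≡ s
  lem0 = solve-∀
  lem1 : ∀ y s → y * s + 1 * s ≡ (1 + y) * s
  lem1 = solve-∀
  go : ∀ a b → wsum y 1 (λ v → 𝟙 (v ⊑ᵇ U) * 𝟙 (v ⊑ᵇ C)) ≡ (1 + y) ^ size (U ∩ C) →
       wsum y 1 (λ v → 𝟙 (v ⊑ᵇ (a ∷ U)) * 𝟙 (v ⊑ᵇ (b ∷ C))) ≡ (1 + y) ^ size ((a ∷ U) ∩ (b ∷ C))
  go true  true  e rewrite e = lem1 y _
  go true  false e rewrite e | Z≡0′ (λ v → 𝟙 (v ⊑ᵇ U)) = lem0 y _
  go false true  e rewrite e | Z≡0 = lem0 y _
  go false false e rewrite e | Z≡0 = lem0 y _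

-- A set W has weight q^(M - |W|). If X is disjoint from W and Z = W ∪ X, this equals q^|X| times
-- the weight of Z, so pairs (W , X) can be summed by first choosing Z and then X inside it.
wsum-split : ∀ q {M} (g : Vec Bool M → Vec Bool M → ℕ) →
  wsum 1 q (λ W → wsum 1 1 (λ X → 𝟙 (disj W X) * g (W ∪ X) X)) ≤ wsum 1 q (λ Z → wsum q 1 (λ X → g Z X))
wsum-split q {zero}  g = ≤-reflexive (+-identityʳ _)
wsum-split q {suc M} g = begin
    1 * wsum 1 q (λ W → 1 * wsum 1 1 {M} (λ _ → 0) + 1 * I W (g11 true false)) + q * wsum 1 q (λ W → 1 * I W (g11 true true) + 1 * I W (g11 false false))
  ≡⟨ cong₂ (λ a b → 1 * a + q * b)
       (wsum-cong 1 q λ W → trans (cong (λ z → 1 * z + 1 * I W (g11 true false)) (trans (wsum-const 1 1 M 0) (*-zeroʳ (2 ^ M)))) (*-identityˡ _))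
       (wsum-lin 1 q {M} 1 1 _ _) ⟩
    1 * L (g11 true false) + q * (1 * L (g11 true true) + 1 * L (g11 false false))
  ≤⟨ +-mono-≤ (*-monoʳ-≤ 1 (IH (g11 true false))) (*-monoʳ-≤ q (+-mono-≤ (*-monoʳ-≤ 1 (IH (g11 true true))) (*-monoʳ-≤ 1 (IH (g11 false false))))) ⟩
    1 * R (g11 true false) + q * (1 * R (g11 true true) + 1 * R (g11 false false))
  -- An element in X but not in Z never arises from Z = W ∪ X; adding this term completes the
  -- product form on the right.
  ≤⟨ m≤m+n _ (q * (q * R (g11 false true))) ⟩
    1 * R (g11 true false) + q * (1 * R (g11 true true) + 1 * R (g11 false false)) + q * (q * R (g11 false true))
  ≡⟨ lemma q (R (g11 true false)) (R (g11 true true)) (R (g11 false false)) (R (g11 false true)) ⟩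
    1 * (q * R (g11 true true) + 1 * R (g11 true false)) + q * (q * R (g11 false true) + 1 * R (g11 false false))
  ≡⟨ sym (cong₂ (λ a b → 1 * a + q * b)
       (wsum-lin 1 q {M} q 1 _ _)
       (wsum-lin 1 q {M} q 1 _ _)) ⟩
    1 * wsum 1 q (λ Z → q * wsum q 1 (g11 true true Z) + 1 * wsum q 1 (g11 true false Z)) + q * wsum 1 q (λ Z → q * wsum q 1 (g11 false true Z) + 1 * wsum q 1 (g11 false false Z))
  ∎
  where
  open ≤-Reasoning
  g11 : Bool → Bool → Vec Bool M → Vec Bool M → ℕ
  g11 a b Z X = g (a ∷ Z) (b ∷ X)
  I : Vec Bool M → (Vec Bool M → Vec Bool M → ℕ) → ℕ
  I W h = wsum 1 1 (λ X → 𝟙 (disj W X) * h (W ∪ X) X)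
  L R : (Vec Bool M → Vec Bool M → ℕ) → ℕ
  L h = wsum 1 q (λ W → I W h)
  R h = wsum 1 q (λ Z → wsum q 1 (h Z))
  IH : ∀ h → L h ≤ R h
  IH h = wsum-split q h
  lemma : ∀ q a b c d → 1 * a + q * (1 * b + 1 * c) + q * (q * d) ≡ 1 * (q * b + 1 * a) + q * (q * d + 1 * c)
  lemma = solve-∀

-- The union misses an element exactly when both sets do, which has weight q * β; the other three
-- combinations add up to α + β + q * α.
wsum-∪ : ∀ q α β {M} (F : Vec Bool M → ℕ) →
  wsum α β (λ G → wsum 1 q (λ W → F (G ∪ W))) ≡ wsum (α + β + q * α) (q * β) F
wsum-∪ q α β {zero}  F = refl
wsum-∪ q α β {suc M} F = begin
    α * wsum α β (λ G → 1 * wsum 1 q (λ W → Ft (G ∪ W)) + q * wsum 1 q (λ W → Ft (G ∪ W)))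
      + β * wsum α β (λ G → 1 * wsum 1 q (λ W → Ft (G ∪ W)) + q * wsum 1 q (λ W → Ff (G ∪ W)))
  ≡⟨ cong₂ (λ a b → α * a + β * b) (spl Ft Ft) (spl Ft Ff) ⟩
    α * (1 * wsum α′ β′ Ft + q * wsum α′ β′ Ft) + β * (1 * wsum α′ β′ Ft + q * wsum α′ β′ Ff)
  ≡⟨ lemma α β q (wsum α′ β′ Ft) (wsum α′ β′ Ff) ⟩
    α′ * wsum α′ β′ Ft + β′ * wsum α′ β′ Ff ∎
  where
  open ≡-Reasoning
  α′ β′ : ℕ
  α′ = α + β + q * α
  β′ = q * β
  Ft Ff : Vec Bool M → ℕ
  Ft v = F (true ∷ v)
  Ff v = F (false ∷ v)
  spl : ∀ H K → wsum α β (λ G → 1 * wsum 1 q (λ W → H (G ∪ W)) + q * wsum 1 q (λ W → K (G ∪ W))) ≡ 1 * wsum α′ β′ H + q * wsum α′ β′ K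
  spl H K = trans (wsum-lin α β {M} 1 q _ _) (cong₂ (λ a b → 1 * a + q * b) (wsum-∪ q α β H) (wsum-∪ q α β K))
  lemma : ∀ a b q t f → a * (1 * t + q * t) + b * (1 * t + q * f) ≡ (a + b + q * a) * t + (q * b) * f
  lemma = solve-∀

-- Powers and factorials.

^-distribʳ-* : ∀ a b k → (a * b) ^ k ≡ a ^ k * b ^ k
^-distribʳ-* a b zero    = refl
^-distribʳ-* a b (suc k) rewrite ^-distribʳ-* a b k = interchange a b (a ^ k) (b ^ k)

^-pos : ∀ {a} k → 1 ≤ a → 1 ≤ a ^ k
^-pos zero    h = ≤-refl
^-pos (suc k) h = h · ^-pos k h

^-monoˡ : ∀ {a b} k → a ≤ b → a ^ k ≤ b ^ k
^-monoˡ k h = ^-monoˡ-≤ k h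

^-monoʳ : ∀ {a k l} → 1 ≤ a → k ≤ l → a ^ k ≤ a ^ l
^-monoʳ {suc a} _ h = ^-monoʳ-≤ (suc a) h

-- Bernoulli's inequality (1 - 1/(N+1))^v ≥ 1 - v/(N+1), with w = N + 1 - v.
bernoulli : ∀ N v {w} → v + w ≡ suc N → suc N ^ v * w ≤ N ^ v * suc N
bernoulli N zero    refl = ≤-refl
bernoulli N (suc v) {w} e = begin
    suc N * suc N ^ v * w         ≡⟨ xy∙z≈y∙xz (suc N) (suc N ^ v) w ⟩
    suc N ^ v * (suc N * w)       ≤⟨ *-monoʳ-≤ (suc N ^ v) key ⟩
    suc N ^ v * (N * suc w)       ≡⟨ x∙yz≈y∙xz (suc N ^ v) N (suc w) ⟩
    N * (suc N ^ v * suc w)       ≤⟨ *-monoʳ-≤ N (bernoulli N v (trans (+-suc v w) e)) ⟩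
    N * (N ^ v * suc N)           ≡⟨ sym (*-assoc N (N ^ v) (suc N)) ⟩
    N * N ^ v * suc N             ∎
  where
  open ≤-Reasoning
  N≡ : N ≡ v + w
  N≡ = sym (suc-injective e)
  key : suc N * w ≤ N * suc w
  key = begin
    w + N * w   ≤⟨ +-monoˡ-≤ (N * w) (subst (w ≤_) (sym N≡) (m≤n+m w v)) ⟩
    N + N * w   ≡⟨ sym (*-suc N w) ⟩
    N * suc w   ∎

halves : ∀ N → ∃ λ h → N ≤ 2 * h × 2 * h ≤ suc N
halves zero          = 0 , z≤n , z≤n
halves (suc zero)    = 1 , s≤s z≤n , ≤-refl
halves (suc (suc N)) = let h , p , q = halves N in suc h , subst (2 + N ≤_) (l h) (+-monoʳ-≤ 2 p) , subst (_≤ 3 + N) (l h) (+-monoʳ-≤ 2 q)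
  where l : ∀ h → 2 + 2 * h ≡ 2 * suc h
        l = solve-∀

-- Bernoulli for half of the exponent, squared.
suc^≤4*^ : ∀ N → suc N ^ N ≤ 4 * N ^ N
suc^≤4*^ zero = s≤s z≤n
suc^≤4*^ N@(suc _) with halves N
... | h , p , q = *-cancelʳ-≤ _ _ (suc N) (begin
    suc N ^ N * suc N       ≡⟨ *-comm (suc N ^ N) (suc N) ⟩
    suc N ^ suc N           ≡⟨ cong (suc N ^_) (sym e+) ⟩
    suc N ^ (2 * h + d)     ≡⟨ ^-distribˡ-+-* (suc N) (2 * h) d ⟩
    suc N ^ (2 * h) * suc N ^ d ≤⟨ full · ≤-refl ⟩
    4 * N ^ (2 * h) * suc N ^ d ≤⟨ last d e+ ⟩
    4 * N ^ N * suc N       ∎)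
  where
  open ≤-Reasoning
  d : ℕ
  d = suc N ∸ 2 * h
  e+ : 2 * h + d ≡ suc N
  e+ = m+[n∸m]≡n q
  w : ℕ
  w = suc N ∸ h
  h+w : h + w ≡ suc N
  h+w = m+[n∸m]≡n (≤-trans (m≤m+n h (h + 0)) q)
  sucN≤2w : suc N ≤ 2 * w
  sucN≤2w = +-cancelˡ-≤ (2 * h) _ _ (begin
      2 * h + suc N       ≤⟨ +-monoˡ-≤ (suc N) q ⟩
      suc N + suc N       ≡⟨ cong₂ _+_ (sym h+w) (sym h+w) ⟩
      h + w + (h + w)     ≡⟨ l h w ⟩
      2 * h + 2 * w       ∎)
    where l : ∀ h w → h + w + (h + w) ≡ 2 * h + 2 * w
          l = solve-∀
  half : suc N ^ h ≤ 2 * N ^ h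
  half = *-cancelʳ-≤ _ _ (suc N) (begin
      suc N ^ h * suc N      ≤⟨ *-monoʳ-≤ (suc N ^ h) sucN≤2w ⟩
      suc N ^ h * (2 * w)    ≡⟨ l1 (suc N ^ h) w ⟩
      2 * (suc N ^ h * w)    ≤⟨ *-monoʳ-≤ 2 (bernoulli N h h+w) ⟩
      2 * (N ^ h * suc N)    ≡⟨ sym (*-assoc 2 (N ^ h) (suc N)) ⟩
      2 * N ^ h * suc N      ∎)
    where l1 : ∀ a w → a * (2 * w) ≡ 2 * (a * w)
          l1 = solve-∀
  dbl : ∀ a → a ^ (2 * h) ≡ a ^ h * a ^ h
  dbl a = trans (cong (a ^_) (cong (h +_) (+-identityʳ h))) (^-distribˡ-+-* a h h)
  full : suc N ^ (2 * h) ≤ 4 * N ^ (2 * h)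
  full = begin
      suc N ^ (2 * h)            ≡⟨ dbl (suc N) ⟩
      suc N ^ h * suc N ^ h      ≤⟨ half · half ⟩
      2 * N ^ h * (2 * N ^ h)    ≡⟨ l1 (N ^ h) ⟩
      4 * (N ^ h * N ^ h)        ≡⟨ cong (4 *_) (sym (dbl N)) ⟩
      4 * N ^ (2 * h)            ∎
    where l1 : ∀ a → 2 * a * (2 * a) ≡ 4 * (a * a)
          l1 = solve-∀
  last : ∀ d → 2 * h + d ≡ suc N → 4 * N ^ (2 * h) * suc N ^ d ≤ 4 * N ^ N * suc N
  last zero e = begin
      4 * N ^ (2 * h) * 1     ≡⟨ *-identityʳ _ ⟩
      4 * N ^ (2 * h)         ≡⟨ cong (λ z → 4 * N ^ z) (trans (sym (+-identityʳ _)) e) ⟩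
      4 * (N * N ^ N)         ≡⟨ l1 N (N ^ N) ⟩
      4 * N ^ N * N           ≤⟨ *-monoʳ-≤ (4 * N ^ N) (n≤1+n N) ⟩
      4 * N ^ N * suc N       ∎
    where l1 : ∀ a b → 4 * (a * b) ≡ 4 * b * a
          l1 = solve-∀
  last (suc zero) e = ≤-reflexive (cong₂ (λ a b → 4 * N ^ a * b) (suc-injective (trans (+-comm 1 (2 * h)) e)) (*-identityʳ (suc N)))
  last (suc (suc d)) e = contradiction (≤-trans (+-monoˡ-≤ (2 + d) p) (≤-reflexive e)) (<⇒≱ (subst (suc N <_) (l N d) (m<m+n (suc N) z<s)))
    where l : ∀ N d → suc N + suc d ≡ N + suc (suc d)
          l = solve-∀

self^≤4^*! : ∀ v → v ^ v ≤ 4 ^ v * v !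
self^≤4^*! zero    = ≤-refl
self^≤4^*! (suc v) = begin
    suc v * suc v ^ v          ≤⟨ *-monoʳ-≤ (suc v) (suc^≤4*^ v) ⟩
    suc v * (4 * v ^ v)        ≤⟨ *-monoʳ-≤ (suc v) (*-monoʳ-≤ 4 (self^≤4^*! v)) ⟩
    suc v * (4 * (4 ^ v * v !)) ≡⟨ l (suc v) (4 ^ v) (v !) ⟩
    4 * 4 ^ v * (suc v * v !)  ∎
  where
  open ≤-Reasoning
  l : ∀ a b c → a * (4 * (b * c)) ≡ 4 * b * (a * c)
  l = solve-∀

-- For N = u + v this bounds the number N!/u! of injections of v points below by (N/4)^v. Raising u
-- by one multiplies (u + v)^v by at most (u + v + 1)/(u + 1), by `bernoulli`, and the factorials
-- absorb exactly this ratio.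
^*!≤4^*! : ∀ u v → (u + v) ^ v * u ! ≤ 4 ^ v * (u + v) !
^*!≤4^*! zero    v = ≤-trans (≤-reflexive (*-identityʳ _)) (self^≤4^*! v)
^*!≤4^*! (suc u) v = begin
    suc (u + v) ^ v * (suc u * u !)     ≡⟨ sym (*-assoc (suc (u + v) ^ v) (suc u) (u !)) ⟩
    suc (u + v) ^ v * suc u * u !       ≤⟨ *-monoˡ-≤ (u !) (bernoulli (u + v) v (trans (+-suc v u) (cong suc (+-comm v u)))) ⟩
    (u + v) ^ v * suc (u + v) * u !     ≡⟨ xy∙z≈y∙xz ((u + v) ^ v) (suc (u + v)) (u !) ⟩
    suc (u + v) * ((u + v) ^ v * u !)   ≤⟨ *-monoʳ-≤ (suc (u + v)) (^*!≤4^*! u v) ⟩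
    suc (u + v) * (4 ^ v * (u + v) !)   ≡⟨ x∙yz≈y∙xz (suc (u + v)) (4 ^ v) ((u + v) !) ⟩
    4 ^ v * (suc (u + v) * (u + v) !)   ∎
  where
  open ≤-Reasoning

∸≤⇒≤+ : ∀ m n {o} → m ∸ n ≤ o → m ≤ n + o
∸≤⇒≤+ m n h = ≤-trans (m≤n+m∸n m n) (+-monoʳ-≤ n h)

-- Inclusion, difference and size of subsets.

infix 4 _⊑_
_⊑_ : ∀ {M} → Vec Bool M → Vec Bool M → Set
u ⊑ v = T (u ⊑ᵇ v)

⊑-trans : ∀ {M} {u v w : Vec Bool M} → u ⊑ v → v ⊑ w → u ⊑ w
⊑-trans {u = []} {[]} {[]} _ _ = tt
⊑-trans {u = false ∷ u} {b ∷ v} {c ∷ w} p q = ⊑-trans {u = u} p (proj₂ (T-∧⁻ {not b ∨ c} q))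
⊑-trans {u = true ∷ u} {true ∷ v} {true ∷ w} p q = ⊑-trans {u = u} p q

∖-⊑ : ∀ {M} (u w : Vec Bool M) → u ∖ w ⊑ u
∖-⊑ [] [] = tt
∖-⊑ (true  ∷ u) (true  ∷ w) = ∖-⊑ u w
∖-⊑ (true  ∷ u) (false ∷ w) = ∖-⊑ u w
∖-⊑ (false ∷ u) (_     ∷ w) = ∖-⊑ u w

∖-∖ : ∀ {M} (s g w : Vec Bool M) → s ∖ g ∖ w ≡ s ∖ (g ∪ w)
∖-∖ [] [] [] = refl
∖-∖ (true  ∷ s) (true  ∷ g) (w ∷ ws) = cong (_ ∷_) (∖-∖ s g ws)
∖-∖ (true  ∷ s) (false ∷ g) (w ∷ ws) = cong (_ ∷_) (∖-∖ s g ws)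
∖-∖ (false ∷ s) (_     ∷ g) (w ∷ ws) = cong (_ ∷_) (∖-∖ s g ws)

disj-∖ : ∀ {M} (w u : Vec Bool M) → T (disj w (u ∖ w))
disj-∖ [] [] = tt
disj-∖ (true  ∷ w) (true  ∷ u) = disj-∖ w u
disj-∖ (true  ∷ w) (false ∷ u) = disj-∖ w u
disj-∖ (false ∷ w) (_     ∷ u) = disj-∖ w u

⊑-∪∖ : ∀ {M} (w u : Vec Bool M) → u ⊑ w ∪ (u ∖ w)
⊑-∪∖ [] [] = tt
⊑-∪∖ (w     ∷ ws) (false ∷ u) = ⊑-∪∖ ws u
⊑-∪∖ (true  ∷ ws) (true  ∷ u) = ⊑-∪∖ ws u
⊑-∪∖ (false ∷ ws) (true  ∷ u) = ⊑-∪∖ ws u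

∖-⊑-∪ : ∀ {M} (v w x : Vec Bool M) → v ⊑ w ∪ x → v ∖ w ⊑ x
∖-⊑-∪ [] [] [] _ = tt
∖-⊑-∪ (false ∷ v) (w     ∷ ws) (x    ∷ xs) p = ∖-⊑-∪ v ws xs p
∖-⊑-∪ (true  ∷ v) (true  ∷ ws) (x    ∷ xs) p = ∖-⊑-∪ v ws xs p
∖-⊑-∪ (true  ∷ v) (false ∷ ws) (true ∷ xs) p = ∖-⊑-∪ v ws xs p

size-mono : ∀ {M} (u v : Vec Bool M) → u ⊑ v → size u ≤ size v
size-mono [] [] _ = z≤n
size-mono (false ∷ u) (b    ∷ v) p = ≤-trans (size-mono u v p) (m≤n+m _ (𝟙 b))
size-mono (true  ∷ u) (true ∷ v) p = s≤s (size-mono u v p)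

⊑-size-≡ : ∀ {M} (u v : Vec Bool M) → u ⊑ v → size v ≤ size u → u ≡ v
⊑-size-≡ [] [] _ _ = refl
⊑-size-≡ (false ∷ u) (false ∷ v) p h = cong (false ∷_) (⊑-size-≡ u v p h)
⊑-size-≡ (false ∷ u) (true  ∷ v) p h = contradiction (≤-trans h (size-mono u v p)) (<-irrefl refl)
⊑-size-≡ (true  ∷ u) (true  ∷ v) p h = cong (true ∷_) (⊑-size-≡ u v p (s≤s⁻¹ h))

⊑∅-size : ∀ {M} (u : Vec Bool M) → u ⊑ ∅ → size u ≡ 0
⊑∅-size [] _ = refl
⊑∅-size (false ∷ u) p = ⊑∅-size u p

argmin : ∀ {A : Set} (p : A → Bool) (f : A → ℕ) xs {x} → x ∈ xs → T (p x) →
         ∃ λ y → y ∈ xs × T (p y) × (∀ {z} → z ∈ xs → T (p z) → f y ≤ f z)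
argmin {A} p f xs x∈ px = go xs (T-any⁺ p x∈ px)
  where
  go : ∀ xs → T (any p xs) → ∃ λ y → y ∈ xs × T (p y) × (∀ {z} → z ∈ xs → T (p z) → f y ≤ f z)
  go (x ∷ xs) h with T? (any p xs)
  ... | no ¬q with T-∨⁻ {p x} h
  ...   | inj₂ q = contradiction q ¬q
  ...   | inj₁ q = x , here refl , q , λ { (here refl) _ → ≤-refl ; (there m) pz → contradiction (T-any⁺ p m pz) ¬q }
  go (x ∷ xs) h | yes q with go xs q | T? (p x)
  ... | y , m , py , min | no ¬px = y , there m , py , λ { (here refl) pz → contradiction pz ¬px ; (there m) pz → min m pz }
  ... | y , m , py , min | yes px with ≤-total (f x) (f y)
  ...   | inj₁ le = x , here refl , px , λ { (here refl) _ → ≤-refl ; (there m) pz → ≤-trans le (min m pz) }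
  ...   | inj₂ le = y , there m , py , λ { (here refl) _ → le ; (there m) pz → min m pz }

-- Fragments

module Fragments {M : ℕ} (H : List (Vec Bool M)) where

  -- `G` is the set exposed so far, and the witness is what some copy S′ still misses. For ℓ = 0 a
  -- single good copy certifies that G contains a copy.
  good : ℕ → Vec Bool M → Vec Bool M → Bool
  good ℓ G S = any (λ S′ → (S′ ∖ G ⊑ᵇ S) ∧ (size (S′ ∖ G) ≤ᵇ ℓ)) H

  bad : ℕ → Vec Bool M → ℕ
  bad ℓ G = ∑ H (λ S → 𝟙 (not (good ℓ G S)))

  cnt : Vec Bool M → ℕ
  cnt X = ∑ H (λ S → 𝟙 (X ⊑ᵇ S))

  good⁺ : ∀ {ℓ G S S′} → S′ ∈ H → S′ ∖ G ⊑ S → size (S′ ∖ G) ≤ ℓ → T (good ℓ G S)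
  good⁺ m p q = T-any⁺ _ m (T-∧⁺ p (≤⇒≤ᵇ q))

  good⁻ : ∀ {ℓ G S} → T (good ℓ G S) → ∃ λ S′ → S′ ∈ H × S′ ∖ G ⊑ S × size (S′ ∖ G) ≤ ℓ
  good⁻ {ℓ} {G} {S} h = let S′ , m , r = T-any⁻ _ H h ; p , q = T-∧⁻ {S′ ∖ G ⊑ᵇ S} r in S′ , m , p , ≤ᵇ⇒≤ (size (S′ ∖ G)) ℓ q

  module _ (ℓ : ℕ) (G : Vec Bool M) where
    -- A choice that depends on Z alone. The default ∅ is harmless, since only sets X with more than
    -- ℓ′ elements are counted and ∅ has no such subset.
    pick : List (Vec Bool M) → Vec Bool M → Vec Bool M
    pick []       Z = ∅
    pick (S ∷ Ss) Z = if (size (S ∖ G) ≤ᵇ ℓ) ∧ (S ∖ G ⊑ᵇ Z) then S ∖ G else pick Ss Z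

    pick-∈ : ∀ Ss Z → pick Ss Z ≡ ∅ ⊎ ∃ λ S → S ∈ Ss × pick Ss Z ≡ S ∖ G × size (S ∖ G) ≤ ℓ
    pick-∈ []       Z = inj₁ refl
    pick-∈ (S ∷ Ss) Z with size (S ∖ G) ≤ᵇ ℓ in e | S ∖ G ⊑ᵇ Z
    ... | true | true = inj₂ (S , here refl , refl , ≤ᵇ⇒≤ _ ℓ (Equivalence.from T-≡ e))
    ... | true | false with pick-∈ Ss Z
    ...   | inj₁ p = inj₁ p
    ...   | inj₂ (S′ , m , r) = inj₂ (S′ , there m , r)
    pick-∈ (S ∷ Ss) Z | false | _ with pick-∈ Ss Z
    ...   | inj₁ p = inj₁ p
    ...   | inj₂ (S′ , m , r) = inj₂ (S′ , there m , r)

    pick-spec : ∀ {Ss Z S} → S ∈ Ss → size (S ∖ G) ≤ ℓ → S ∖ G ⊑ Z →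
                ∃ λ S′ → S′ ∈ Ss × pick Ss Z ≡ S′ ∖ G × size (S′ ∖ G) ≤ ℓ × S′ ∖ G ⊑ Z
    pick-spec {S₀ ∷ Ss} {Z} m p q with size (S₀ ∖ G) ≤ᵇ ℓ in e | S₀ ∖ G ⊑ᵇ Z in e′
    ... | true | true = S₀ , here refl , refl , ≤ᵇ⇒≤ _ ℓ (Equivalence.from T-≡ e) , Equivalence.from T-≡ e′
    pick-spec (here refl) p q | true | false = ⊥-elim (subst T e′ q)
    pick-spec (there m) p q | true | false = let S′ , m′ , r = pick-spec m p q in S′ , there m′ , r
    pick-spec (here refl) p q | false | _ = ⊥-elim (subst T e (≤⇒≤ᵇ p))
    pick-spec (there m) p q | false | _ = let S′ , m′ , r = pick-spec m p q in S′ , there m′ , r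

    -- X is a minimum fragment U ∖ W; it lies inside the set picked from W ∪ X alone,
    -- so the pair (W , X) is recovered from few choices given W ∪ X.
    bad-step : ∀ ℓ′ W S → 𝟙 (not (good ℓ′ (G ∪ W) S)) ≤ 𝟙 (not (good ℓ G S)) +
      wsum 1 1 (λ X → 𝟙 (disj W X) * (𝟙 (X ⊑ᵇ pick H (W ∪ X)) * (𝟙 (ℓ′ <ᵇ size X) * 𝟙 (X ⊑ᵇ S))))
    bad-step ℓ′ W S with T? (good ℓ G S)
    ... | no ¬g = ≤-trans (𝟙≤1 (not (good ℓ′ (G ∪ W) S))) (≤-trans (≤-reflexive (sym (𝟙-T (T-not⁺ ¬g)))) (m≤m+n _ _))
    ... | yes g = 𝟙-⇒ λ ¬g′ → ≤-trans (main (T-not⁻ ¬g′)) (m≤n+m _ (𝟙 (not (good ℓ G S))))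
      where
      F : Vec Bool M → ℕ
      F X = 𝟙 (disj W X) * (𝟙 (X ⊑ᵇ pick H (W ∪ X)) * (𝟙 (ℓ′ <ᵇ size X) * 𝟙 (X ⊑ᵇ S)))
      one : ∀ {a b c d} → T a → T b → T c → T d → 1 ≤ 𝟙 a * (𝟙 b * (𝟙 c * 𝟙 d))
      one {true} {true} {true} {true} _ _ _ _ = ≤-refl
      main : ¬ T (good ℓ′ (G ∪ W) S) → 1 ≤ wsum 1 1 F
      main ¬g′ with good⁻ g
      -- The minimum is over copies which miss at most ℓ elements of G and whose part missed by both
      -- G and W lies in S; the witness S₀ for goodness of S is one of them.
      ... | S₀ , m₀ , p₀ , q₀ with argmin (λ S′ → (size (S′ ∖ G) ≤ᵇ ℓ) ∧ (S′ ∖ G ∖ W ⊑ᵇ S)) (λ S′ → size (S′ ∖ G ∖ W)) H m₀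
                                   (T-∧⁺ (≤⇒≤ᵇ q₀) (⊑-trans {u = S₀ ∖ G ∖ W} (∖-⊑ (S₀ ∖ G) W) p₀))
      ... | S₁ , m₁ , c₁ , min with T-∧⁻ {size (S₁ ∖ G) ≤ᵇ ℓ} c₁
      ... | q₁ , p₁ with pick-spec {Z = W ∪ (S₁ ∖ G ∖ W)} m₁ (≤ᵇ⇒≤ _ ℓ q₁) (⊑-∪∖ W (S₁ ∖ G))
      ... | S₂ , m₂ , e₂ , q₂ , p₂ = ≤-trans (one (disj-∖ W (S₁ ∖ G)) inpick (<⇒<ᵇ big) p₁) (wsum-term F X)
        where
        X : Vec Bool M
        X = S₁ ∖ G ∖ W
        sub : S₂ ∖ G ∖ W ⊑ X
        sub = ∖-⊑-∪ (S₂ ∖ G) W X p₂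
        -- The picked copy S₂ competes in the minimum, and what it misses lies inside X, so
        -- minimality forces equality.
        eq : S₂ ∖ G ∖ W ≡ X
        eq = ⊑-size-≡ _ X sub (min m₂ (T-∧⁺ (≤⇒≤ᵇ q₂) (⊑-trans {u = S₂ ∖ G ∖ W} sub p₁)))
        inpick : X ⊑ pick H (W ∪ X)
        inpick = subst (X ⊑_) (sym e₂) (subst (_⊑ S₂ ∖ G) eq (∖-⊑ (S₂ ∖ G) W))
        big : ℓ′ < size X
        big = ≰⇒> λ le → ¬g′ (good⁺ m₁ (subst (_⊑ S) (∖-∖ S₁ G W) p₁) (subst (λ z → size z ≤ ℓ′) (∖-∖ S₁ G W) le))

  -- A copy that turns bad when W is exposed yields a pair (W , X) with X large. `wsum-split` sums
  -- these pairs by Z = W ∪ X, and for each Z the sets X range over subsets of the one set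
  -- `pick ℓ G H Z`, where the hypothesis bounds the weighted count by β.
  fragment : ∀ q ℓ ℓ′ G β →
    (∀ {S} → S ∈ H → size (S ∖ G) ≤ ℓ → wsum q 1 (λ X → 𝟙 (X ⊑ᵇ S ∖ G) * (𝟙 (ℓ′ <ᵇ size X) * cnt X)) ≤ β) →
    wsum 1 q (λ W → bad ℓ′ (G ∪ W)) ≤ (1 + q) ^ M * (bad ℓ G + β)
  fragment q ℓ ℓ′ G β hyp = begin
      wsum 1 q (λ W → bad ℓ′ (G ∪ W))
    ≤⟨ wsum-mono 1 q (λ W → ≤-trans (∑-mono H (bad-step ℓ G ℓ′ W)) (≤-reflexive (step W))) ⟩
      wsum 1 q (λ W → bad ℓ G + wsum 1 1 (λ X → 𝟙 (disj W X) * g (W ∪ X) X))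
    ≡⟨ wsum-+ 1 q {M} _ _ ⟩
      wsum 1 q {M} (λ W → bad ℓ G) + wsum 1 q (λ W → wsum 1 1 (λ X → 𝟙 (disj W X) * g (W ∪ X) X))
    ≤⟨ +-mono-≤ (≤-reflexive (wsum-const 1 q M _)) (wsum-split q g) ⟩
      (1 + q) ^ M * bad ℓ G + wsum 1 q (λ Z → wsum q 1 (λ X → g Z X))
    ≤⟨ +-monoʳ-≤ _ (wsum-mono 1 q inner) ⟩
      (1 + q) ^ M * bad ℓ G + wsum 1 q {M} (λ Z → β)
    ≡⟨ cong ((1 + q) ^ M * bad ℓ G +_) (wsum-const 1 q M β) ⟩
      (1 + q) ^ M * bad ℓ G + (1 + q) ^ M * β
    ≡⟨ sym (*-distribˡ-+ ((1 + q) ^ M) _ β) ⟩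
      (1 + q) ^ M * (bad ℓ G + β) ∎
    where
    open ≤-Reasoning
    g : Vec Bool M → Vec Bool M → ℕ
    g Z X = 𝟙 (X ⊑ᵇ pick ℓ G H Z) * (𝟙 (ℓ′ <ᵇ size X) * cnt X)
    step : ∀ W → ∑ H (λ S → 𝟙 (not (good ℓ G S)) + wsum 1 1 (λ X → 𝟙 (disj W X) * (𝟙 (X ⊑ᵇ pick ℓ G H (W ∪ X)) * (𝟙 (ℓ′ <ᵇ size X) * 𝟙 (X ⊑ᵇ S)))))
           ≡ bad ℓ G + wsum 1 1 (λ X → 𝟙 (disj W X) * g (W ∪ X) X)
    step W = trans (∑-+ H _ _) (cong (bad ℓ G +_) (trans (sym (wsum-∑ 1 1 {M} H _)) (wsum-cong 1 1 {M} λ X →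
               trans (∑-*ˡ H (𝟙 (disj W X)) _) (cong (𝟙 (disj W X) *_) (trans (∑-*ˡ H (𝟙 (X ⊑ᵇ pick ℓ G H (W ∪ X))) _) (cong (𝟙 (X ⊑ᵇ pick ℓ G H (W ∪ X)) *_) (∑-*ˡ H (𝟙 (ℓ′ <ᵇ size X)) _)))))))
    inner : ∀ Z → wsum q 1 (λ X → g Z X) ≤ β
    inner Z with pick ℓ G H Z | pick-∈ ℓ G H Z
    ... | _ | inj₂ (S , m , refl , le) = hyp m le
    ... | _ | inj₁ refl = ≤-trans (≤-reflexive (trans (wsum-cong q 1 {M} zero-at) (trans (wsum-const q 1 M 0) (*-zeroʳ ((q + 1) ^ M))))) z≤n
      where
      zero-at : ∀ X → 𝟙 (X ⊑ᵇ ∅) * (𝟙 (ℓ′ <ᵇ size X) * cnt X) ≡ 0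
      zero-at X with T? (X ⊑ᵇ ∅)
      ... | yes p rewrite ⊑∅-size X p = *-zeroʳ (𝟙 (X ⊑ᵇ ∅))
      ... | no ¬p with X ⊑ᵇ ∅
      ...   | true = contradiction tt ¬p
      ...   | false = refl

-- Random permutations of blocks against independent random positions

picks : List ℕ → List (ℕ × List ℕ)
picks []       = []
picks (x ∷ xs) = (x , xs) ∷ map (λ p → proj₁ p , x ∷ proj₂ p) (picks xs)

-- For j = length A these are the permutations of A, drawn coordinate by coordinate (unlike `perms`,
-- which inserts), so that marked and unmarked coordinates can be summed out in turn.
sel : ℕ → List ℕ → List (List ℕ)
sel zero    A = [] ∷ []
sel (suc j) A = concatMap (λ p → map (proj₁ p ∷_) (sel j (proj₂ p))) (picks A)

picks-↭ : ∀ {A p} → p ∈ picks A → A ↭ proj₁ p ∷ proj₂ p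
picks-↭ {x ∷ xs} (here refl) = ↭-refl
picks-↭ {x ∷ xs} (there m) with ∈-map⁻ _ m
... | (q , B) , m′ , refl = ↭-trans (↭-prep x (picks-↭ m′)) (↭-swap x q ↭-refl)

picks-length : ∀ {A p} → p ∈ picks A → length A ≡ suc (length (proj₂ p))
picks-length m = ↭-length (picks-↭ m)

∑-picks : ∀ A (h : ℕ → ℕ) → ∑ (picks A) (h ∘ proj₁) ≡ ∑ A h
∑-picks []       h = refl
∑-picks (x ∷ xs) h = cong (h x +_) (trans (∑-map _ (picks xs) _) (∑-picks xs h))

-- Two successive draws without repetition are exchangeable; this moves the draw of an unmarked
-- coordinate past those of the marked ones.
∑∑-picks-swap : ∀ A (F : ℕ → ℕ → List ℕ → ℕ) →
  ∑ (picks A) (λ p → ∑ (picks (proj₂ p)) (λ r → F (proj₁ p) (proj₁ r) (proj₂ r))) ≡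
  ∑ (picks A) (λ p → ∑ (picks (proj₂ p)) (λ r → F (proj₁ r) (proj₁ p) (proj₂ r)))
∑∑-picks-swap []       F = refl
∑∑-picks-swap (x ∷ xs) F = begin
    S (F x) + ∑ (map _ (picks xs)) _                      ≡⟨ cong (S (F x) +_) (inner F) ⟩
    S (F x) + (S (λ q → F q x) + D F′)                    ≡⟨ l (S (F x)) (S (λ q → F q x)) (D F′) ⟩
    S (λ q → F q x) + (S (F x) + D F′)                    ≡⟨ cong (λ z → S (λ q → F q x) + (S (F x) + z)) (∑∑-picks-swap xs F′) ⟩
    S (λ q → F q x) + (S (F x) + D (λ a b → F′ b a))      ≡⟨ cong (S (λ q → F q x) +_) (sym (inner (λ a b → F b a))) ⟩
    S (λ q → F q x) + ∑ (map _ (picks xs)) _              ∎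
  where
  open ≡-Reasoning
  S : (ℕ → List ℕ → ℕ) → ℕ
  S h = ∑ (picks xs) (λ p → h (proj₁ p) (proj₂ p))
  D : (ℕ → ℕ → List ℕ → ℕ) → ℕ
  D G = ∑ (picks xs) (λ p → ∑ (picks (proj₂ p)) (λ r → G (proj₁ p) (proj₁ r) (proj₂ r)))
  F′ : ℕ → ℕ → List ℕ → ℕ
  F′ a b B = F a b (x ∷ B)
  inner : ∀ G → ∑ (map (λ p → proj₁ p , x ∷ proj₂ p) (picks xs)) (λ p → ∑ (picks (proj₂ p)) (λ r → G (proj₁ p) (proj₁ r) (proj₂ r)))
          ≡ S (λ q → G q x) + D (λ a b B → G a b (x ∷ B))
  inner G = trans (∑-map _ (picks xs) _) (trans (∑-cong (picks xs) λ p → cong (G (proj₁ p) x (proj₂ p) +_) (∑-map _ (picks (proj₂ p)) _)) (∑-+ (picks xs) _ _))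
  l : ∀ a b c → a + (b + c) ≡ b + (a + c)
  l = solve-∀

∑-sel : ∀ j A (F : List ℕ → ℕ) → ∑ (sel (suc j) A) F ≡ ∑ (picks A) (λ p → ∑ (sel j (proj₂ p)) (λ f → F (proj₁ p ∷ f)))
∑-sel j A F = trans (∑-concatMap _ (picks A) F) (∑-cong (picks A) λ p → ∑-map _ (sel j (proj₂ p)) F)

length-sel : ∀ j A → length A ≡ j → length (sel j A) ≡ j !
length-sel j A e = trans (length-∑1 (sel j A)) (go j A e)
  where
  go : ∀ j A → length A ≡ j → ∑ (sel j A) (λ _ → 1) ≡ j !
  go zero    A e = refl
  go (suc j) A e = trans (∑-sel j A _) (trans (∑-cong∈ (picks A) λ m → go j _ (suc-injective (trans (sym (picks-length m)) e)))
    (trans (∑-picks A (λ _ → j !)) (trans (∑-const A (j !)) (cong (_* j !) e))))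

∈-sel⇒↭ : ∀ {j A f} → length A ≡ j → f ∈ sel j A → f ↭ A
∈-sel⇒↭ {zero}  {[]} e (here refl) = ↭-refl
∈-sel⇒↭ {suc j} {A} e m with ∈-concatMap-elim (λ p → map (proj₁ p ∷_) (sel j (proj₂ p))) (picks A) m
... | p , mp , mf with ∈-map⁻ _ mf
... | g , mg , refl = ↭-trans (↭-prep _ (∈-sel⇒↭ (suc-injective (trans (sym (picks-length mp)) e)) mg)) (↭-sym (picks-↭ mp))

keep : Bool → ℕ → ℕ
keep b q = if b then q else 0

-- Unmarked coordinates become 0, so that a function of mask fl f depends on the marked ones only.
mask : List Bool → List ℕ → List ℕ
mask []       f       = []
mask (b ∷ fl) []      = []
mask (b ∷ fl) (q ∷ f) = keep b q ∷ mask fl f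

mask-++ : ∀ fl gl f g → length fl ≡ length f → mask (fl ++ gl) (f ++ g) ≡ mask fl f ++ mask gl g
mask-++ []       gl []      g e = refl
mask-++ (b ∷ fl) gl (q ∷ f) g e = cong (keep b q ∷_) (mask-++ fl gl f g (suc-injective e))

∑Π : List (List ℕ) → (List ℕ → ℕ) → ℕ
∑Π []       F = F []
∑Π (R ∷ Rs) F = ∑ R (λ q → ∑Π Rs (λ f → F (q ∷ f)))

∑Π-mono : ∀ Rs {F G : List ℕ → ℕ} → (∀ {f} → Pointwise _∈_ f Rs → F f ≤ G f) → ∑Π Rs F ≤ ∑Π Rs G
∑Π-mono []       h = h []
∑Π-mono (R ∷ Rs) h = ∑-mono∈ R λ m → ∑Π-mono Rs λ ms → h (m ∷ ms)

∑Π-cong : ∀ Rs {F G : List ℕ → ℕ} → (∀ {f} → Pointwise _∈_ f Rs → F f ≡ G f) → ∑Π Rs F ≡ ∑Π Rs G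
∑Π-cong []       h = h []
∑Π-cong (R ∷ Rs) h = ∑-cong∈ R λ m → ∑Π-cong Rs λ ms → h (m ∷ ms)

∑Π-*ˡ : ∀ Rs c (F : List ℕ → ℕ) → ∑Π Rs (λ f → c * F f) ≡ c * ∑Π Rs F
∑Π-*ˡ []       c F = refl
∑Π-*ˡ (R ∷ Rs) c F = trans (∑-cong R λ q → ∑Π-*ˡ Rs c _) (∑-*ˡ R c _)

∑Π-++ : ∀ Rs Ss (F : List ℕ → ℕ) → ∑Π (Rs ++ Ss) F ≡ ∑Π Rs (λ f → ∑Π Ss (λ g → F (f ++ g)))
∑Π-++ []       Ss F = refl
∑Π-++ (R ∷ Rs) Ss F = ∑-cong R λ q → ∑Π-++ Rs Ss _

∑Π-replicate-const : ∀ N A → ∑Π (replicate N A) (λ _ → 1) ≡ length A ^ N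
∑Π-replicate-const zero    A = refl
∑Π-replicate-const (suc N) A = trans (∑-cong A λ _ → ∑Π-replicate-const N A) (∑-const A _)

trues falses : List Bool → ℕ
trues fl  = ∑ fl 𝟙
falses fl = ∑ fl (𝟙 ∘ not)

falses+trues : ∀ fl → falses fl + trues fl ≡ length fl
falses+trues []           = refl
falses+trues (true ∷ fl)  = trans (+-suc (falses fl) _) (cong suc (falses+trues fl))
falses+trues (false ∷ fl) = cong suc (falses+trues fl)

-- Sums over the assignments of values in A to the marked coordinates, without and with repetition,
-- in the format of `mask`.
∑Inj ∑Fun : List Bool → List ℕ → (List ℕ → ℕ) → ℕ
∑Inj []           A P = P []
∑Inj (true  ∷ fl) A P = ∑ (picks A) (λ p → ∑Inj fl (proj₂ p) (λ f → P (proj₁ p ∷ f)))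
∑Inj (false ∷ fl) A P = ∑Inj fl A (λ f → P (0 ∷ f))
∑Fun []           A P = P []
∑Fun (true  ∷ fl) A P = ∑ A (λ q → ∑Fun fl A (λ f → P (q ∷ f)))
∑Fun (false ∷ fl) A P = ∑Fun fl A (λ f → P (0 ∷ f))

-- An injective assignment uses `trues fl` of the values and therefore survives the removal of any
-- of the u others.
∑-picks-∑Inj : ∀ fl A P {u} → length A ≡ trues fl + u → ∑ (picks A) (λ p → ∑Inj fl (proj₂ p) P) ≡ u * ∑Inj fl A P
∑-picks-∑Inj []           A P refl = trans (∑-picks A (λ _ → P [])) (∑-const A (P []))
∑-picks-∑Inj (false ∷ fl) A P e = ∑-picks-∑Inj fl A (λ f → P (0 ∷ f)) e
∑-picks-∑Inj (true ∷ fl)  A P {u} e = begin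
    ∑ (picks A) (λ p → ∑ (picks (proj₂ p)) (λ r → ∑Inj fl (proj₂ r) (λ f → P (proj₁ r ∷ f))))
  ≡⟨ ∑∑-picks-swap A (λ _ b B → ∑Inj fl B (λ f → P (b ∷ f))) ⟩
    ∑ (picks A) (λ p → ∑ (picks (proj₂ p)) (λ r → ∑Inj fl (proj₂ r) (λ f → P (proj₁ p ∷ f))))
  ≡⟨ ∑-cong∈ (picks A) (λ {p} m → ∑-picks-∑Inj fl (proj₂ p) (λ f → P (proj₁ p ∷ f)) {u} (suc-injective (trans (sym (picks-length m)) e))) ⟩
    ∑ (picks A) (λ p → u * ∑Inj fl (proj₂ p) (λ f → P (proj₁ p ∷ f)))
  ≡⟨ ∑-*ˡ (picks A) u _ ⟩
    u * ∑ (picks A) (λ p → ∑Inj fl (proj₂ p) (λ f → P (proj₁ p ∷ f))) ∎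
  where open ≡-Reasoning

-- Once the marked coordinates are fixed, the unmarked ones can be filled in `falses fl !` ways.
∑-sel-mask : ∀ fl A P → length A ≡ length fl → ∑ (sel (length fl) A) (P ∘ mask fl) ≡ falses fl ! * ∑Inj fl A P
∑-sel-mask []           A P e = refl
∑-sel-mask (true ∷ fl)  A P e = trans (∑-sel (length fl) A _)
  (trans (∑-cong∈ (picks A) λ {p} m → ∑-sel-mask fl (proj₂ p) (λ f → P (proj₁ p ∷ f)) (suc-injective (trans (sym (picks-length m)) e)))
  (∑-*ˡ (picks A) (falses fl !) _))
∑-sel-mask (false ∷ fl) A P e = begin
    ∑ (sel (suc (length fl)) A) (P ∘ mask (false ∷ fl))
  ≡⟨ ∑-sel (length fl) A _ ⟩
    ∑ (picks A) (λ p → ∑ (sel (length fl) (proj₂ p)) (λ f → P (0 ∷ mask fl f)))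
  ≡⟨ ∑-cong∈ (picks A) (λ {p} m → ∑-sel-mask fl (proj₂ p) (λ f → P (0 ∷ f)) (suc-injective (trans (sym (picks-length m)) e))) ⟩
    ∑ (picks A) (λ p → falses fl ! * ∑Inj fl (proj₂ p) (λ f → P (0 ∷ f)))
  ≡⟨ ∑-*ˡ (picks A) (falses fl !) _ ⟩
    falses fl ! * ∑ (picks A) (λ p → ∑Inj fl (proj₂ p) (λ f → P (0 ∷ f)))
  ≡⟨ cong (falses fl ! *_) (∑-picks-∑Inj fl A _ {suc (falses fl)} (trans e (trans (cong suc (trans (sym (falses+trues fl)) (+-comm (falses fl) _))) (sym (+-suc (trues fl) _))))) ⟩
    falses fl ! * (suc (falses fl) * ∑Inj fl A (λ f → P (0 ∷ f)))
  ≡⟨ x∙yz≈yx∙z (falses fl !) (suc (falses fl)) _ ⟩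
    suc (falses fl) * falses fl ! * ∑Inj fl A (λ f → P (0 ∷ f)) ∎
  where
  open ≡-Reasoning

∑Inj≤∑Fun : ∀ fl A B P → (∀ g → ∑ A g ≤ ∑ B g) → ∑Inj fl A P ≤ ∑Fun fl B P
∑Inj≤∑Fun []           A B P h = ≤-refl
∑Inj≤∑Fun (false ∷ fl) A B P h = ∑Inj≤∑Fun fl A B _ h
∑Inj≤∑Fun (true ∷ fl)  A B P h = begin
    ∑ (picks A) (λ p → ∑Inj fl (proj₂ p) (λ f → P (proj₁ p ∷ f)))
  ≤⟨ ∑-mono∈ (picks A) (λ {p} m → ∑Inj≤∑Fun fl (proj₂ p) B _ λ g → ≤-trans (≤-trans (m≤n+m _ (g (proj₁ p))) (≤-reflexive (sym (∑-↭ g (picks-↭ m))))) (h g)) ⟩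
    ∑ (picks A) (λ p → ∑Fun fl B (λ f → P (proj₁ p ∷ f)))
  ≡⟨ ∑-picks A (λ q → ∑Fun fl B (λ f → P (q ∷ f))) ⟩
    ∑ A (λ q → ∑Fun fl B (λ f → P (q ∷ f)))
  ≤⟨ h _ ⟩
    ∑ B (λ q → ∑Fun fl B (λ f → P (q ∷ f))) ∎
  where open ≤-Reasoning

∑Π-mask : ∀ fl A P → ∑Π (replicate (length fl) A) (P ∘ mask fl) ≡ length A ^ falses fl * ∑Fun fl A P
∑Π-mask []           A P = sym (+-identityʳ _)
∑Π-mask (true ∷ fl)  A P = trans (∑-cong A λ q → ∑Π-mask fl A (λ f → P (q ∷ f))) (∑-*ˡ A (length A ^ falses fl) _)
∑Π-mask (false ∷ fl) A P = trans (∑-cong A λ q → ∑Π-mask fl A (λ f → P (0 ∷ f)))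
  (trans (∑-const A _) (sym (*-assoc (length A) (length A ^ falses fl) _)))

-- On the marked coordinates a uniform permutation is a uniform injection. Injections are functions,
-- and by `^*!≤4^*!` they are not too rare among them, so passing to independent uniform positions
-- costs a factor 4 per marked coordinate.
block-spread : ∀ fl A P → length A ≡ length fl →
  length A ^ length fl * ∑ (sel (length fl) A) (P ∘ mask fl) ≤ 4 ^ trues fl * (length fl ! * ∑Π (replicate (length fl) A) (P ∘ mask fl))
block-spread fl A P e = begin
    length A ^ length fl * ∑ (sel (length fl) A) (P ∘ mask fl)
  ≡⟨ cong₂ _*_ (cong₂ _^_ N≡ (sym (falses+trues fl))) (∑-sel-mask fl A P e) ⟩
    (u + v) ^ (u + v) * (u ! * ∑Inj fl A P)
  ≡⟨ cong (_* (u ! * ∑Inj fl A P)) (^-distribˡ-+-* (u + v) u v) ⟩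
    (u + v) ^ u * (u + v) ^ v * (u ! * ∑Inj fl A P)
  ≡⟨ l1 ((u + v) ^ u) ((u + v) ^ v) (u !) _ ⟩
    (u + v) ^ v * u ! * ((u + v) ^ u * ∑Inj fl A P)
  ≤⟨ ^*!≤4^*! u v · *-monoʳ-≤ ((u + v) ^ u) (∑Inj≤∑Fun fl A A P (λ g → ≤-refl)) ⟩
    4 ^ v * (u + v) ! * ((u + v) ^ u * ∑Fun fl A P)
  ≡⟨ *-assoc (4 ^ v) _ _ ⟩
    4 ^ v * ((u + v) ! * ((u + v) ^ u * ∑Fun fl A P))
  ≡⟨ cong₂ (λ a b → 4 ^ v * (a ! * b)) (falses+trues fl) (trans (cong (λ z → z ^ u * ∑Fun fl A P) (sym N≡)) (sym (∑Π-mask fl A P))) ⟩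
    4 ^ v * (length fl ! * ∑Π (replicate (length fl) A) (P ∘ mask fl)) ∎
  where
  open ≤-Reasoning
  u v : ℕ
  u = falses fl
  v = trues fl
  N≡ : length A ≡ u + v
  N≡ = trans e (sym (falses+trues fl))
  l1 : ∀ a b c d → a * b * (c * d) ≡ b * c * (a * d)
  l1 = solve-∀

blockPerms : List (List ℕ) → List (List ℕ)
blockPerms []       = [] ∷ []
blockPerms (A ∷ As) = concatMap (λ f → map (f ++_) (blockPerms As)) (sel (length A) A)

-- With these lists `∑Π` lets every vertex choose its position within its own block, independently
-- of the others.
ranges : List (List ℕ) → List (List ℕ)
ranges []       = []
ranges (A ∷ As) = replicate (length A) A ++ ranges As

∑-blockPerms : ∀ A As (F : List ℕ → ℕ) → ∑ (blockPerms (A ∷ As)) F ≡ ∑ (sel (length A) A) (λ f → ∑ (blockPerms As) (λ g → F (f ++ g)))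
∑-blockPerms A As F = trans (∑-concatMap _ (sel (length A) A) F) (∑-cong (sel (length A) A) λ f → ∑-map _ (blockPerms As) F)

length-blockPerms : ∀ A As → length (blockPerms (A ∷ As)) ≡ length A ! * length (blockPerms As)
length-blockPerms A As = begin
    length (blockPerms (A ∷ As))                                      ≡⟨ length-∑1 (blockPerms (A ∷ As)) ⟩
    ∑ (blockPerms (A ∷ As)) (λ _ → 1)                                 ≡⟨ ∑-blockPerms A As _ ⟩
    ∑ (sel (length A) A) (λ f → ∑ (blockPerms As) (λ g → 1))          ≡⟨ ∑-const (sel (length A) A) _ ⟩
    length (sel (length A) A) * ∑ (blockPerms As) (λ g → 1)           ≡⟨ cong₂ _*_ (length-sel (length A) A refl) (sym (length-∑1 (blockPerms As))) ⟩
    length A ! * length (blockPerms As)                               ∎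
  where open ≡-Reasoning

length-blockPerms-pos : ∀ As → 1 ≤ length (blockPerms As)
length-blockPerms-pos []       = ≤-refl
length-blockPerms-pos (A ∷ As) = subst (1 ≤_) (sym (length-blockPerms A As)) (1≤n! (length A) · length-blockPerms-pos As)

-- Blocks are permuted independently, so the costs multiply: the later blocks are replaced with the
-- first one fixed, and `block-spread` is then applied to the resulting function P′ of the first
-- block.
blockPerms-spread : ∀ As fl P → length fl ≡ length (concat As) →
  ∑Π (ranges As) (λ _ → 1) * ∑ (blockPerms As) (P ∘ mask fl) ≤ 4 ^ trues fl * (length (blockPerms As) * ∑Π (ranges As) (P ∘ mask fl))
blockPerms-spread []       []       P e = ≤-reflexive (l (P []))
  where l : ∀ a → 1 * (a + 0) ≡ 1 * (1 * a)
        l = solve-∀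
blockPerms-spread (A ∷ As) fl₀ P e = subst Goal (take++drop≡id (length A) fl₀) (go (take (length A) fl₀) (drop (length A) fl₀) e₁ e₂)
  where
  Goal : List Bool → Set
  Goal fl = ∑Π (ranges (A ∷ As)) (λ _ → 1) * ∑ (blockPerms (A ∷ As)) (P ∘ mask fl) ≤ 4 ^ trues fl * (length (blockPerms (A ∷ As)) * ∑Π (ranges (A ∷ As)) (P ∘ mask fl))
  e′ : length fl₀ ≡ length A + length (concat As)
  e′ = trans e (length-++ A)
  e₁ : length (take (length A) fl₀) ≡ length A
  e₁ = trans (length-take (length A) fl₀) (m≤n⇒m⊓n≡m (subst (length A ≤_) (sym e′) (m≤m+n _ _)))
  e₂ : length (drop (length A) fl₀) ≡ length (concat As)
  e₂ = trans (length-drop (length A) fl₀) (trans (cong (_∸ length A) e′) (m+n∸m≡n (length A) _))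
  go : ∀ fl gl → length fl ≡ length A → length gl ≡ length (concat As) → Goal (fl ++ gl)
  go fl gl e₁ e₂ = begin
      ∑Π (ranges (A ∷ As)) (λ _ → 1) * ∑ (blockPerms (A ∷ As)) (P ∘ mask (fl ++ gl))
    ≡⟨ cong₂ _*_ Φsplit (trans (∑-blockPerms A As _) (∑-cong∈ (sel N A) λ {f} m → ∑-cong (blockPerms As) λ g → cong P (mask-++ fl gl f g (trans e₁ (sym (↭-length (∈-sel⇒↭ {A = A} refl m))))))) ⟩
      length A ^ N * w * ∑ (sel N A) (λ f → ∑ (blockPerms As) (λ g → P (mask fl f ++ mask gl g)))
    ≡⟨ trans (*-assoc (length A ^ N) w _) (cong (length A ^ N *_) (sym (∑-*ˡ (sel N A) w _))) ⟩
      length A ^ N * ∑ (sel N A) (λ f → w * ∑ (blockPerms As) (λ g → P (mask fl f ++ mask gl g)))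
    ≤⟨ *-monoʳ-≤ (length A ^ N) (∑-mono (sel N A) λ f → blockPerms-spread As gl (λ y → P (mask fl f ++ y)) e₂) ⟩
      length A ^ N * ∑ (sel N A) (λ f → 4 ^ trues gl * (h * P′ (mask fl f)))
    ≡⟨ cong (length A ^ N *_) (trans (∑-*ˡ (sel N A) (4 ^ trues gl) _) (cong (4 ^ trues gl *_) (∑-*ˡ (sel N A) h _))) ⟩
      length A ^ N * (4 ^ trues gl * (h * ∑ (sel N A) (P′ ∘ mask fl)))
    ≡⟨ l1 (length A ^ N) (4 ^ trues gl) h _ ⟩
      4 ^ trues gl * h * (length A ^ N * ∑ (sel N A) (P′ ∘ mask fl))
    ≤⟨ *-monoʳ-≤ (4 ^ trues gl * h) (subst (λ z → length A ^ z * ∑ (sel z A) (P′ ∘ mask fl) ≤ 4 ^ trues fl * (z ! * ∑Π (replicate z A) (P′ ∘ mask fl))) e₁ (block-spread fl A P′ (sym e₁))) ⟩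
      4 ^ trues gl * h * (4 ^ trues fl * (N ! * ∑Π (replicate N A) (P′ ∘ mask fl)))
    ≡⟨ l2 (4 ^ trues gl) h (4 ^ trues fl) (N !) _ ⟩
      4 ^ trues fl * 4 ^ trues gl * (N ! * h * ∑Π (replicate N A) (P′ ∘ mask fl))
    ≡⟨ cong₂ _*_ (trans (sym (^-distribˡ-+-* 4 (trues fl) (trues gl))) (cong (4 ^_) (sym (∑-++ fl gl 𝟙))))
        (cong₂ _*_ (sym (length-blockPerms A As)) (sym (trans (∑Π-++ (replicate N A) (ranges As) _)
          (∑Π-cong (replicate N A) λ {f} pw → ∑Π-cong (ranges As) λ {g} _ → cong P (mask-++ fl gl f g (trans e₁ (sym (trans (Pointwise-length pw) (length-replicate N))))))))) ⟩
      4 ^ trues (fl ++ gl) * (length (blockPerms (A ∷ As)) * ∑Π (ranges (A ∷ As)) (P ∘ mask (fl ++ gl))) ∎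
    where
    open ≤-Reasoning
    N w h : ℕ
    N = length A
    w = ∑Π (ranges As) (λ _ → 1)
    h = length (blockPerms As)
    P′ : List ℕ → ℕ
    P′ x = ∑Π (ranges As) (λ g → P (x ++ mask gl g))
    Φsplit : ∑Π (ranges (A ∷ As)) (λ _ → 1) ≡ length A ^ N * w
    Φsplit = trans (∑Π-++ (replicate N A) (ranges As) _) (trans (∑Π-cong (replicate N A) (λ _ → sym (*-identityʳ w))) (trans (∑Π-*ˡ (replicate N A) w _) (trans (*-comm w _) (cong (_* w) (∑Π-replicate-const N A)))))
    l1 : ∀ a b c d → a * (b * (c * d)) ≡ b * c * (a * d)
    l1 = solve-∀
    l2 : ∀ a b c d e → a * b * (c * (d * e)) ≡ c * a * (d * b * e)
    l2 = solve-∀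

∈-blockPerms⁻ : ∀ {A As f} → f ∈ blockPerms (A ∷ As) → ∃₂ λ g h → g ∈ sel (length A) A × h ∈ blockPerms As × f ≡ g ++ h
∈-blockPerms⁻ {A} {As} m with ∈-concatMap-elim (λ f → map (f ++_) (blockPerms As)) (sel (length A) A) m
... | g , mg , mf with ∈-map⁻ _ mf
... | h , mh , e = g , h , mg , mh , e

∈-take⇒∈ : ∀ {A : Set} {x : A} k {xs} → x ∈ take k xs → x ∈ xs
∈-take⇒∈ (suc k) {_ ∷ _} (here p)  = here p
∈-take⇒∈ (suc k) {_ ∷ _} (there m) = there (∈-take⇒∈ k m)

∈-take-mono : ∀ {A : Set} {x : A} {j k} xs → j ≤ k → x ∈ take j xs → x ∈ take k xs
∈-take-mono (y ∷ ys) (s≤s le) (here p)  = here p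
∈-take-mono (y ∷ ys) (s≤s le) (there m) = there (∈-take-mono ys le m)

-- Exponential moments

lengths : List (List ℕ) → ℕ
lengths []       = 1
lengths (R ∷ Rs) = length R * lengths Rs

∑Π-1 : ∀ Rs → ∑Π Rs (λ _ → 1) ≡ lengths Rs
∑Π-1 []       = refl
∑Π-1 (R ∷ Rs) = trans (∑-cong R λ _ → ∑Π-1 Rs) (∑-const R _)

module Pairs (k : ℕ) (close : ℕ → ℕ → Bool) where
  deg : ℕ → List ℕ → ℕ
  deg q h = ∑ (take k h) (λ b → 𝟙 (close q b))

  expo : List ℕ → List ℕ → ℕ
  expo h []       = 0
  expo h (q ∷ qs) = deg q h + expo (q ∷ h) qs

-- Exponential moment of the number of pairs of close points at distance at most k in a
-- sequence of independent points.  After a point that lands near one of its k predecessors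
-- the next k points may be close to many predecessors; otherwise, since two points close to a
-- common point count as near each other, a new point is close to at most one of them.
module Moment (n k Δ Y r : ℕ) (close : ℕ → ℕ → Bool)
  (close-refl : ∀ {q} → q < n → T (close q q))
  (row : ∀ {q} → q < n → ∑ (upTo n) (λ b → 𝟙 (close q b)) ≤ Δ)
  (col : ∀ {b} → b < n → ∑ (upTo n) (λ q → 𝟙 (close q b)) ≤ Δ)
  (1≤k : 1 ≤ k) (1≤Y : 1 ≤ Y) (1≤r : 1 ≤ r)
  (hyp₁ : 2 * (k * (Δ * Δ)) * Y ≤ r)
  (hyp₂ : 2 * k * (k * (Δ * Δ)) * Y ^ k ≤ r * r) where

  near : ℕ → ℕ → Bool
  near a b = any (λ q → close q a ∧ close q b) (upTo n)

  open Pairs k close public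

  hit : ℕ → List ℕ → Bool
  hit q h = any (near q) (take k h)

  -- The history h has the most recent point first; the last j points must all have landed away from
  -- their predecessors.
  quiet : ℕ → List ℕ → Set
  quiet zero    h       = ⊤
  quiet (suc j) []      = ⊤
  quiet (suc j) (q ∷ h) = ¬ T (hit q h) × quiet j h

  quiet-mono : ∀ {i j} h → i ≤ j → quiet j h → quiet i h
  quiet-mono h z≤n q = tt
  quiet-mono [] (s≤s le) q = tt
  quiet-mono (_ ∷ h) (s≤s le) (a , q) = a , quiet-mono h le q

  near⁺ : ∀ {q a b} → q < n → T (close q a) → T (close q b) → T (near a b)
  near⁺ q<n p r = T-any⁺ _ (∈-upTo⁺ q<n) (T-∧⁺ p r)

  ∑-none : ∀ {A : Set} (p : A → Bool) xs → (∀ {x} → x ∈ xs → ¬ T (p x)) → ∑ xs (λ x → 𝟙 (p x)) ≡ 0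
  ∑-none p []       h = refl
  ∑-none p (x ∷ xs) h with p x in e
  ... | true  = ⊥-elim (h (here refl) (subst T (sym e) tt))
  ... | false = ∑-none p xs (h ∘ there)

  deg≤k : ∀ q h → deg q h ≤ k
  deg≤k q h = begin
      deg q h                 ≤⟨ ∑-mono (take k h) (λ b → 𝟙≤1 (close q b)) ⟩
      ∑ (take k h) (λ _ → 1)  ≡⟨ sym (length-∑1 (take k h)) ⟩
      length (take k h)       ≡⟨ length-take k h ⟩
      k ⊓ length h            ≤⟨ m⊓n≤m k _ ⟩
      k ∎
    where open ≤-Reasoning

  deg-unhit : ∀ {q h} → q < n → ¬ T (hit q h) → deg q h ≡ 0
  deg-unhit {q} {h} q<n ¬hit = ∑-none (close q) (take k h) λ m c → ¬hit (T-any⁺ (near q) m (near⁺ q<n (close-refl q<n) c))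

  deg-quiet : ∀ {q} → q < n → ∀ j h → j ≤ k → quiet j h → ∑ (take j h) (λ b → 𝟙 (close q b)) ≤ 1
  deg-quiet q<n zero    h       le qt = z≤n
  deg-quiet q<n (suc j) []      le qt = z≤n
  deg-quiet {q} q<n (suc j) (b ∷ h) le (¬hit , qt) with close q b in e
  ... | false = deg-quiet q<n j h (≤-trans (n≤1+n j) le) qt
  ... | true  = ≤-reflexive (cong suc (∑-none (close q) (take j h) λ m c →
                  ¬hit (T-any⁺ (near b) (∈-take-mono h (≤-trans (n≤1+n j) le) m) (near⁺ q<n (subst T (sym e) tt) c))))

  -- The second condition makes R a sub-multiset of `upTo n`; the third bounds the probability of a
  -- hit by `hits` / r².
  Range : List ℕ → Set
  Range R = (∀ {q} → q ∈ R → q < n) × (∀ g → ∑ R g ≤ ∑ (upTo n) g) × r * r ≤ length R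

  -- There are at most Δ intermediate points close to b, and each is close to at most Δ points q.
  near-count : ∀ {R b} → Range R → b < n → ∑ R (λ q → 𝟙 (near q b)) ≤ Δ * Δ
  near-count {R} {b} (_ , sub , _) b<n = begin
      ∑ R (λ q → 𝟙 (near q b))
    ≤⟨ sub _ ⟩
      ∑ U (λ q → 𝟙 (near q b))
    ≤⟨ ∑-mono U (λ q → 𝟙-⇒ {near q b} λ t → let q′ , m , p = T-any⁻ _ U t ; p₁ , p₂ = T-∧⁻ {close q′ q} p in
         ≤-trans (≤-reflexive (sym (cong₂ _*_ (𝟙-T p₂) (𝟙-T p₁)))) (∑-∈ (λ z → 𝟙 (close z b) * 𝟙 (close z q)) m)) ⟩
      ∑ U (λ q → ∑ U (λ z → 𝟙 (close z b) * 𝟙 (close z q)))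
    ≡⟨ trans (∑-swap U U _) (∑-cong U λ z → ∑-*ˡ U (𝟙 (close z b)) _) ⟩
      ∑ U (λ z → 𝟙 (close z b) * ∑ U (λ q → 𝟙 (close z q)))
    ≤⟨ ∑-mono∈ U (λ {z} m → *-monoʳ-≤ (𝟙 (close z b)) (row (∈-upTo⁻ m))) ⟩
      ∑ U (λ z → 𝟙 (close z b) * Δ)
    ≡⟨ ∑-*ʳ U Δ _ ⟩
      ∑ U (λ z → 𝟙 (close z b)) * Δ
    ≤⟨ *-monoˡ-≤ Δ (col b<n) ⟩
      Δ * Δ ∎
    where
    open ≤-Reasoning
    U : List ℕ
    U = upTo n

  hits : ℕ
  hits = k * (Δ * Δ)

  hit-count : ∀ {R h} → Range R → (∀ {b} → b ∈ h → b < n) → ∑ R (λ q → 𝟙 (hit q h)) ≤ hits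
  hit-count {R} {h} rg h<n = begin
      ∑ R (λ q → 𝟙 (hit q h))
    ≤⟨ ∑-mono R (λ q → 𝟙-⇒ {hit q h} λ t → let b , m , p = T-any⁻ (near q) (take k h) t in
          ≤-trans (≤-reflexive (sym (𝟙-T p))) (∑-∈ (λ b → 𝟙 (near q b)) m)) ⟩
      ∑ R (λ q → ∑ (take k h) (λ b → 𝟙 (near q b)))
    ≡⟨ ∑-swap R (take k h) _ ⟩
      ∑ (take k h) (λ b → ∑ R (λ q → 𝟙 (near q b)))
    ≤⟨ ∑-mono∈ (take k h) (λ m → near-count rg (h<n (∈-take⇒∈ k m))) ⟩
      ∑ (take k h) (λ b → Δ * Δ)
    ≡⟨ ∑-const (take k h) _ ⟩
      length (take k h) * (Δ * Δ)
    ≤⟨ *-monoˡ-≤ (Δ * Δ) (≤-trans (≤-reflexive (length-take k h)) (m⊓n≤m k _)) ⟩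
      hits ∎
    where open ≤-Reasoning

  moment : List ℕ → List (List ℕ) → ℕ
  moment h Rs = ∑Π Rs (λ qs → Y ^ expo h qs)

  moment-∷ : ∀ h R Rs → moment h (R ∷ Rs) ≡ ∑ R (λ q → Y ^ deg q h * moment (q ∷ h) Rs)
  moment-∷ h R Rs = ∑-cong R λ q → trans (∑Π-cong Rs λ {qs} _ → ^-distribˡ-+-* Y (deg q h) (expo (q ∷ h) qs)) (∑Π-*ˡ Rs (Y ^ deg q h) _)

  cap : ℕ → ℕ
  cap zero    = 1
  cap (suc _) = k

  deg≤cap : ∀ c h {q} → q < n → quiet (k ∸ c) h → deg q h ≤ cap c
  deg≤cap zero    h q<n qt = deg-quiet q<n k h ≤-refl qt
  deg≤cap (suc _) h _   _  = deg≤k _ h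

  -- The factor (k + c) / k, between 1 and 2, is a potential: a hit resets c to k, and any other
  -- point lowers c by one until it is 0. At c = 0 a hit closes at most one edge and costs at most
  -- 2Y, so by `hyp₁` its expected cost is at most 1/r, which is the factor 1 + 1/r per point. At c
  -- > 0 a hit may close k edges; `hyp₂` bounds its expected contribution by one unit of k + c, and
  -- the drop of c pays for that unit.
  moment-bound : ∀ Rs h c → All Range Rs → (∀ {b} → b ∈ h → b < n) → c ≤ k → quiet (k ∸ c) h →
    k * (r ^ length Rs * moment h Rs) ≤ (k + c) * (suc r ^ length Rs * lengths Rs)
  moment-bound [] h c [] h<n c≤k qt = *-monoˡ-≤ 1 (m≤m+n k c)
  moment-bound (R ∷ Rs) h c (rg@(R<n , _ , r²≤R) ∷ rgs) h<n c≤k qt = begin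
      k * (r * r ^ L * moment h (R ∷ Rs))
    ≡⟨ l1 k r (r ^ L) _ ⟩
      r * (k * r ^ L * moment h (R ∷ Rs))
    ≡⟨ cong (r *_) (trans (cong (k * r ^ L *_) (moment-∷ h R Rs)) (sym (∑-*ˡ R (k * r ^ L) _))) ⟩
      r * ∑ R (λ q → k * r ^ L * (Y ^ deg q h * moment (q ∷ h) Rs))
    ≤⟨ *-monoʳ-≤ r (∑-mono∈ R each) ⟩
      r * ∑ R (λ q → (k + (c ∸ 1)) * B + 𝟙 (hit q h) * (Y ^ cap c * (2 * k * B)))
    ≡⟨ cong (r *_) (trans (∑-+ R _ _) (cong₂ _+_ (∑-const R _) (∑-*ʳ R _ _))) ⟩
      r * (length R * ((k + (c ∸ 1)) * B) + ∑ R (λ q → 𝟙 (hit q h)) * (Y ^ cap c * (2 * k * B)))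
    ≤⟨ *-monoʳ-≤ r (+-monoʳ-≤ (length R * ((k + (c ∸ 1)) * B)) (*-monoˡ-≤ _ (hit-count rg h<n))) ⟩
      r * (length R * ((k + (c ∸ 1)) * B) + hits * (Y ^ cap c * (2 * k * B)))
    ≤⟨ final c ⟩
      (k + c) * (suc r * (length R * B))
    ≡⟨ cong ((k + c) *_) (l2 (suc r) (length R) (suc r ^ L) (lengths Rs)) ⟩
      (k + c) * (suc r * suc r ^ L * (length R * lengths Rs)) ∎
    where
    open ≤-Reasoning
    L B : ℕ
    L = length Rs
    B = suc r ^ L * lengths Rs
    l1 : ∀ k r a m → k * (r * a * m) ≡ r * (k * a * m)
    l1 = solve-∀
    l2 : ∀ s R p q → s * (R * (p * q)) ≡ s * p * (R * q)
    l2 = solve-∀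
    l3 : ∀ k a y m → k * a * (y * m) ≡ y * (k * (a * m))
    l3 = solve-∀
    ext : ∀ {q} → q ∈ R → ∀ {b} → b ∈ q ∷ h → b < n
    ext m (here refl) = R<n m
    ext m (there mb)  = h<n mb
    each : ∀ {q} → q ∈ R → k * r ^ L * (Y ^ deg q h * moment (q ∷ h) Rs) ≤ (k + (c ∸ 1)) * B + 𝟙 (hit q h) * (Y ^ cap c * (2 * k * B))
    each {q} m with T? (hit q h)
    ... | yes t = begin
        k * r ^ L * (Y ^ deg q h * moment (q ∷ h) Rs)         ≡⟨ l3 k (r ^ L) (Y ^ deg q h) _ ⟩
        Y ^ deg q h * (k * (r ^ L * moment (q ∷ h) Rs))       ≤⟨ ^-monoʳ 1≤Y (deg≤cap c h (R<n m) qt) · moment-bound Rs (q ∷ h) k rgs (ext m) ≤-refl (subst (λ z → quiet z (q ∷ h)) (sym (n∸n≡0 k)) tt) ⟩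
        Y ^ cap c * ((k + k) * B)                             ≡⟨ cong (λ z → Y ^ cap c * (z * B)) (cong (k +_) (sym (+-identityʳ k))) ⟩
        Y ^ cap c * (2 * k * B)                               ≡⟨ sym (*-identityˡ _) ⟩
        1 * (Y ^ cap c * (2 * k * B))                         ≡⟨ cong (_* (Y ^ cap c * (2 * k * B))) (sym (𝟙-T t)) ⟩
        𝟙 (hit q h) * (Y ^ cap c * (2 * k * B))               ≤⟨ m≤n+m _ _ ⟩
        (k + (c ∸ 1)) * B + 𝟙 (hit q h) * (Y ^ cap c * (2 * k * B)) ∎
    ... | no ¬t = begin
        k * r ^ L * (Y ^ deg q h * moment (q ∷ h) Rs)         ≡⟨ cong (λ z → k * r ^ L * (Y ^ z * moment (q ∷ h) Rs)) (deg-unhit (R<n m) ¬t) ⟩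
        k * r ^ L * (1 * moment (q ∷ h) Rs)                   ≡⟨ l3 k (r ^ L) 1 _ ⟩
        1 * (k * (r ^ L * moment (q ∷ h) Rs))                 ≡⟨ *-identityˡ _ ⟩
        k * (r ^ L * moment (q ∷ h) Rs)                       ≤⟨ moment-bound Rs (q ∷ h) (c ∸ 1) rgs (ext m) (≤-trans (m∸n≤m c 1) c≤k)
                                                                   (quiet-mono (q ∷ h) (k∸[c∸1] c) (¬t , qt)) ⟩
        (k + (c ∸ 1)) * B                                     ≤⟨ m≤m+n _ _ ⟩
        (k + (c ∸ 1)) * B + 𝟙 (hit q h) * (Y ^ cap c * (2 * k * B)) ∎
      where
      -- The new point extends the quiet stretch by one; at c = 0 the truncated `c ∸ 1` keeps its
      -- recorded length at k.
      k∸[c∸1] : ∀ c → k ∸ (c ∸ 1) ≤ suc (k ∸ c)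
      k∸[c∸1] zero    = n≤1+n k
      k∸[c∸1] (suc c) = lem k c
        where
        lem : ∀ k c → k ∸ c ≤ suc (k ∸ suc c)
        lem zero    c       = ≤-trans (≤-reflexive (0∸n≡0 c)) z≤n
        lem (suc k) zero    = ≤-refl
        lem (suc k) (suc c) = lem k c
    final : ∀ c → r * (length R * ((k + (c ∸ 1)) * B) + hits * (Y ^ cap c * (2 * k * B))) ≤ (k + c) * (suc r * (length R * B))
    final zero = begin
        r * (length R * ((k + 0) * B) + hits * (Y * 1 * (2 * k * B)))   ≡⟨ e1 r (length R) k B hits Y ⟩
        r * length R * (k * B) + r * (2 * hits * Y) * (k * B)           ≤⟨ +-monoʳ-≤ (r * length R * (k * B)) (*-monoˡ-≤ (k * B) (≤-trans (*-monoʳ-≤ r hyp₁) r²≤R)) ⟩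
        r * length R * (k * B) + length R * (k * B)                     ≡⟨ e2 r (length R) k B ⟩
        (k + 0) * (suc r * (length R * B)) ∎
      where
      e1 : ∀ r R k B h Y → r * (R * ((k + 0) * B) + h * (Y * 1 * (2 * k * B))) ≡ r * R * (k * B) + r * (2 * h * Y) * (k * B)
      e1 = solve-∀
      e2 : ∀ r R k B → r * R * (k * B) + R * (k * B) ≡ (k + 0) * (suc r * (R * B))
      e2 = solve-∀
    final (suc c) = begin
        r * (length R * ((k + c) * B) + hits * (Y ^ k * (2 * k * B)))   ≡⟨ e1 r (length R) k c B hits (Y ^ k) ⟩
        r * (length R * ((k + c) * B) + 2 * k * hits * Y ^ k * B)       ≤⟨ *-monoʳ-≤ r (+-monoʳ-≤ (length R * ((k + c) * B)) (*-monoˡ-≤ B (≤-trans hyp₂ r²≤R))) ⟩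
        r * (length R * ((k + c) * B) + length R * B)                   ≤⟨ *-monoˡ-≤ _ (n≤1+n r) ⟩
        suc r * (length R * ((k + c) * B) + length R * B)               ≡⟨ e2 (suc r) (length R) k c B ⟩
        (k + suc c) * (suc r * (length R * B)) ∎
      where
      e1 : ∀ r R k c B h Y → r * (R * ((k + c) * B) + h * (Y * (2 * k * B))) ≡ r * (R * ((k + c) * B) + 2 * k * h * Y * B)
      e1 = solve-∀
      e2 : ∀ r R k c B → r * (R * ((k + c) * B) + R * B) ≡ (k + (1 + c)) * (r * (R * B))
      e2 = solve-∀

  moment-bound₀ : ∀ Rs → All Range Rs → r ^ length Rs * moment [] Rs ≤ suc r ^ length Rs * lengths Rs
  moment-bound₀ Rs rgs = *-cancelˡ-≤ k ⦃ >-nonZero 1≤k ⦄ (≤-trans (moment-bound Rs [] 0 rgs (λ ()) z≤n (quiet-[] k)) (≤-reflexive (cong (_* (suc r ^ length Rs * lengths Rs)) (+-identityʳ k))))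
    where
    quiet-[] : ∀ j → quiet j []
    quiet-[] zero    = tt
    quiet-[] (suc j) = tt

  lengths-pos : ∀ Rs → All Range Rs → 1 ≤ lengths Rs
  lengths-pos [] [] = ≤-refl
  lengths-pos (R ∷ Rs) ((_ , _ , h) ∷ rgs) = ≤-trans (1≤r · 1≤r) h · lengths-pos Rs rgs

-- Reading independent positions in a prescribed order.

nth : ∀ {A : Set} → A → List A → ℕ → A
nth d []       _       = d
nth d (x ∷ xs) zero    = x
nth d (x ∷ xs) (suc i) = nth d xs i

upd : List ℕ → ℕ → ℕ → List ℕ
upd []      _       q = []
upd (y ∷ f) zero    q = q ∷ f
upd (y ∷ f) (suc x) q = y ∷ upd f x q

length-upd : ∀ f x q → length (upd f x q) ≡ length f
length-upd []      x       q = refl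
length-upd (y ∷ f) zero    q = refl
length-upd (y ∷ f) (suc x) q = cong suc (length-upd f x q)

nth-upd : ∀ f x q → x < length f → nth 0 (upd f x q) x ≡ q
nth-upd (y ∷ f) zero    q _ = refl
nth-upd (y ∷ f) (suc x) q (s≤s h) = nth-upd f x q h

nth-upd-≢ : ∀ f {x y} q → x ≢ y → nth 0 (upd f x q) y ≡ nth 0 f y
nth-upd-≢ []      q ne = refl
nth-upd-≢ (z ∷ f) {zero}  {zero}  q ne = contradiction refl ne
nth-upd-≢ (z ∷ f) {zero}  {suc y} q ne = refl
nth-upd-≢ (z ∷ f) {suc x} {zero}  q ne = refl
nth-upd-≢ (z ∷ f) {suc x} {suc y} q ne = nth-upd-≢ f q (ne ∘ cong suc)

updates : List ℕ → List ℕ → List ℕ → List ℕ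
updates f (x ∷ xs) (q ∷ qs) = updates (upd f x q) xs qs
updates f _        _        = f

updates-∉ : ∀ f {y} xs qs → All (_≢ y) xs → nth 0 (updates f xs qs) y ≡ nth 0 f y
updates-∉ f []       qs       _ = refl
updates-∉ f (x ∷ xs) []       _ = refl
updates-∉ f (x ∷ xs) (q ∷ qs) (ne ∷ nes) = trans (updates-∉ (upd f x q) xs qs nes) (nth-upd-≢ f q ne)

length-updates : ∀ f xs qs → length (updates f xs qs) ≡ length f
length-updates f []       qs       = refl
length-updates f (x ∷ xs) []       = refl
length-updates f (x ∷ xs) (q ∷ qs) = trans (length-updates _ xs qs) (length-upd f x q)

nth-updates : ∀ f xs qs → Unique xs → All (_< length f) xs → length xs ≡ length qs → map (nth 0 (updates f xs qs)) xs ≡ qs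
nth-updates f []       []       u a e = refl
nth-updates f (x ∷ xs) (q ∷ qs) (nx ∷ u) (x< ∷ a) e = cong₂ _∷_
  (trans (updates-∉ _ xs qs (mapᴬ (λ ne e → ne (sym e)) nx)) (nth-upd f x q x<))
  (nth-updates (upd f x q) xs qs u (mapᴬ (subst (_ <_) (sym (length-upd f x q))) a) (suc-injective e))

∑-∑Π : ∀ (R : List ℕ) Rs (F : ℕ → List ℕ → ℕ) → ∑ R (λ q → ∑Π Rs (F q)) ≡ ∑Π Rs (λ f → ∑ R (λ q → F q f))
∑-∑Π R []       F = refl
∑-∑Π R (S ∷ Rs) F = trans (∑-swap R S _) (∑-cong S λ s → ∑-∑Π R Rs (λ q f → F q (s ∷ f)))

-- Redrawing one coordinate from its own range preserves the uniform distribution on the product.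
∑Π-upd : ∀ Rs x (F : List ℕ → ℕ) → x < length Rs → ∑Π Rs (λ f → ∑ (nth [] Rs x) (λ q → F (upd f x q))) ≡ length (nth [] Rs x) * ∑Π Rs F
∑Π-upd (R ∷ Rs) zero    F _ = trans (∑-const R _) (cong (length R *_) (sym (∑-∑Π R Rs _)))
∑Π-upd (R ∷ Rs) (suc x) F (s≤s h) = trans (∑-cong R λ q → ∑Π-upd Rs x (λ f → F (q ∷ f)) h) (∑-*ˡ R (length (nth [] Rs x)) _)

∑Π-updates : ∀ Rs xs (F : List ℕ → ℕ) → All (_< length Rs) xs →
  ∑Π Rs (λ f → ∑Π (map (nth [] Rs) xs) (λ qs → F (updates f xs qs))) ≡ lengths (map (nth [] Rs) xs) * ∑Π Rs F
∑Π-updates Rs []       F _ = sym (+-identityʳ _)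
∑Π-updates Rs (x ∷ xs) F (h ∷ hs) = trans (∑Π-upd Rs x (λ f → ∑Π (map (nth [] Rs) xs) (λ qs → F (updates f xs qs))) h)
  (trans (cong (length (nth [] Rs x) *_) (∑Π-updates Rs xs F hs)) (sym (*-assoc (length (nth [] Rs x)) _ _)))

nth-All : ∀ {A : Set} {P : A → Set} {d xs i} → All P xs → i < length xs → P (nth d xs i)
nth-All {i = zero}  (p ∷ ps) _       = p
nth-All {i = suc i} (p ∷ ps) (s≤s h) = nth-All ps h

module MomentOf (n k Δ Y r : ℕ) (close : ℕ → ℕ → Bool)
  (close-refl : ∀ {q} → q < n → T (close q q))
  (row : ∀ {q} → q < n → ∑ (upTo n) (λ b → 𝟙 (close q b)) ≤ Δ)
  (col : ∀ {b} → b < n → ∑ (upTo n) (λ q → 𝟙 (close q b)) ≤ Δ)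
  (1≤k : 1 ≤ k) (1≤Y : 1 ≤ Y) (1≤r : 1 ≤ r)
  (hyp₁ : 2 * (k * (Δ * Δ)) * Y ≤ r)
  (hyp₂ : 2 * k * (k * (Δ * Δ)) * Y ^ k ≤ r * r) where
  open Moment n k Δ Y r close close-refl row col 1≤k 1≤Y 1≤r hyp₁ hyp₂ public

  -- The moment bound concerns a sequence of fresh points, whereas here the coordinates are visited
  -- in the order `xs`. Redrawing exactly the coordinates in `xs` does not change the distribution,
  -- and afterwards the values read along `xs` are the fresh sequence.
  ∑Π-bound : ∀ Rs xs K (F : List ℕ → ℕ) → All Range Rs → Unique xs → All (_< length Rs) xs →
    (∀ f → length f ≡ length Rs → F f ≤ K * Y ^ expo [] (map (nth 0 f) xs)) →
    r ^ length xs * ∑Π Rs F ≤ suc r ^ length xs * (K * ∑Π Rs (λ _ → 1))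
  ∑Π-bound Rs xs K F rgs uq xs< hyp = *-cancelˡ-≤ ℓ ⦃ >-nonZero (lengths-pos Rx rgx) ⦄ (begin
      ℓ * (r ^ length xs * ∑Π Rs F)
    ≡⟨ x∙yz≈y∙xz ℓ (r ^ length xs) _ ⟩
      r ^ length xs * (ℓ * ∑Π Rs F)
    ≡⟨ cong (r ^ length xs *_) (sym (∑Π-updates Rs xs F xs<)) ⟩
      r ^ length xs * ∑Π Rs (λ f → ∑Π Rx (λ qs → F (updates f xs qs)))
    ≤⟨ *-monoʳ-≤ (r ^ length xs) (∑Π-mono Rs λ {f} pf → ∑Π-mono Rx λ {qs} pq → inner f qs (Pointwise-length pf) (trans (sym (length-map _ xs)) (sym (Pointwise-length pq)))) ⟩
      r ^ length xs * ∑Π Rs (λ f → ∑Π Rx (λ qs → K * Y ^ expo [] qs))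
    ≡⟨ cong (r ^ length xs *_) (trans (∑Π-cong Rs λ _ → trans (∑Π-*ˡ Rx K _) (sym (*-identityʳ _))) (∑Π-*ˡ Rs (K * moment [] Rx) (λ _ → 1))) ⟩
      r ^ length xs * (K * moment [] Rx * Φ)
    ≡⟨ l2 (r ^ length xs) K (moment [] Rx) Φ ⟩
      r ^ length xs * moment [] Rx * (K * Φ)
    ≤⟨ *-monoˡ-≤ (K * Φ) (subst (λ z → r ^ z * moment [] Rx ≤ suc r ^ z * ℓ) (length-map (nth [] Rs) xs) (moment-bound₀ Rx rgx)) ⟩
      suc r ^ length xs * ℓ * (K * Φ)
    ≡⟨ xy∙z≈y∙xz (suc r ^ length xs) ℓ (K * Φ) ⟩
      ℓ * (suc r ^ length xs * (K * Φ)) ∎)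
    where
    open ≤-Reasoning
    Rx : List (List ℕ)
    Rx = map (nth [] Rs) xs
    ℓ Φ : ℕ
    ℓ = lengths Rx
    Φ = ∑Π Rs (λ _ → 1)
    rgx : All Range Rx
    rgx = go xs xs<
      where
      go : ∀ xs → All (_< length Rs) xs → All Range (map (nth [] Rs) xs)
      go []       []       = []
      go (x ∷ xs) (h ∷ hs) = nth-All rgs h ∷ go xs hs
    inner : ∀ f qs → length f ≡ length Rs → length xs ≡ length qs → F (updates f xs qs) ≤ K * Y ^ expo [] qs
    inner f qs e₁ e₂ = subst (λ z → F (updates f xs qs) ≤ K * Y ^ expo [] z)
      (nth-updates f xs qs uq (mapᴬ (λ h → subst (_ <_) (sym e₁) h) xs<) e₂)
      (hyp (updates f xs qs) (trans (length-updates f xs qs) e₁))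
    l2 : ∀ a b c d → a * (b * c * d) ≡ a * c * (b * d)
    l2 = solve-∀

-- Cyclic distance and the edges of the complete graph

∑-applyUpTo : ∀ {A : Set} (g : ℕ → A) n (f : A → ℕ) → ∑ (applyUpTo g n) f ≡ ∑ (upTo n) (f ∘ g)
∑-applyUpTo g n f = trans (cong (λ z → ∑ z f) (sym (map-upTo g n))) (∑-map g (upTo n) f)

∑-upTo-suc : ∀ n (f : ℕ → ℕ) → ∑ (upTo (suc n)) f ≡ f 0 + ∑ (upTo n) (f ∘ suc)
∑-upTo-suc n f = cong (f 0 +_) (∑-applyUpTo suc n f)

∑-upTo-none : ∀ n (p : ℕ → Bool) → (∀ {b} → ¬ T (p b)) → ∑ (upTo n) (λ b → 𝟙 (p b)) ≡ 0
∑-upTo-none n p h = trans (∑-cong (upTo n) λ b → no-𝟙 (h {b})) (∑-zero (upTo n))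
  where
  no-𝟙 : ∀ {b} → ¬ T b → 𝟙 b ≡ 0
  no-𝟙 {true}  h = contradiction tt h
  no-𝟙 {false} h = refl

interval-count : ∀ n a w (p : ℕ → Bool) → (∀ {b} → T (p b) → a ≤ b × b ≤ a + w) → ∑ (upTo n) (λ b → 𝟙 (p b)) ≤ suc w
interval-count zero    a       w       p h = z≤n
interval-count (suc n) zero    zero    p h = ≤-trans (≤-reflexive (trans (∑-upTo-suc n _) (cong (𝟙 (p 0) +_) (∑-upTo-none n (p ∘ suc) λ t → contradiction (proj₂ (h t)) λ ()))))
  (≤-trans (≤-reflexive (+-identityʳ _)) (𝟙≤1 (p 0)))
interval-count (suc n) zero    (suc w) p h = ≤-trans (≤-reflexive (∑-upTo-suc n _))
  (+-mono-≤ (𝟙≤1 (p 0)) (interval-count n 0 w (p ∘ suc) λ t → z≤n , s≤s⁻¹ (proj₂ (h t))))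
interval-count (suc n) (suc a) w       p h = ≤-trans (≤-reflexive (trans (∑-upTo-suc n _) (cong (λ z → 𝟙 z + ∑ (upTo n) (λ b → 𝟙 (p (suc b)))) (p0 (p 0) refl))))
  (interval-count n a w (p ∘ suc) λ t → s≤s⁻¹ (proj₁ (h t)) , s≤s⁻¹ (proj₂ (h t)))
  where
  p0 : ∀ b → p 0 ≡ b → p 0 ≡ false
  p0 true  e = contradiction (proj₁ (h {0} (subst T (sym e) tt))) λ ()
  p0 false e = e

-- Cyclic distance at most k on {0, …, n - 1}.
close : ℕ → ℕ → ℕ → ℕ → Bool
close k n i j = ((i ≤ᵇ j + k) ∧ (j ≤ᵇ i + k)) ∨ ((i + n ≤ᵇ j + k) ∨ (j + n ≤ᵇ i + k))

Close : ℕ → ℕ → ℕ → ℕ → Set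
Close k n i j = (i ≤ j + k × j ≤ i + k) ⊎ (i + n ≤ j + k) ⊎ (j + n ≤ i + k)

close⁻ : ∀ k n i j → T (close k n i j) → Close k n i j
close⁻ k n i j t with T-∨⁻ {(i ≤ᵇ j + k) ∧ (j ≤ᵇ i + k)} t
... | inj₁ p = let a , b = T-∧⁻ {i ≤ᵇ j + k} p in inj₁ (≤ᵇ⇒≤ i (j + k) a , ≤ᵇ⇒≤ j (i + k) b)
... | inj₂ p with T-∨⁻ {i + n ≤ᵇ j + k} p
...   | inj₁ q = inj₂ (inj₁ (≤ᵇ⇒≤ (i + n) (j + k) q))
...   | inj₂ q = inj₂ (inj₂ (≤ᵇ⇒≤ (j + n) (i + k) q))

close⁺ : ∀ k n i j → Close k n i j → T (close k n i j)
close⁺ k n i j (inj₁ (a , b)) = T-∨⁺ˡ (T-∧⁺ (≤⇒≤ᵇ a) (≤⇒≤ᵇ b))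
close⁺ k n i j (inj₂ (inj₁ a)) = T-∨⁺ʳ {(i ≤ᵇ j + k) ∧ (j ≤ᵇ i + k)} (T-∨⁺ˡ (≤⇒≤ᵇ a))
close⁺ k n i j (inj₂ (inj₂ a)) = T-∨⁺ʳ {(i ≤ᵇ j + k) ∧ (j ≤ᵇ i + k)} (T-∨⁺ʳ {i + n ≤ᵇ j + k} (≤⇒≤ᵇ a))

close-refl : ∀ k n q → T (close k n q q)
close-refl k n q = close⁺ k n q q (inj₁ (m≤m+n q k , m≤m+n q k))

close-sym : ∀ k n i j → T (close k n i j) → T (close k n j i)
close-sym k n i j t with close⁻ k n i j t
... | inj₁ (a , b) = close⁺ k n j i (inj₁ (b , a))
... | inj₂ (inj₁ a) = close⁺ k n j i (inj₂ (inj₂ a))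
... | inj₂ (inj₂ a) = close⁺ k n j i (inj₂ (inj₁ a))

-- A window of 2k + 1 positions around the point and k + 1 positions at either end for the
-- wrap-around; crude, but valid for every n.
spread : ℕ → ℕ
spread k = 4 * k + 3

close-row : ∀ k n {q} → q < n → ∑ (upTo n) (λ b → 𝟙 (close k n q b)) ≤ spread k
close-row k n {q} q<n = begin
    ∑ U (λ b → 𝟙 (close k n q b))
  ≤⟨ ∑-mono∈ U (λ {b} m → 𝟙-⇒ {close k n q b} λ t → each (∈-upTo⁻ m) (close⁻ k n q b t)) ⟩
    ∑ U (λ b → 𝟙 (p₁ b) + (𝟙 (p₂ b) + 𝟙 (p₃ b)))
  ≡⟨ trans (∑-+ U _ _) (cong (∑ U (λ b → 𝟙 (p₁ b)) +_) (∑-+ U _ _)) ⟩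
    ∑ U (λ b → 𝟙 (p₁ b)) + (∑ U (λ b → 𝟙 (p₂ b)) + ∑ U (λ b → 𝟙 (p₃ b)))
  ≤⟨ +-mono-≤ (interval-count n (q ∸ k) (k + k) p₁ (λ {b} t → ≤ᵇ⇒≤ (q ∸ k) b (proj₁ (T-∧⁻ {q ∸ k ≤ᵇ b} t)) , ≤ᵇ⇒≤ b _ (proj₂ (T-∧⁻ {q ∸ k ≤ᵇ b} t))))
       (+-mono-≤ (interval-count n (n ∸ k) k p₂ (λ {b} t → ≤ᵇ⇒≤ (n ∸ k) b (proj₁ (T-∧⁻ {n ∸ k ≤ᵇ b} t)) , ≤ᵇ⇒≤ b _ (proj₂ (T-∧⁻ {n ∸ k ≤ᵇ b} t))))
         (interval-count n 0 k p₃ (λ {b} t → z≤n , ≤ᵇ⇒≤ b k t))) ⟩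
    suc (k + k) + (suc k + suc k)
  ≡⟨ l k ⟩
    spread k ∎
  where
  open ≤-Reasoning
  U : List ℕ
  U = upTo n
  p₁ p₂ p₃ : ℕ → Bool
  p₁ b = (q ∸ k ≤ᵇ b) ∧ (b ≤ᵇ q ∸ k + (k + k))
  p₂ b = (n ∸ k ≤ᵇ b) ∧ (b ≤ᵇ n ∸ k + k)
  p₃ b = b ≤ᵇ k
  l : ∀ k → suc (k + k) + (suc k + suc k) ≡ 4 * k + 3
  l = solve-∀
  each : ∀ {b} → b < n → Close k n q b → 1 ≤ 𝟙 (p₁ b) + (𝟙 (p₂ b) + 𝟙 (p₃ b))
  each {b} b<n (inj₁ (x , y)) = ≤-trans (≤-reflexive (sym (𝟙-T (T-∧⁺ (≤⇒≤ᵇ (m≤n+o⇒m∸n≤o q k (≤-trans x (≤-reflexive (+-comm b k)))))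
      (≤⇒≤ᵇ (≤-trans y (≤-trans (+-monoˡ-≤ k (≤-trans (m≤n+m∸n q k) (≤-reflexive (+-comm k (q ∸ k))))) (≤-reflexive (+-assoc (q ∸ k) k k))))))))) (m≤m+n _ _)
  each {b} b<n (inj₂ (inj₁ x)) = ≤-trans (≤-reflexive (sym (𝟙-T (T-∧⁺ (≤⇒≤ᵇ (m≤n+o⇒m∸n≤o n k (≤-trans (m≤n+m n q) (≤-trans x (≤-reflexive (+-comm b k))))))
      (≤⇒≤ᵇ (≤-trans (<⇒≤ b<n) (≤-trans (m≤n+m∸n n k) (≤-reflexive (+-comm k (n ∸ k)))))))))) (≤-trans (m≤m+n _ _) (m≤n+m _ (𝟙 (p₁ b))))
  each {b} b<n (inj₂ (inj₂ x)) = ≤-trans (≤-reflexive (sym (𝟙-T (≤⇒≤ᵇ (+-cancelʳ-≤ n b k (≤-trans x (≤-trans (+-monoˡ-≤ k (<⇒≤ q<n)) (≤-reflexive (+-comm n k)))))))))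
      (≤-trans (m≤n+m _ (𝟙 (p₂ b))) (m≤n+m _ (𝟙 (p₁ b))))

close-col : ∀ k n {b} → b < n → ∑ (upTo n) (λ q → 𝟙 (close k n q b)) ≤ spread k
close-col k n {b} b<n = ≤-trans (∑-mono (upTo n) λ q → 𝟙-mono (close-sym k n q b)) (close-row k n b<n)

map-toℕ-allFin : ∀ n → map toℕ (allFin n) ≡ upTo n
map-toℕ-allFin zero    = refl
map-toℕ-allFin (suc n) = cong (0 ∷_) (begin
    map toℕ (tabulate Fin.suc)  ≡⟨ map-tabulate Fin.suc toℕ ⟩
    tabulate (suc ∘ toℕ)                  ≡⟨ sym (map-tabulate toℕ suc) ⟩
    map suc (tabulate toℕ)                ≡⟨ cong (map suc) (trans (sym (map-tabulate id toℕ)) (map-toℕ-allFin n)) ⟩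
    map suc (upTo n)                      ≡⟨ map-upTo suc n ⟩
    applyUpTo suc n                       ∎)
  where open ≡-Reasoning

∑-allFin : ∀ n (g : ℕ → ℕ) → ∑ (allFin n) (g ∘ toℕ) ≡ ∑ (upTo n) g
∑-allFin n g = trans (sym (∑-map toℕ (allFin n) g)) (cong (λ z → ∑ z g) (map-toℕ-allFin n))

∑-allEdges : ∀ n (F : Edge n → ℕ) → ∑ (allEdges n) F ≡ ∑ (allFin n) (λ i → ∑ (allFin n) (λ j → 𝟙 (toℕ i <ᵇ toℕ j) * F (i , j)))
∑-allEdges n F = trans (∑-concatMap _ (allFin n) F) (∑-cong (allFin n) λ i → trans (∑-concatMap _ (allFin n) F) (∑-cong (allFin n) λ j → cell (toℕ i <ᵇ toℕ j)))
  where
  cell : ∀ {i j} b → ∑ (if b then [ (i , j) ] else []) F ≡ 𝟙 b * F (i , j)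
  cell true  = refl
  cell false = refl

src tgt : ∀ {n} → Edge n → ℕ
src e = toℕ (proj₁ e)
tgt e = toℕ (proj₂ e)

∑-edges≤ : ∀ n (F : ℕ → ℕ → ℕ) → ∑ (allEdges n) (λ e → F (src e) (tgt e)) ≤ ∑ (upTo n) (λ i → ∑ (upTo n) (F i))
∑-edges≤ n F = begin
    ∑ (allEdges n) (λ e → F (src e) (tgt e))
  ≡⟨ ∑-allEdges n _ ⟩
    ∑ (allFin n) (λ i → ∑ (allFin n) (λ j → 𝟙 (toℕ i <ᵇ toℕ j) * F (toℕ i) (toℕ j)))
  ≤⟨ ∑-mono (allFin n) (λ i → ∑-mono (allFin n) λ j → ≤-trans (*-monoˡ-≤ (F (toℕ i) (toℕ j)) (𝟙≤1 (toℕ i <ᵇ toℕ j))) (≤-reflexive (*-identityˡ _))) ⟩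
    ∑ (allFin n) (λ i → ∑ (allFin n) (λ j → F (toℕ i) (toℕ j)))
  ≡⟨ trans (∑-cong (allFin n) λ i → ∑-allFin n (F (toℕ i))) (∑-allFin n (λ i → ∑ (upTo n) (F i))) ⟩
    ∑ (upTo n) (λ i → ∑ (upTo n) (F i)) ∎
  where open ≤-Reasoning

joins : ∀ {n} → Edge n → ℕ → ℕ → Bool
joins e u v = ((src e ≡ᵇ u) ∧ (tgt e ≡ᵇ v)) ∨ ((src e ≡ᵇ v) ∧ (tgt e ≡ᵇ u))

joins⁻ : ∀ {n} (e : Edge n) u v → T (joins e u v) → (src e ≡ u × tgt e ≡ v) ⊎ (src e ≡ v × tgt e ≡ u)
joins⁻ e u v t with T-∨⁻ {(src e ≡ᵇ u) ∧ (tgt e ≡ᵇ v)} t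
... | inj₁ p = let a , b = T-∧⁻ {src e ≡ᵇ u} p in inj₁ (≡ᵇ⇒≡ _ u a , ≡ᵇ⇒≡ _ v b)
... | inj₂ p = let a , b = T-∧⁻ {src e ≡ᵇ v} p in inj₂ (≡ᵇ⇒≡ _ v a , ≡ᵇ⇒≡ _ u b)

joins⁺ : ∀ {n} (e : Edge n) u v → (src e ≡ u × tgt e ≡ v) ⊎ (src e ≡ v × tgt e ≡ u) → T (joins e u v)
joins⁺ e u v (inj₁ (a , b)) = T-∨⁺ˡ (T-∧⁺ (≡⇒≡ᵇ _ u a) (≡⇒≡ᵇ _ v b))
joins⁺ e u v (inj₂ (a , b)) = T-∨⁺ʳ {(src e ≡ᵇ u) ∧ (tgt e ≡ᵇ v)} (T-∧⁺ (≡⇒≡ᵇ _ v a) (≡⇒≡ᵇ _ u b))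

count-≡ : ∀ n a → ∑ (upTo n) (λ b → 𝟙 (b ≡ᵇ a)) ≤ 1
count-≡ n a = interval-count n a 0 (_≡ᵇ a) λ {b} t → ≤-reflexive (sym (≡ᵇ⇒≡ b a t)) , ≤-reflexive (trans (≡ᵇ⇒≡ b a t) (sym (+-identityʳ a)))

-- Edges are stored with the smaller endpoint as source, so only (u ⊓ v , u ⊔ v) can join u and v.
joins-count : ∀ n u v → ∑ (allEdges n) (λ e → 𝟙 (joins e u v)) ≤ 1
joins-count n u v = begin
    ∑ (allEdges n) (λ e → 𝟙 (joins e u v))
  ≡⟨ ∑-allEdges n _ ⟩
    ∑ (allFin n) (λ i → ∑ (allFin n) (λ j → 𝟙 (toℕ i <ᵇ toℕ j) * 𝟙 (joins (i , j) u v)))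
  ≤⟨ ∑-mono (allFin n) (λ i → ∑-mono (allFin n) λ j → ≤-trans (≤-reflexive (sym (𝟙-∧ (toℕ i <ᵇ toℕ j) (joins (i , j) u v)))) (𝟙-⇒ {(toℕ i <ᵇ toℕ j) ∧ joins (i , j) u v} (cell i j))) ⟩
    ∑ (allFin n) (λ i → ∑ (allFin n) (λ j → 𝟙 (toℕ i ≡ᵇ u ⊓ v) * 𝟙 (toℕ j ≡ᵇ u ⊔ v)))
  ≡⟨ trans (∑-cong (allFin n) λ i → trans (∑-*ˡ (allFin n) (𝟙 (toℕ i ≡ᵇ u ⊓ v)) _) (cong (𝟙 (toℕ i ≡ᵇ u ⊓ v) *_) (∑-allFin n (λ j → 𝟙 (j ≡ᵇ u ⊔ v)))))
       (trans (∑-*ʳ (allFin n) _ _) (cong (_* ∑ (upTo n) (λ j → 𝟙 (j ≡ᵇ u ⊔ v))) (∑-allFin n (λ i → 𝟙 (i ≡ᵇ u ⊓ v))))) ⟩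
    ∑ (upTo n) (λ i → 𝟙 (i ≡ᵇ u ⊓ v)) * ∑ (upTo n) (λ j → 𝟙 (j ≡ᵇ u ⊔ v))
  ≤⟨ count-≡ n (u ⊓ v) · count-≡ n (u ⊔ v) ⟩
    1 ∎
  where
  open ≤-Reasoning
  cell : ∀ i j → T ((toℕ i <ᵇ toℕ j) ∧ joins (i , j) u v) → 1 ≤ 𝟙 (toℕ i ≡ᵇ u ⊓ v) * 𝟙 (toℕ j ≡ᵇ u ⊔ v)
  cell i j t = let lt , jn = T-∧⁻ {toℕ i <ᵇ toℕ j} t in ends (<ᵇ⇒< (toℕ i) (toℕ j) lt) (joins⁻ (i , j) u v jn)
    where
    ends : ∀ {a b} → a < b → (a ≡ u × b ≡ v) ⊎ (a ≡ v × b ≡ u) → 1 ≤ 𝟙 (a ≡ᵇ u ⊓ v) * 𝟙 (b ≡ᵇ u ⊔ v)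
    ends a<b (inj₁ (refl , refl)) = ≤-reflexive (sym (cong₂ _*_ (𝟙-T (≡⇒≡ᵇ _ _ (sym (m≤n⇒m⊓n≡m (<⇒≤ a<b))))) (𝟙-T (≡⇒≡ᵇ _ _ (sym (m≤n⇒m⊔n≡n (<⇒≤ a<b)))))))
    ends a<b (inj₂ (refl , refl)) = ≤-reflexive (sym (cong₂ _*_ (𝟙-T (≡⇒≡ᵇ _ _ (sym (m≥n⇒m⊓n≡n (<⇒≤ a<b))))) (𝟙-T (≡⇒≡ᵇ _ _ (sym (m≥n⇒m⊔n≡m (<⇒≤ a<b)))))))

∈-allEdges : ∀ {n} (i j : Fin n) → toℕ i < toℕ j → (i , j) ∈ allEdges n
∈-allEdges {n} i j i<j = ∈-concatMap-intro _ (∈-allFin i) (∈-concatMap-intro _ (∈-allFin j) cell)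
  where
  cell : (i , j) ∈ (if toℕ i <ᵇ toℕ j then [ (i , j) ] else [])
  cell with toℕ i <ᵇ toℕ j | <⇒<ᵇ i<j
  ... | true | _ = here refl

trichotomy : ∀ i j → 𝟙 (i <ᵇ j) + (𝟙 (j <ᵇ i) + 𝟙 (j ≡ᵇ i)) ≡ 1
trichotomy zero    zero    = refl
trichotomy zero    (suc j) = refl
trichotomy (suc i) zero    = refl
trichotomy (suc i) (suc j) = trichotomy i j

square≤2*edges+n : ∀ n → n * n ≤ 2 * length (allEdges n) + n
square≤2*edges+n n = begin
    n * n
  ≡⟨ sym (trans (∑-cong U λ i → trans (sym (length-∑1 U)) (length-upTo n)) (trans (∑-const U n) (cong (_* n) (length-upTo n)))) ⟩
    ∑ U (λ i → ∑ U (λ j → 1))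
  ≡⟨ ∑-cong U (λ i → trans (∑-cong U λ j → sym (trichotomy i j)) (trans (∑-+ U _ _) (cong (∑ U (λ j → 𝟙 (i <ᵇ j)) +_) (∑-+ U _ _)))) ⟩
    ∑ U (λ i → ∑ U (λ j → 𝟙 (i <ᵇ j)) + (∑ U (λ j → 𝟙 (j <ᵇ i)) + ∑ U (λ j → 𝟙 (j ≡ᵇ i))))
  ≡⟨ trans (∑-+ U _ _) (cong (L +_) (∑-+ U _ _)) ⟩
    L + (∑ U (λ i → ∑ U (λ j → 𝟙 (j <ᵇ i))) + ∑ U (λ i → ∑ U (λ j → 𝟙 (j ≡ᵇ i))))
  ≤⟨ +-monoʳ-≤ L (+-mono-≤ (≤-reflexive (∑-swap U U (λ i j → 𝟙 (j <ᵇ i)))) (∑-mono U λ i → count-≡ n i)) ⟩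
    L + (L + ∑ U (λ i → 1))
  ≡⟨ cong₂ (λ a b → a + (a + b)) L≡ (trans (sym (length-∑1 U)) (length-upTo n)) ⟩
    M + (M + n)
  ≡⟨ l M n ⟩
    2 * M + n ∎
  where
  open ≤-Reasoning
  U : List ℕ
  U = upTo n
  L M : ℕ
  L = ∑ U (λ i → ∑ U (λ j → 𝟙 (i <ᵇ j)))
  M = length (allEdges n)
  l : ∀ M n → M + (M + n) ≡ 2 * M + n
  l = solve-∀
  L≡ : L ≡ M
  L≡ = sym (trans (length-∑1 (allEdges n)) (trans (∑-allEdges n _) (trans (∑-cong (allFin n) λ i → trans (∑-cong (allFin n) λ j → *-identityʳ _) (∑-allFin n (λ j → 𝟙 (toℕ i <ᵇ j))))
         (∑-allFin n (λ i → ∑ U (λ j → 𝟙 (i <ᵇ j)))))))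

edges≤square : ∀ n → length (allEdges n) ≤ n * n
edges≤square n = ≤-trans (≤-reflexive (length-∑1 (allEdges n))) (≤-trans (∑-edges≤ n (λ _ _ → 1))
  (≤-reflexive (trans (∑-cong U λ i → trans (sym (length-∑1 U)) (length-upTo n)) (trans (∑-const U n) (cong (_* n) (length-upTo n))))))
  where
  U : List ℕ
  U = upTo n

square≤4*edges : ∀ n → 2 ≤ n → n * n ≤ 4 * length (allEdges n)
square≤4*edges n 2≤n = +-cancelʳ-≤ (n * n) _ _ (begin
    n * n + n * n         ≡⟨ l1 (n * n) ⟩
    2 * (n * n)           ≤⟨ *-monoʳ-≤ 2 (square≤2*edges+n n) ⟩
    2 * (2 * M + n)       ≡⟨ l2 M n ⟩
    4 * M + 2 * n         ≤⟨ +-monoʳ-≤ (4 * M) (*-monoˡ-≤ n 2≤n) ⟩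
    4 * M + n * n         ∎)
  where
  open ≤-Reasoning
  M : ℕ
  M = length (allEdges n)
  l1 : ∀ a → a + a ≡ 2 * a
  l1 = solve-∀
  l2 : ∀ M n → 2 * (2 * M + n) ≡ 4 * M + 2 * n
  l2 = solve-∀

-- Sublists given by bit vectors.

module _ {A : Set} where
  vmap : (A → Bool) → (xs : List A) → Vec Bool (length xs)
  vmap p []       = []
  vmap p (x ∷ xs) = p x ∷ vmap p xs

  els : (xs : List A) → Vec Bool (length xs) → List A
  els []       []          = []
  els (x ∷ xs) (true  ∷ v) = x ∷ els xs v
  els (x ∷ xs) (false ∷ v) = els xs v

  length-els : ∀ xs v → length (els xs v) ≡ size v
  length-els []       []          = refl
  length-els (x ∷ xs) (true  ∷ v) = cong suc (length-els xs v)
  length-els (x ∷ xs) (false ∷ v) = length-els xs v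

  ⊑-vmap : ∀ p xs v → (v ⊑ᵇ vmap p xs) ≡ all p (els xs v)
  ⊑-vmap p []       []          = refl
  ⊑-vmap p (x ∷ xs) (true  ∷ v) = cong (p x ∧_) (⊑-vmap p xs v)
  ⊑-vmap p (x ∷ xs) (false ∷ v) = ⊑-vmap p xs v

  size-∩-vmap : ∀ p xs v → size (v ∩ vmap p xs) ≡ ∑ (els xs v) (λ x → 𝟙 (p x))
  size-∩-vmap p []       []          = refl
  size-∩-vmap p (x ∷ xs) (true  ∷ v) = cong (𝟙 (p x) +_) (size-∩-vmap p xs v)
  size-∩-vmap p (x ∷ xs) (false ∷ v) = size-∩-vmap p xs v

  size-vmap : ∀ p xs → size (vmap p xs) ≡ ∑ xs (λ x → 𝟙 (p x))
  size-vmap p []       = refl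
  size-vmap p (x ∷ xs) = cong (𝟙 (p x) +_) (size-vmap p xs)

  ∑-els≤ : ∀ xs v f → ∑ (els xs v) f ≤ ∑ xs f
  ∑-els≤ []       []          f = z≤n
  ∑-els≤ (x ∷ xs) (true  ∷ v) f = +-monoʳ-≤ (f x) (∑-els≤ xs v f)
  ∑-els≤ (x ∷ xs) (false ∷ v) f = ≤-trans (∑-els≤ xs v f) (m≤n+m _ (f x))

  ∈-els⁺ : ∀ p xs v {x} → vmap p xs ⊑ v → x ∈ xs → T (p x) → x ∈ els xs v
  ∈-els⁺ p (x ∷ xs) (true  ∷ v) s (here refl) t = here refl
  ∈-els⁺ p (x ∷ xs) (false ∷ v) s (here refl) t = ⊥-elim (clash (p x) s t)
    where clash : ∀ b {c} → T ((not b ∨ false) ∧ c) → T b → ⊥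
          clash true ()
  ∈-els⁺ p (x ∷ xs) (true  ∷ v) s (there m) t = there (∈-els⁺ p xs v (proj₂ (T-∧⁻ {not (p x) ∨ true} s)) m t)

  ∈-els⁺ p (x ∷ xs) (false ∷ v) s (there m) t = ∈-els⁺ p xs v (proj₂ (T-∧⁻ {not (p x) ∨ false} s)) m t

-- Cutting the cycle open

map-nth-upTo : ∀ {A : Set} (d : A) xs → map (nth d xs) (upTo (length xs)) ≡ xs
map-nth-upTo d []       = refl
map-nth-upTo d (x ∷ xs) = cong (x ∷_) (begin
    map (nth d (x ∷ xs)) (applyUpTo suc (length xs))   ≡⟨ cong (map _) (sym (map-upTo suc (length xs))) ⟩
    map (nth d (x ∷ xs)) (map suc (upTo (length xs)))  ≡⟨ sym (map-∘ (upTo (length xs))) ⟩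
    map (nth d xs) (upTo (length xs))                  ≡⟨ map-nth-upTo d xs ⟩
    xs                                                 ∎)
  where open ≡-Reasoning

nth-∈ : ∀ {A : Set} (d : A) xs {i} → i < length xs → nth d xs i ∈ xs
nth-∈ d (x ∷ xs) {zero}  _       = here refl
nth-∈ d (x ∷ xs) {suc i} (s≤s h) = there (nth-∈ d xs h)

∈-nth : ∀ {A : Set} (d : A) {xs x} → x ∈ xs → ∃ λ i → i < length xs × nth d xs i ≡ x
∈-nth d (here refl) = 0 , s≤s z≤n , refl
∈-nth d (there m)   = let i , h , e = ∈-nth d m in suc i , s≤s h , e

nth-map : ∀ {A B : Set} (d : A) (d′ : B) (g : A → B) xs {i} → i < length xs → nth d′ (map g xs) i ≡ g (nth d xs i)
nth-map d d′ g (x ∷ xs) {zero}  _       = refl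
nth-map d d′ g (x ∷ xs) {suc i} (s≤s h) = nth-map d d′ g xs h

nth-upTo : ∀ n {i} → i < n → nth 0 (upTo n) i ≡ i
nth-upTo n@(suc n′) {zero}  h       = refl
nth-upTo (suc n) {suc i} (s≤s h) = begin
    nth 0 (applyUpTo suc n) i  ≡⟨ cong (λ z → nth 0 z i) (sym (map-upTo suc n)) ⟩
    nth 0 (map suc (upTo n)) i ≡⟨ nth-map 0 0 suc (upTo n) (subst (i <_) (sym (length-upTo n)) h) ⟩
    suc (nth 0 (upTo n) i)     ≡⟨ cong suc (nth-upTo n h) ⟩
    suc i                      ∎
  where open ≡-Reasoning

nth-split : ∀ {A : Set} (d : A) xs {i} → i < length xs → ∃₂ λ ys zs → xs ≡ ys ++ nth d xs i ∷ zs × length ys ≡ i × (∀ j → nth d xs (suc (i + j)) ≡ nth d zs j) × length xs ≡ i + suc (length zs)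
nth-split d (x ∷ xs) {zero}  _       = [] , xs , refl , refl , (λ _ → refl) , refl
nth-split d (x ∷ xs) {suc i} (s≤s h) = let ys , zs , e , l , n , m = nth-split d xs h in x ∷ ys , zs , cong (x ∷_) e , cong suc l , n , cong suc m

-- `f` sends vertices to positions, while `p` lists the vertices by position.
inverse : ∀ {n f} → f ↭ upTo n → ∃ λ p → p ↭ upTo n × map (nth 0 f) p ≡ upTo n
inverse {n} {f} π with ↭-map-inv (nth 0 f) {upTo n} (subst (_↭ upTo n) (sym (trans (cong (map (nth 0 f) ∘ upTo) (sym len)) (map-nth-upTo 0 f))) π)
  where
  len : length f ≡ n
  len = trans (↭-length π) (length-upTo n)
... | p , e , σ = p , ↭-sym σ , sym e

take-+ : ∀ {A : Set} (xs ys : List A) m → take (length xs + m) (xs ++ ys) ≡ xs ++ take m ys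
take-+ []       ys m = refl
take-+ (x ∷ xs) ys m = cong (x ∷_) (take-+ xs ys m)

drop-+ : ∀ {A : Set} (xs ys : List A) m → drop (length xs + m) (xs ++ ys) ≡ drop m ys
drop-+ []       ys m = refl
drop-+ (x ∷ xs) ys m = drop-+ xs ys m

take-≤ : ∀ {A : Set} (xs ys : List A) {m} → m ≤ length xs → take m (xs ++ ys) ≡ take m xs
take-≤ []       ys z≤n     = refl
take-≤ (x ∷ xs) ys z≤n     = refl
take-≤ (x ∷ xs) ys (s≤s h) = cong (x ∷_) (take-≤ xs ys h)

drop-≤ : ∀ {A : Set} (xs ys : List A) {m} → m ≤ length xs → drop m (xs ++ ys) ≡ drop m xs ++ ys
drop-≤ []       ys z≤n     = refl
drop-≤ (x ∷ xs) ys z≤n     = refl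
drop-≤ (x ∷ xs) ys (s≤s h) = drop-≤ xs ys h

rotate : ∀ {A : Set} → ℕ → List A → List A
rotate g xs = drop g xs ++ take g xs

rotate-↭ : ∀ {A : Set} g (xs : List A) → rotate g xs ↭ xs
rotate-↭ g xs = subst (rotate g xs ↭_) (take++drop≡id g xs) (++-comm (drop g xs) (take g xs))

Within : ∀ {A : Set} → ℕ → List A → A → A → Set
Within k xs u v = ∃ λ as → ∃ λ bs → ∃ λ cs → xs ≡ as ++ u ∷ bs ++ v ∷ cs × length bs < k

module _ {A : Set} (u v : A) (as bs cs : List A) (k g : ℕ) where
  private
    p : List A
    p = as ++ u ∷ bs ++ v ∷ cs

  -- Rotation by g cuts the cycle just before position g. A cut before u or after v leaves the gap
  -- bs between them unchanged; a cut between them (`within-across`) puts v first, with the gap cs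
  -- ++ as.
  within-before : length bs < k → g ≤ length as → Within k (rotate g p) u v
  within-before h g≤ = drop g as , bs , cs ++ take g p , e , h
    where
    e : rotate g p ≡ drop g as ++ u ∷ bs ++ v ∷ cs ++ take g p
    e rewrite drop-≤ as (u ∷ bs ++ v ∷ cs) g≤ | ++-assoc (drop g as) (u ∷ bs ++ v ∷ cs) (take g p) | ++-assoc bs (v ∷ cs) (take g p) = refl

  within-after : length bs < k → ∀ d → g ≡ length as + suc (length bs + suc d) → Within k (rotate g p) u v
  within-after h d refl = drop g p ++ as , bs , take d cs , e , h
    where
    e : rotate g p ≡ (drop g p ++ as) ++ u ∷ bs ++ v ∷ take d cs
    e rewrite take-+ as (u ∷ bs ++ v ∷ cs) (suc (length bs + suc d)) | take-+ bs (v ∷ cs) (suc d) = sym (++-assoc (drop g p) as _)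

  within-across : length cs + length as < k → ∀ d → g ≡ length as + suc d → d ≤ length bs → Within k (rotate g p) v u
  within-across h d refl d≤ = drop d bs , cs ++ as , take d bs , e , subst (_< k) (sym (length-++ cs)) h
    where
    e : rotate g p ≡ drop d bs ++ v ∷ (cs ++ as) ++ u ∷ take d bs
    e rewrite take-+ as (u ∷ bs ++ v ∷ cs) (suc d) | drop-+ as (u ∷ bs ++ v ∷ cs) (suc d)
            | take-≤ bs (v ∷ cs) d≤ | drop-≤ bs (v ∷ cs) d≤ | ++-assoc (drop d bs) (v ∷ cs) (as ++ u ∷ take d bs) | ++-assoc cs as (u ∷ take d bs) = refl

-- The pairs tested by `expo`, recorded as vertices instead of positions, so that they can be
-- matched with edges independently of the random positions.
pairs : ℕ → List ℕ → List ℕ → List (ℕ × ℕ)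
pairs k h []       = []
pairs k h (x ∷ xs) = map (x ,_) (take k h) ++ pairs k (x ∷ h) xs

expo-pairs : ∀ k cl (φ : ℕ → ℕ) h xs → Pairs.expo k cl (map φ h) (map φ xs) ≡ ∑ (pairs k h xs) (λ e → 𝟙 (cl (φ (proj₁ e)) (φ (proj₂ e))))
expo-pairs k cl φ h []       = refl
expo-pairs k cl φ h (x ∷ xs) = trans (cong₂ _+_
    (trans (cong (λ z → ∑ z (λ b → 𝟙 (cl (φ x) b))) (take-map k h)) (trans (∑-map φ (take k h) _) (sym (∑-map (x ,_) (take k h) _))))
    (expo-pairs k cl φ (x ∷ h) xs))
  (sym (∑-++ (map (x ,_) (take k h)) _ _))

∈-take-mid : ∀ {A : Set} {v : A} k h₁ h₂ → length h₁ < k → v ∈ take k (h₁ ++ v ∷ h₂)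
∈-take-mid (suc k) []       h₂ _       = here refl
∈-take-mid (suc k) (x ∷ h₁) h₂ (s≤s l) = there (∈-take-mid k h₁ h₂ l)

pairs-mid : ∀ k {u v} h₁ h₂ mid post → length h₁ + length mid < k → (u , v) ∈ pairs k (h₁ ++ v ∷ h₂) (mid ++ u ∷ post)
pairs-mid k h₁ h₂ []        post l = ∈-++⁺ˡ (∈-map⁺ _ (∈-take-mid k h₁ h₂ (subst (_< k) (+-identityʳ _) l)))
pairs-mid k {u} {v} h₁ h₂ (x ∷ mid) post l = ∈-++⁺ʳ (map (x ,_) (take k (h₁ ++ v ∷ h₂))) (pairs-mid k (x ∷ h₁) h₂ mid post (subst (_< k) (+-suc (length h₁) (length mid)) l))

pairs-∈ : ∀ k {u v} h as bs cs → length bs < k → (u , v) ∈ pairs k h (as ++ v ∷ bs ++ u ∷ cs)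
pairs-∈ k h []       bs cs l = ∈-++⁺ʳ (map _ (take k h)) (pairs-mid k [] h bs cs l)
pairs-∈ k h (a ∷ as) bs cs l = ∈-++⁺ʳ (map (a ,_) (take k h)) (pairs-∈ k (a ∷ h) as bs cs l)

covered : ℕ → List ℕ → ∀ {n} → Edge n → Bool
covered k xs e = any (λ p → joins e (proj₁ p) (proj₂ p)) (pairs k [] xs)

sieve : (ℕ → Bool) → List ℕ → List ℕ
sieve p = filter (T? ∘ p)

-- Deleting other vertices from a sequence only shortens the gap between two that remain.
within-covered : ∀ {k p xs u v n} (e : Edge n) → Within k xs u v → T (p u) → T (p v) →
  (src e ≡ u × tgt e ≡ v) ⊎ (src e ≡ v × tgt e ≡ u) → T (covered k (sieve p xs) e)
within-covered {k} {p} {u = u} {v} e (as , bs , cs , refl , l) pu pv j =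
  T-any⁺ _ (subst ((v , u) ∈_) (cong (pairs k []) (sym eq)) (pairs-∈ k [] (sieve p as) (sieve p bs) (sieve p cs) (≤-<-trans (length-filter (T? ∘ p) bs) l)))
    (joins⁺ e v u (⊎-swap j))
  where
  eq : sieve p (as ++ u ∷ bs ++ v ∷ cs) ≡ sieve p as ++ u ∷ sieve p bs ++ v ∷ sieve p cs
  eq = trans (filter-++ (T? ∘ p) as _) (cong (sieve p as ++_) (trans (filter-accept (T? ∘ p) pu) (cong (u ∷_)
    (trans (filter-++ (T? ∘ p) bs _) (cong (sieve p bs ++_) (filter-accept (T? ∘ p) pv))))))

∑-sieve : ∀ p xs → length (sieve p xs) ≡ ∑ xs (λ x → 𝟙 (p x))
∑-sieve p []       = refl
∑-sieve p (x ∷ xs) with p x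
... | true  = cong suc (∑-sieve p xs)
... | false = ∑-sieve p xs

touched : ∀ {n} → List (Edge n) → ℕ → Bool
touched es x = any (λ e → (src e ≡ᵇ x) ∨ (tgt e ≡ᵇ x)) es

touched-src : ∀ {n es} {e : Edge n} → e ∈ es → T (touched es (src e))
touched-src {e = e} m = T-any⁺ _ m (T-∨⁺ˡ (≡⇒≡ᵇ (src e) _ refl))

touched-tgt : ∀ {n es} {e : Edge n} → e ∈ es → T (touched es (tgt e))
touched-tgt {e = e} m = T-any⁺ _ m (T-∨⁺ʳ {src e ≡ᵇ tgt e} (≡⇒≡ᵇ (tgt e) _ refl))

touched-count : ∀ n (es : List (Edge n)) → ∑ (upTo n) (λ x → 𝟙 (touched es x)) ≤ 2 * length es
touched-count n es = begin
    ∑ (upTo n) (λ x → 𝟙 (touched es x))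
  ≤⟨ ∑-mono (upTo n) (λ x → 𝟙-⇒ {touched es x} λ t → let e , m , p = T-any⁻ _ es t in ≤-trans (one {src e ≡ᵇ x} p) (∑-∈ (F x) m)) ⟩
    ∑ (upTo n) (λ x → ∑ es (F x))
  ≡⟨ ∑-swap (upTo n) es F ⟩
    ∑ es (λ e → ∑ (upTo n) (λ x → F x e))
  ≤⟨ ∑-mono es (λ e → ≤-trans (≤-reflexive (∑-+ (upTo n) _ _)) (+-mono-≤ (at-most-one (src e)) (at-most-one (tgt e)))) ⟩
    ∑ es (λ e → 2)
  ≡⟨ trans (∑-const es 2) (*-comm (length es) 2) ⟩
    2 * length es ∎
  where
  open ≤-Reasoning
  F : ℕ → Edge n → ℕ
  F x e = 𝟙 (src e ≡ᵇ x) + 𝟙 (tgt e ≡ᵇ x)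
  one : ∀ {a b} → T (a ∨ b) → 1 ≤ 𝟙 a + 𝟙 b
  one {true}         _ = s≤s z≤n
  one {false} {true} _ = s≤s z≤n
  at-most-one : ∀ a → ∑ (upTo n) (λ x → 𝟙 (a ≡ᵇ x)) ≤ 1
  at-most-one a = ≤-trans (∑-mono (upTo n) λ x → 𝟙-mono {a ≡ᵇ x} {x ≡ᵇ a} λ t → ≡⇒≡ᵇ x a (sym (≡ᵇ⇒≡ a x t))) (count-≡ n a)

count-below : ∀ n i → ∑ (upTo n) (λ g → 𝟙 (g ≤ᵇ i)) ≤ suc i
count-below n i = interval-count n 0 i (_≤ᵇ i) λ {b} t → z≤n , ≤ᵇ⇒≤ b i t

count-above : ∀ {n j} → j < n → ∑ (upTo n) (λ g → 𝟙 (j <ᵇ g)) + suc j ≤ n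
count-above {suc n} {zero} _ = ≤-trans (≤-reflexive (+-comm _ 1)) (s≤s (≤-trans (≤-reflexive (∑-applyUpTo suc n _)) (≤-trans (≤-reflexive (sym (length-∑1 (upTo n)))) (≤-reflexive (length-upTo n)))))
count-above {suc n} {suc j} (s≤s h) = ≤-trans (≤-reflexive (trans (cong (_+ suc (suc j)) (∑-applyUpTo suc n _)) (+-suc _ (suc j)))) (s≤s (count-above h))

-- An edge of the k-th power of a cycle is cut by at most k of the n rotations, so some rotation
-- cuts at most k / n of any given set of edges.
module Cut {n k : ℕ} {f : List ℕ} (1≤k : 1 ≤ k) (π : f ↭ upTo n) (p : List ℕ) (p↭ : p ↭ upTo n) (fp : map (nth 0 f) p ≡ upTo n) where
  length-p : length p ≡ n
  length-p = trans (↭-length p↭) (length-upTo n)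

  f∘p : ∀ {i} → i < n → nth 0 f (nth 0 p i) ≡ i
  f∘p {i} h = trans (sym (nth-map 0 0 (nth 0 f) p (subst (i <_) (sym length-p) h))) (trans (cong (λ z → nth 0 z i) fp) (nth-upTo n h))

  p∘f : ∀ {x} → x < n → nth 0 f x < n × nth 0 p (nth 0 f x) ≡ x
  p∘f {x} x<n with ∈-nth 0 (∈-resp-↭ (↭-sym p↭) (∈-upTo⁺ x<n))
  ... | i , i<p , refl = subst (_< n) (sym e) (subst (i <_) length-p i<p) , cong (nth 0 p) e
    where e : nth 0 f (nth 0 p i) ≡ i
          e = f∘p (subst (i <_) length-p i<p)

  split₂ : ∀ {i j} → i < j → j < n → ∃ λ as → ∃ λ bs → ∃ λ cs →
    p ≡ as ++ nth 0 p i ∷ bs ++ nth 0 p j ∷ cs × length as ≡ i × suc (i + length bs) ≡ j × j + suc (length cs) ≡ n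
  split₂ {i} {j} i<j j<n with nth-split 0 p {i} (subst (i <_) (sym length-p) (<-trans i<j j<n)) | m≤n⇒∃[o]m+o≡n i<j
  ... | as , zs , e , la , nz , lz | d , refl with nth-split 0 zs {d} (+-cancelˡ-< (suc i) _ _ (subst (suc i + d <_) (trans (sym length-p) (trans lz (+-suc i _))) j<n))
  ...   | bs , cs , e′ , lb , _ , lc = as , bs , cs , trans e (cong (λ z → as ++ nth 0 p i ∷ z) (trans e′ (cong (λ z → bs ++ z ∷ cs) (sym (nz d)))))
          , la , cong (λ z → suc (i + z)) lb , trans (trans (cong suc (trans (+-assoc i d _) (cong (i +_) (sym lc)))) (sym (+-suc i _))) (trans (sym lz) length-p)

  module _ (es : List (Edge n)) where
    order : ℕ → List ℕ
    order g = sieve (touched es) (rotate g p)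

    -- A pair with j - i ≤ k is separated only by the cuts with i < g ≤ j, which are j - i in
    -- number. For a pair that is close around the end it is the complementary cuts g ≤ i and g > j
    -- that separate it, and there are n - (j - i) of them.
    cuts : ∀ {e i j} → e ∈ es → i < j → j < n → (src e ≡ nth 0 p i × tgt e ≡ nth 0 p j) ⊎ (src e ≡ nth 0 p j × tgt e ≡ nth 0 p i) →
           Close k n i j → ∑ (upTo n) (λ g → 𝟙 (not (covered k (order g) e))) ≤ k
    cuts {e} {i} {j} m i<j j<n ends cl with split₂ i<j j<n
    ... | as , bs , cs , p≡ , refl , lb , lc = go cl
      where
      u v : ℕ
      u = nth 0 p i
      v = nth 0 p j
      marked : (src e ≡ u × tgt e ≡ v) ⊎ (src e ≡ v × tgt e ≡ u) → T (touched es u) × T (touched es v)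
      marked (inj₁ (a , b)) = subst (λ z → T (touched es z)) a (touched-src m) , subst (λ z → T (touched es z)) b (touched-tgt m)
      marked (inj₂ (a , b)) = subst (λ z → T (touched es z)) b (touched-tgt m) , subst (λ z → T (touched es z)) a (touched-src m)
      vis : ∀ g → Within k (rotate g p) u v → T (covered k (order g) e)
      vis g w = within-covered e w (proj₁ (marked ends)) (proj₂ (marked ends)) ends
      vis′ : ∀ g → Within k (rotate g p) v u → T (covered k (order g) e)
      vis′ g w = within-covered e w (proj₂ (marked ends)) (proj₁ (marked ends)) (⊎-swap ends)
      direct : j ≤ i + k → ∑ (upTo n) (λ g → 𝟙 (not (covered k (order g) e))) ≤ k
      direct j≤ = subst (∑ (upTo n) (λ g → 𝟙 (not (covered k (order g) e))) ≤_) (suc-pred k ⦃ >-nonZero 1≤k ⦄) (interval-count n (suc i) (pred k) _ λ {g} t → between g (T-not⁻ t))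
        where
        lb<k : length bs < k
        lb<k = +-cancelˡ-≤ i _ _ (≤-trans (≤-reflexive (trans (+-suc i _) lb)) j≤)
        between : ∀ g → ¬ T (covered k (order g) e) → suc i ≤ g × g ≤ suc i + pred k
        between g ¬c = ≰⇒> (λ g≤i → ¬c (vis g (subst (λ z → Within k (rotate g z) u v) (sym p≡) (within-before u v as bs cs k g lb<k g≤i)))) ,
          ≤-trans (≮⇒≥ λ j<g → ¬c (after j<g)) (≤-trans j≤ (≤-reflexive (trans (cong (i +_) (sym (suc-pred k ⦃ >-nonZero 1≤k ⦄))) (+-suc i (pred k)))))
          where
          after : j < g → T (covered k (order g) e)
          after j<g with m≤n⇒∃[o]m+o≡n j<g
          ... | d , refl = vis g (subst (λ z → Within k (rotate g z) u v) (sym p≡) (within-after u v as bs cs k g lb<k d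
                (trans (cong (λ z → suc (z + d)) (sym lb)) (l i (length bs) d))))
            where l : ∀ i b d → suc (suc (i + b) + d) ≡ i + suc (b + suc d)
                  l = solve-∀
      around : i + n ≤ j + k → ∑ (upTo n) (λ g → 𝟙 (not (covered k (order g) e))) ≤ k
      around h = begin
          ∑ (upTo n) (λ g → 𝟙 (not (covered k (order g) e)))
        ≤⟨ ∑-mono (upTo n) (λ g → 𝟙-⇒ {not (covered k (order g) e)} λ t → outside g (T-not⁻ t)) ⟩
          ∑ (upTo n) (λ g → 𝟙 (g ≤ᵇ i) + 𝟙 (j <ᵇ g))
        ≡⟨ ∑-+ (upTo n) _ _ ⟩
          ∑ (upTo n) (λ g → 𝟙 (g ≤ᵇ i)) + ∑ (upTo n) (λ g → 𝟙 (j <ᵇ g))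
        ≤⟨ +-monoˡ-≤ _ (count-below n i) ⟩
          suc i + ∑ (upTo n) (λ g → 𝟙 (j <ᵇ g))
        ≤⟨ +-cancelʳ-≤ (suc j) _ _ (≤-trans (≤-reflexive (+-assoc (suc i) _ (suc j))) (≤-trans (+-monoʳ-≤ (suc i) (count-above j<n)) (≤-trans (s≤s h) (≤-reflexive (+-comm (suc j) k))))) ⟩
          k ∎
        where
        open ≤-Reasoning
        lc<k : length cs + length as < k
        lc<k = +-cancelˡ-≤ j _ _ (≤-trans (≤-reflexive (trans (l j (length cs) (length as)) (trans (cong (length as +_) lc) refl))) h)
          where l : ∀ j c a → j + suc (c + a) ≡ a + (j + suc c)
                l = solve-∀
        outside : ∀ g → ¬ T (covered k (order g) e) → 1 ≤ 𝟙 (g ≤ᵇ i) + 𝟙 (j <ᵇ g)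
        outside g ¬c with g ≤? i | j <? g
        ... | yes a | _     = ≤-trans (≤-reflexive (sym (𝟙-T (≤⇒≤ᵇ a)))) (m≤m+n _ _)
        ... | no _  | yes b = ≤-trans (≤-reflexive (sym (𝟙-T (<⇒<ᵇ b)))) (m≤n+m _ (𝟙 (g ≤ᵇ i)))
        ... | no a  | no b with m≤n⇒∃[o]m+o≡n (≰⇒> a)
        ...   | d , refl = contradiction (vis′ g (subst (λ z → Within k (rotate g z) v u) (sym p≡) (within-across u v as bs cs k g lc<k d (sym (+-suc i d))
                  (+-cancelˡ-≤ (suc i) _ _ (≤-trans (≮⇒≥ b) (≤-reflexive (sym lb))))))) ¬c
      go : Close k n i j → ∑ (upTo n) (λ g → 𝟙 (not (covered k (order g) e))) ≤ k
      go (inj₁ (_ , h))        = direct h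
      go (inj₂ (inj₁ h))       = around h
      -- As i < j, this case forces k > n, and the pair is then also close in the direct sense.
      go (inj₂ (inj₂ h))       = direct (≤-trans (m≤m+n j n) h)

    order-↭ : ∀ g → rotate g p ↭ upTo n
    order-↭ g = ↭-trans (rotate-↭ g p) p↭

    order-unique : ∀ g → Unique (order g)
    order-unique g = Unique-filter⁺ _ (Unique-resp-↭ (setoid ℕ) (↭⇒↭ₛ (↭-sym (order-↭ g))) (upTo⁺ n))

    order-< : ∀ g → All (_< n) (order g)
    order-< g = All-filter⁺ (T? ∘ touched es) (tabulateᴬ λ m → ∈-upTo⁻ (∈-resp-↭ (order-↭ g) m))

    order-length : ∀ g → length (order g) ≤ 2 * length es
    order-length g = ≤-trans (≤-reflexive (trans (∑-sieve (touched es) (rotate g p)) (∑-↭ _ (order-↭ g)))) (touched-count n es)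

    good-cut : 1 ≤ n → (∀ {e} → e ∈ es → src e < tgt e × T (close k n (nth 0 f (src e)) (nth 0 f (tgt e)))) →
      ∃ λ g → n * ∑ es (λ e → 𝟙 (not (covered k (order g) e))) ≤ k * length es
    good-cut 1≤n hyp with argmin (λ _ → true) cost (upTo n) (∈-upTo⁺ 1≤n) tt
      where
      cost : ℕ → ℕ
      cost g = ∑ es (λ e → 𝟙 (not (covered k (order g) e)))
    ... | g , _ , _ , min = g , (begin
        n * cost g
      ≡⟨ trans (cong (_* cost g) (sym (length-upTo n))) (sym (∑-const (upTo n) (cost g))) ⟩
        ∑ (upTo n) (λ _ → cost g)
      ≤⟨ ∑-mono∈ (upTo n) (λ m → min m tt) ⟩
        ∑ (upTo n) cost
      ≡⟨ ∑-swap (upTo n) es _ ⟩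
        ∑ es (λ e → ∑ (upTo n) (λ g → 𝟙 (not (covered k (order g) e))))
      ≤⟨ ∑-mono∈ es each ⟩
        ∑ es (λ _ → k)
      ≡⟨ trans (∑-const es k) (*-comm (length es) k) ⟩
        k * length es ∎)
      where
      open ≤-Reasoning
      cost : ℕ → ℕ
      cost g = ∑ es (λ e → 𝟙 (not (covered k (order g) e)))
      each : ∀ {e} → e ∈ es → ∑ (upTo n) (λ g → 𝟙 (not (covered k (order g) e))) ≤ k
      each {e} m with hyp m | p∘f (toℕ<n (proj₁ e)) | p∘f (toℕ<n (proj₂ e))
      ... | s<t , cl | i<n , pi | j<n , pj with <-cmp (nth 0 f (src e)) (nth 0 f (tgt e))
      ...   | tri< i<j _ _ = cuts m i<j j<n (inj₁ (sym pi , sym pj)) (close⁻ k n _ _ cl)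
      ...   | tri> _ _ j<i = cuts m j<i i<n (inj₂ (sym pi , sym pj)) (close⁻ k n _ _ (close-sym k n (nth 0 f (src e)) (nth 0 f (tgt e)) cl))
      ...   | tri≈ _ i≡j _ = contradiction (trans (sym pi) (trans (cong (nth 0 p) i≡j) pj)) (<⇒≢ s<t)

-- Each close covered edge is charged to a pair of `xs` that it joins. A pair receives at most one
-- edge by `joins-count`, and is itself close, hence counted by `expo`. Uncovered edges are paid for
-- in full.
covered-bound : ∀ {n} k xs (es : List (Edge n)) φ → (∀ F → ∑ es F ≤ ∑ (allEdges n) F) →
  ∑ es (λ e → 𝟙 (close k n (φ (src e)) (φ (tgt e)))) ≤ ∑ es (λ e → 𝟙 (not (covered k xs e))) + Pairs.expo k (close k n) [] (map φ xs)
covered-bound {n} k xs es φ sub = begin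
    ∑ es (λ e → 𝟙 (cl e))
  ≤⟨ ∑-mono es each ⟩
    ∑ es (λ e → 𝟙 (not (covered k xs e)) + ∑ ps (λ p → 𝟙 (clp p) * 𝟙 (joins e (proj₁ p) (proj₂ p))))
  ≡⟨ trans (∑-+ es _ _) (cong (X +_) (trans (∑-swap es ps _) (∑-cong ps λ p → ∑-*ˡ es (𝟙 (clp p)) _))) ⟩
    X + ∑ ps (λ p → 𝟙 (clp p) * ∑ es (λ e → 𝟙 (joins e (proj₁ p) (proj₂ p))))
  ≤⟨ +-monoʳ-≤ X (∑-mono ps λ p → ≤-trans (*-monoʳ-≤ (𝟙 (clp p)) (≤-trans (sub _) (joins-count n (proj₁ p) (proj₂ p)))) (≤-reflexive (*-identityʳ _))) ⟩
    X + ∑ ps (λ p → 𝟙 (clp p))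
  ≡⟨ cong (X +_) (sym (expo-pairs k (close k n) φ [] xs)) ⟩
    X + Pairs.expo k (close k n) [] (map φ xs) ∎
  where
  open ≤-Reasoning
  ps : List (ℕ × ℕ)
  ps = pairs k [] xs
  cl : Edge n → Bool
  cl e = close k n (φ (src e)) (φ (tgt e))
  clp : ℕ × ℕ → Bool
  clp p = close k n (φ (proj₁ p)) (φ (proj₂ p))
  X : ℕ
  X = ∑ es (λ e → 𝟙 (not (covered k xs e)))
  each : ∀ e → 𝟙 (cl e) ≤ 𝟙 (not (covered k xs e)) + ∑ ps (λ p → 𝟙 (clp p) * 𝟙 (joins e (proj₁ p) (proj₂ p)))
  each e = 𝟙-⇒ {cl e} λ c → split c (T? (covered k xs e))
    where
    transfer : ∀ p → T (joins e (proj₁ p) (proj₂ p)) → T (cl e) → T (clp p)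
    transfer p j c with joins⁻ e (proj₁ p) (proj₂ p) j
    ... | inj₁ (a , b) = subst₂ (λ x y → T (close k n (φ x) (φ y))) a b c
    ... | inj₂ (a , b) = close-sym k n (φ (proj₂ p)) (φ (proj₁ p)) (subst₂ (λ x y → T (close k n (φ x) (φ y))) a b c)
    split : T (cl e) → Dec (T (covered k xs e)) → 1 ≤ 𝟙 (not (covered k xs e)) + ∑ ps (λ p → 𝟙 (clp p) * 𝟙 (joins e (proj₁ p) (proj₂ p)))
    split c (no ¬t) = ≤-trans (≤-reflexive (sym (𝟙-T (T-not⁺ ¬t)))) (m≤m+n _ _)
    split c (yes t) = let p , m , j = T-any⁻ _ ps t in
      ≤-trans (≤-reflexive (sym (cong₂ _*_ (𝟙-T (transfer p j c)) (𝟙-T j)))) (≤-trans (∑-∈ (λ p → 𝟙 (clp p) * 𝟙 (joins e (proj₁ p) (proj₂ p))) m) (m≤n+m _ (𝟙 (not (covered k xs e)))))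

∈-els⁻ : ∀ {A : Set} (xs : List A) v {x} → x ∈ els xs v → x ∈ xs
∈-els⁻ []       []          ()
∈-els⁻ (x ∷ xs) (true  ∷ v) (here p)  = here p
∈-els⁻ (x ∷ xs) (true  ∷ v) (there m) = there (∈-els⁻ xs v m)
∈-els⁻ (x ∷ xs) (false ∷ v) m         = there (∈-els⁻ xs v m)

∈-allEdges⇒< : ∀ {n} {e : Edge n} → e ∈ allEdges n → src e < tgt e
∈-allEdges⇒< {n} {e} m with src e <? tgt e
... | yes h = h
... | no ¬h = contradiction (≤-trans (≤-reflexive (sym (𝟙-T (T-not⁺ {src e <ᵇ tgt e} λ t → ¬h (<ᵇ⇒< (src e) _ t))))) (≤-trans (∑-∈ (λ e → 𝟙 (not (src e <ᵇ tgt e))) m) (≤-reflexive all0))) λ ()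
  where
  cell : ∀ b → 𝟙 b * 𝟙 (not b) ≡ 0
  cell true  = refl
  cell false = refl
  all0 : ∑ (allEdges n) (λ e → 𝟙 (not (src e <ᵇ tgt e))) ≡ 0
  all0 = trans (∑-allEdges n _) (trans (∑-cong (allFin n) λ i → trans (∑-cong (allFin n) λ j → cell (toℕ i <ᵇ toℕ j)) (∑-zero (allFin n))) (∑-zero (allFin n)))

-- Spread of the family of copies.

closeᴱ : ∀ k {n} → List ℕ → Edge n → Bool
closeᴱ k {n} f e = close k n (nth 0 f (src e)) (nth 0 f (tgt e))

wsum-∑Π : ∀ α β {M} Rs (F : Vec Bool M → List ℕ → ℕ) → wsum α β (λ v → ∑Π Rs (F v)) ≡ ∑Π Rs (λ f → wsum α β (λ v → F v f))
wsum-∑Π α β []       F = refl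
wsum-∑Π α β {M} (R ∷ Rs) F = trans (wsum-∑ α β {M} R _) (∑-cong R λ q → wsum-∑Π α β Rs (λ v f → F v (q ∷ f)))

nth-mask : ∀ fl f {x} → length fl ≡ length f → x < length f → T (nth false fl x) → nth 0 (mask fl f) x ≡ nth 0 f x
nth-mask (true ∷ fl) (q ∷ f) {zero}  e _ t = refl
nth-mask (b ∷ fl)    (q ∷ f) {suc x} e (s≤s h) t = nth-mask fl f (suc-injective e) h t

all-cong : ∀ {A : Set} {p q : A → Bool} xs → (∀ {x} → x ∈ xs → p x ≡ q x) → all p xs ≡ all q xs
all-cong []       h = refl
all-cong (x ∷ xs) h = cong₂ _∧_ (h (here refl)) (all-cong xs (h ∘ there))

All-ranges : ∀ {P : List ℕ → Set} {As} → All P As → All P (ranges As)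
All-ranges [] = []
All-ranges {P} {A ∷ As} (p ∷ ps) = go (length A)
  where
  go : ∀ j → All P (replicate j A ++ ranges As)
  go zero    = All-ranges ps
  go (suc j) = p ∷ go j

length-ranges : ∀ As → length (ranges As) ≡ length (concat As)
length-ranges []       = refl
length-ranges (A ∷ As) = trans (length-++ (replicate (length A) A)) (trans (cong₂ _+_ (length-replicate (length A)) (length-ranges As)) (sym (length-++ A)))

blockPerms-↭ : ∀ As {f} → f ∈ blockPerms As → f ↭ concat As
blockPerms-↭ []       (here refl) = ↭-refl
blockPerms-↭ (A ∷ As) m with ∈-blockPerms⁻ {A} {As} m
... | g , h , mg , mh , refl = ++⁺ (∈-sel⇒↭ {length A} {A} refl mg) (blockPerms-↭ As mh)

∑-concat-∈ : ∀ As {A} (g : ℕ → ℕ) → A ∈ As → ∑ A g ≤ ∑ (concat As) g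
∑-concat-∈ (A ∷ As) g (here refl) = ≤-trans (m≤m+n _ _) (≤-reflexive (sym (∑-++ A _ g)))
∑-concat-∈ (A ∷ As) g (there m)   = ≤-trans (∑-concat-∈ As g m) (≤-trans (m≤n+m _ (∑ A g)) (≤-reflexive (sym (∑-++ A _ g))))

4^≤16^ : ∀ {v} s → v ≤ 2 * s → 4 ^ v ≤ 16 ^ s
4^≤16^ s h = ≤-trans (^-monoʳ (s≤s z≤n) h) (≤-reflexive (sym (^-*-assoc 4 2 s)))

module Spread (n k r y : ℕ) (As : List (List ℕ)) (concat-As : concat As ≡ upTo n) (big : All (λ A → r * r ≤ length A) As)
  (1≤n : 1 ≤ n) (1≤k : 1 ≤ k) (1≤r : 1 ≤ r)
  (hyp₁ : 2 * (k * (spread k * spread k)) * (1 + 16 * y) ≤ r)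
  (hyp₂ : 2 * k * (k * (spread k * spread k)) * (1 + 16 * y) ^ k ≤ r * r) where

  open MomentOf n k (spread k) (1 + 16 * y) r (close k n) (λ {q} _ → close-refl k n q) (close-row k n) (close-col k n) 1≤k (s≤s z≤n) 1≤r hyp₁ hyp₂

  E : List (Edge n)
  E = allEdges n

  fs : List (List ℕ)
  fs = blockPerms As

  H : List (Vec Bool (length E))
  H = map (λ f → vmap (closeᴱ k f) E) fs

  open Fragments H public

  fs-↭ : ∀ {f} → f ∈ fs → f ↭ upTo n
  fs-↭ {f} m = subst (f ↭_) concat-As (blockPerms-↭ As m)

  fs-length : ∀ {f} → f ∈ fs → length f ≡ n
  fs-length m = trans (↭-length (fs-↭ m)) (length-upTo n)

  Rs : List (List ℕ)
  Rs = ranges As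

  length-Rs : length Rs ≡ n
  length-Rs = trans (length-ranges As) (trans (cong length concat-As) (length-upTo n))

  Rs-Range : All Range Rs
  Rs-Range = All-ranges (tabulateᴬ λ {A} m → (λ q∈ → ∈-upTo⁻ (subst (_ ∈_) concat-As (∈-concat⁺′ q∈ m))) ,
    (λ g → subst (λ z → ∑ A g ≤ ∑ z g) concat-As (∑-concat-∈ As g m)) , lookupᴬ big m)

  Φ : ℕ
  Φ = ∑Π Rs (λ _ → 1)

  Φ-pos : 1 ≤ Φ
  Φ-pos = subst (1 ≤_) (sym (∑Π-1 Rs)) (lengths-pos Rs Rs-Range)

  cnt-fs : ∀ X → cnt X ≡ ∑ fs (λ f → 𝟙 (all (closeᴱ k f) (els E X)))
  cnt-fs X = trans (∑-map _ fs _) (∑-cong fs λ f → cong 𝟙 (⊑-vmap (closeᴱ k f) E X))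

  -- The edges of X touch at most two vertices each, and passing to independent positions costs 4
  -- per touched vertex, which makes 16 per edge.
  cnt-spread : ∀ X → cnt X * Φ ≤ 16 ^ size X * (length fs * ∑Π Rs (λ φ → 𝟙 (X ⊑ᵇ vmap (closeᴱ k φ) E)))
  cnt-spread X = begin
      cnt X * Φ
    ≡⟨ trans (cong (_* Φ) (trans (cnt-fs X) (∑-cong∈ fs λ m → cong 𝟙 (masked (fs-length m))))) (*-comm _ Φ) ⟩
      Φ * ∑ fs (Pr ∘ mask fl)
    ≤⟨ blockPerms-spread As fl Pr (trans length-fl (sym (trans (cong length concat-As) (length-upTo n)))) ⟩
      4 ^ trues fl * (length fs * ∑Π Rs (Pr ∘ mask fl))
    ≡⟨ cong (λ z → 4 ^ trues fl * (length fs * z)) (∑Π-cong Rs λ pw → cong 𝟙 (trans (sym (masked (trans (Pointwise-length pw) length-Rs))) (sym (⊑-vmap _ E X)))) ⟩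
      4 ^ trues fl * (length fs * ∑Π Rs (λ φ → 𝟙 (X ⊑ᵇ vmap (closeᴱ k φ) E)))
    ≤⟨ *-monoˡ-≤ _ (4^≤16^ (size X) (≤-trans (≤-reflexive (∑-map _ (upTo n) 𝟙)) (≤-trans (touched-count n es) (≤-reflexive (cong (2 *_) (length-els E X)))))) ⟩
      16 ^ size X * (length fs * ∑Π Rs (λ φ → 𝟙 (X ⊑ᵇ vmap (closeᴱ k φ) E))) ∎
    where
    open ≤-Reasoning
    es : List (Edge n)
    es = els E X
    fl : List Bool
    fl = map (touched es) (upTo n)
    length-fl : length fl ≡ n
    length-fl = trans (length-map _ (upTo n)) (length-upTo n)
    Pr : List ℕ → ℕ
    Pr f = 𝟙 (all (closeᴱ k f) es)
    -- Whether the copy of f contains X depends only on the positions of the vertices touched by X,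
    -- and the mask keeps these.
    masked : ∀ {f} → length f ≡ n → all (closeᴱ k f) es ≡ all (closeᴱ k (mask fl f)) es
    masked {f} lf = all-cong es λ {e} m → sym (cong₂ (close k n) (at-end (proj₁ e) (touched-src m)) (at-end (proj₂ e) (touched-tgt m)))
      where
      at-end : ∀ (i : Fin n) → T (touched es (toℕ i)) → nth 0 (mask fl f) (toℕ i) ≡ nth 0 f (toℕ i)
      at-end i t = nth-mask fl f (trans length-fl (sym lf)) (subst (toℕ i <_) (sym lf) (toℕ<n i))
        (subst T (sym (trans (nth-map 0 false (touched es) (upTo n) (subst (toℕ i <_) (sym (length-upTo n)) (toℕ<n i))) (cong (touched es) (nth-upTo n (toℕ<n i))))) t)

  -- The fragment sum over all X ⊆ U, with factor y per edge; `Rounds` takes y = Λ * q, which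
  -- includes the tilt for the tail bound.
  weight : Vec Bool (length E) → ℕ
  weight U = wsum y 1 (λ X → 𝟙 (X ⊑ᵇ U) * cnt X)

  -- After the passage to independent positions φ, the sum over X ⊆ U can be carried out for each φ
  -- separately by `wsum-binomial`.
  weight-moment : ∀ U → weight U * Φ ≤ length fs * ∑Π Rs (λ φ → (1 + 16 * y) ^ size (U ∩ vmap (closeᴱ k φ) E))
  weight-moment U = begin
      weight U * Φ
    ≡⟨ trans (*-comm _ Φ) (sym (wsum-*ˡ y 1 {length E} Φ _)) ⟩
      wsum y 1 (λ X → Φ * (𝟙 (X ⊑ᵇ U) * cnt X))
    ≤⟨ wsum-mono y 1 (λ X → ≤-trans (≤-reflexive (l1 Φ (𝟙 (X ⊑ᵇ U)) (cnt X))) (≤-trans (*-monoʳ-≤ (𝟙 (X ⊑ᵇ U)) (cnt-spread X)) (≤-reflexive (l2 (𝟙 (X ⊑ᵇ U)) (16 ^ size X) (length fs) _)))) ⟩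
      wsum y 1 (λ X → 16 ^ size X * (length fs * (𝟙 (X ⊑ᵇ U) * ∑Π Rs (λ φ → 𝟙 (X ⊑ᵇ vmap (closeᴱ k φ) E)))))
    ≡⟨ sym (wsum-scale 16 y {length E} _) ⟩
      wsum (16 * y) 1 (λ X → length fs * (𝟙 (X ⊑ᵇ U) * ∑Π Rs (λ φ → 𝟙 (X ⊑ᵇ vmap (closeᴱ k φ) E))))
    ≡⟨ wsum-*ˡ (16 * y) 1 {length E} (length fs) _ ⟩
      length fs * wsum (16 * y) 1 (λ X → 𝟙 (X ⊑ᵇ U) * ∑Π Rs (λ φ → 𝟙 (X ⊑ᵇ vmap (closeᴱ k φ) E)))
    ≡⟨ cong (length fs *_) (trans (wsum-cong (16 * y) 1 {length E} λ X → sym (∑Π-*ˡ Rs (𝟙 (X ⊑ᵇ U)) _)) (trans (wsum-∑Π (16 * y) 1 {length E} Rs _)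
         (∑Π-cong Rs λ {φ} _ → wsum-binomial (16 * y) U (vmap (closeᴱ k φ) E)))) ⟩
      length fs * ∑Π Rs (λ φ → (1 + 16 * y) ^ size (U ∩ vmap (closeᴱ k φ) E)) ∎
    where
    open ≤-Reasoning
    l1 : ∀ a b c → a * (b * c) ≡ b * (c * a)
    l1 = solve-∀
    l2 : ∀ a b c d → a * (b * (c * d)) ≡ b * (c * (a * d))
    l2 = solve-∀

  -- κ counts the edges of U lost when its cycle is cut at the best place; each is charged the
  -- maximal factor 1 + 16 y. The remaining overlap is controlled by the moment bound along the at
  -- most 2 |U| touched vertices, at 1 + 1/r each.
  weight-bound : ∀ {f} U → f ∈ fs → U ⊑ vmap (closeᴱ k f) E → ∃ λ κ → n * κ ≤ k * size U ×
    r ^ (2 * size U) * weight U ≤ suc r ^ (2 * size U) * (length fs * (1 + 16 * y) ^ κ)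
  weight-bound {f} U f∈ U⊑ with inverse (fs-↭ f∈)
  ... | p , p↭ , fp with Cut.good-cut 1≤k (fs-↭ f∈) p p↭ fp (els E U) 1≤n
         (λ {e} m → ∈-allEdges⇒< (∈-els⁻ E U m) , T-all⁻ (closeᴱ k f) (subst T (⊑-vmap _ E U) U⊑) m)
  ... | g , cut = κ , subst (λ z → n * κ ≤ k * z) (length-els E U) cut , *-cancelʳ-≤ _ _ Φ ⦃ >-nonZero Φ-pos ⦄ (begin
      r ^ (2 * size U) * weight U * Φ
    ≡⟨ trans (cong (λ z → r ^ z * weight U * Φ) (sym (m+[n∸m]≡n L≤))) (trans (cong (λ z → z * weight U * Φ) (^-distribˡ-+-* r L d)) (l1 (r ^ L) (r ^ d) (weight U) Φ)) ⟩
      r ^ d * (r ^ L * (weight U * Φ))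
    -- Padding by d factors replaces the number L of touched vertices by the uniform exponent 2 |U|.
    ≤⟨ ^-monoˡ d (n≤1+n r) · *-monoʳ-≤ (r ^ L) (≤-trans (weight-moment U) (*-monoʳ-≤ (length fs) ≤-refl)) ⟩
      suc r ^ d * (r ^ L * (length fs * ∑Π Rs (λ φ → Y ^ size (U ∩ vmap (closeᴱ k φ) E))))
    ≡⟨ cong (suc r ^ d *_) (x∙yz≈y∙xz (r ^ L) (length fs) _) ⟩
      suc r ^ d * (length fs * (r ^ L * ∑Π Rs (λ φ → Y ^ size (U ∩ vmap (closeᴱ k φ) E))))
    ≤⟨ *-monoʳ-≤ (suc r ^ d) (*-monoʳ-≤ (length fs) (∑Π-bound Rs xs (Y ^ κ) _ Rs-Range uniq (subst (λ z → All (_< z) xs) (sym length-Rs) xs<) λ φ _ → split φ)) ⟩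
      suc r ^ d * (length fs * (suc r ^ L * (Y ^ κ * Φ)))
    ≡⟨ l3 (suc r ^ d) (length fs) (suc r ^ L) (Y ^ κ) Φ ⟩
      suc r ^ L * suc r ^ d * (length fs * Y ^ κ) * Φ
    ≡⟨ cong (λ z → z * (length fs * Y ^ κ) * Φ) (trans (sym (^-distribˡ-+-* (suc r) L d)) (cong (suc r ^_) (m+[n∸m]≡n L≤))) ⟩
      suc r ^ (2 * size U) * (length fs * Y ^ κ) * Φ ∎)
    where
    open ≤-Reasoning
    module Q = Cut 1≤k (fs-↭ f∈) p p↭ fp
    es : List (Edge n)
    es = els E U
    xs : List ℕ
    xs = Q.order es g
    uniq : Unique xs
    uniq = Q.order-unique es g
    xs< : All (_< n) xs
    xs< = Q.order-< es g
    Y κ L d : ℕ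
    Y = 1 + 16 * y
    κ = ∑ es (λ e → 𝟙 (not (covered k xs e)))
    L = length xs
    d = 2 * size U ∸ L
    L≤ : L ≤ 2 * size U
    L≤ = ≤-trans (Q.order-length es g) (≤-reflexive (cong (2 *_) (length-els E U)))
    split : ∀ φ → Y ^ size (U ∩ vmap (closeᴱ k φ) E) ≤ Y ^ κ * Y ^ Pairs.expo k (close k n) [] (map (nth 0 φ) xs)
    split φ = ≤-trans (^-monoʳ {Y} (s≤s z≤n) (≤-trans (≤-reflexive (size-∩-vmap (closeᴱ k φ) E U)) (covered-bound k xs es (nth 0 φ) (∑-els≤ E U))))
      (≤-reflexive (^-distribˡ-+-* Y κ _))
    l1 : ∀ a b c d → a * b * c * d ≡ b * (a * (c * d))
    l1 = solve-∀
    l3 : ∀ a b c d e → a * (b * (c * (d * e))) ≡ c * a * (b * d) * e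
    l3 = solve-∀

-- Iterating the fragment step.

wsum-∅ : ∀ {M} (F : Vec Bool M → ℕ) → wsum 0 1 F ≡ F ∅
wsum-∅ {zero}  F = refl
wsum-∅ {suc M} F = trans (+-identityʳ _) (wsum-∅ (λ v → F (false ∷ v)))

square≤2^ : ∀ r → 4 ≤ r → r * r ≤ 2 ^ r
square≤2^ r h with m≤n⇒∃[o]m+o≡n h
... | d , refl = go d
  where
  open ≤-Reasoning
  l1 : ∀ d → (4 + (1 + d)) * (4 + (1 + d)) + (d * d + 6 * d + 7) ≡ 2 * ((4 + d) * (4 + d))
  l1 = solve-∀
  go : ∀ d → (4 + d) * (4 + d) ≤ 2 ^ (4 + d)
  go zero    = ≤-refl
  go (suc d) = begin
      (4 + suc d) * (4 + suc d)                         ≤⟨ m≤m+n _ (d * d + 6 * d + 7) ⟩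
      (4 + suc d) * (4 + suc d) + (d * d + 6 * d + 7)   ≡⟨ l1 d ⟩
      2 * ((4 + d) * (4 + d))                           ≤⟨ *-monoʳ-≤ 2 (go d) ⟩
      2 ^ (4 + suc d)                                   ∎

≤/ : ∀ {m n o} .⦃ _ : NonZero n ⦄ → m * n ≤ o → m ≤ o / n
≤/ {m} {n} {o} h = subst (_≤ o / n) (m*n/n≡m m n) (/-monoˡ-≤ n h)

<suc/* : ∀ m r .⦃ _ : NonZero r ⦄ → m < r * suc (m / r)
<suc/* m r = ≤-trans (s≤s (≤-reflexive (m≡m%n+[m/n]*n m r))) (≤-trans (+-monoˡ-≤ (m / r * r) (m%n<n m r)) (≤-reflexive (*-comm (suc (m / r)) r)))

-- Exposing one random set per round shrinks the fragments by a factor r.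
module Rounds (n k r Λ q : ℕ) (As : List (List ℕ)) (concat-As : concat As ≡ upTo n) (big : All (λ A → r * r ≤ length A) As)
  (1≤n : 1 ≤ n) (1≤k : 1 ≤ k) (4≤r : 4 ≤ r) (32≤Λ : 32 ≤ Λ) (r²≤n : r * r ≤ n) (few : k * spread k < r)
  (hyp₁ : 2 * (k * (spread k * spread k)) * (1 + 16 * (Λ * q)) ≤ r)
  (hyp₂ : 2 * k * (k * (spread k * spread k)) * (1 + 16 * (Λ * q)) ^ k ≤ r * r) where

  private
    1≤r : 1 ≤ r
    1≤r = ≤-trans (s≤s z≤n) 4≤r
    instance
      r≢0 : NonZero r
      r≢0 = >-nonZero 1≤r
      Λ≢0 : NonZero Λ
      Λ≢0 = >-nonZero (≤-trans (s≤s z≤n) 32≤Λ)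
    1≤Λ : 1 ≤ Λ
    1≤Λ = ≤-trans (s≤s z≤n) 32≤Λ

  open Spread n k r (Λ * q) As concat-As big 1≤n 1≤k 1≤r hyp₁ hyp₂ public

  Y M h : ℕ
  Y = 1 + 16 * (Λ * q)
  M = length E
  h = length fs

  -- Exponential Markov bound: |X| > ℓ′ gives Λ^|X| ≥ Λ^(ℓ′+1), and `wsum-scale` moves the tilt into
  -- the weight.
  tail-weight : ∀ U ℓ′ → Λ ^ suc ℓ′ * wsum q 1 (λ X → 𝟙 (X ⊑ᵇ U) * (𝟙 (ℓ′ <ᵇ size X) * cnt X)) ≤ weight U
  tail-weight U ℓ′ = begin
      Λ ^ suc ℓ′ * wsum q 1 (λ X → 𝟙 (X ⊑ᵇ U) * (𝟙 (ℓ′ <ᵇ size X) * cnt X))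
    ≡⟨ sym (wsum-*ˡ q 1 {M} (Λ ^ suc ℓ′) _) ⟩
      wsum q 1 (λ X → Λ ^ suc ℓ′ * (𝟙 (X ⊑ᵇ U) * (𝟙 (ℓ′ <ᵇ size X) * cnt X)))
    ≤⟨ wsum-mono q 1 {M} (λ X → ≤-trans (≤-reflexive (l1 (Λ ^ suc ℓ′) (𝟙 (X ⊑ᵇ U)) (𝟙 (ℓ′ <ᵇ size X)) (cnt X))) (*-monoˡ-≤ (𝟙 (X ⊑ᵇ U) * cnt X) (gain (size X)))) ⟩
      wsum q 1 (λ X → Λ ^ size X * (𝟙 (X ⊑ᵇ U) * cnt X))
    ≡⟨ sym (wsum-scale Λ q {M} _) ⟩
      weight U ∎
    where
    open ≤-Reasoning
    l1 : ∀ a b c d → a * (b * (c * d)) ≡ a * c * (b * d)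
    l1 = solve-∀
    gain : ∀ s → Λ ^ suc ℓ′ * 𝟙 (ℓ′ <ᵇ s) ≤ Λ ^ s
    gain s with ℓ′ <ᵇ s in e
    ... | true  = ≤-trans (≤-reflexive (*-identityʳ _)) (^-monoʳ 1≤Λ (<ᵇ⇒< ℓ′ s (subst T (sym e) tt)))
    ... | false = ≤-trans (≤-reflexive (*-zeroʳ (Λ ^ suc ℓ′))) z≤n

  -- From (1 + 1/r)^r ≤ 4, squared and raised to the power s.
  ratio-pow : ∀ s → suc r ^ (2 * (r * s)) ≤ 16 ^ s * r ^ (2 * (r * s))
  ratio-pow s = begin
      suc r ^ (2 * (r * s))         ≡⟨ e (suc r) ⟩
      ((suc r ^ r) ^ 2) ^ s         ≤⟨ ^-monoˡ s (^-monoˡ 2 (suc^≤4*^ r)) ⟩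
      ((4 * r ^ r) ^ 2) ^ s         ≡⟨ trans (cong (_^ s) (^-distribʳ-* 4 (r ^ r) 2)) (^-distribʳ-* 16 ((r ^ r) ^ 2) s) ⟩
      16 ^ s * ((r ^ r) ^ 2) ^ s    ≡⟨ cong (16 ^ s *_) (sym (e r)) ⟩
      16 ^ s * r ^ (2 * (r * s))    ∎
    where
    open ≤-Reasoning
    e : ∀ x → x ^ (2 * (r * s)) ≡ ((x ^ r) ^ 2) ^ s
    e x = trans (cong (x ^_) (l s)) (sym (trans (cong (_^ s) (^-*-assoc x r 2)) (^-*-assoc x (r * 2) s)))
      where l : ∀ s → 2 * (r * s) ≡ r * 2 * s
            l s = trans (sym (*-assoc 2 r s)) (cong (_* s) (*-comm 2 r))

  -- With ℓ′ = ℓ / r, the vertices contribute 16^(ℓ′+1) and the cut edges 2^ℓ′, while the tail bound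
  -- divides by Λ^(ℓ′+1). As 16 · 2 ≤ Λ, the powers cancel and a factor 16/Λ remains, however small
  -- ℓ′ is.
  copy-weight : ∀ ℓ → (∀ {κ} → n * κ ≤ k * ℓ → Y ^ κ ≤ 2 ^ (ℓ / r)) → ∀ {f U} → f ∈ fs → U ⊑ vmap (closeᴱ k f) E → size U ≤ ℓ →
    Λ * wsum q 1 (λ X → 𝟙 (X ⊑ᵇ U) * (𝟙 (ℓ / r <ᵇ size X) * cnt X)) ≤ 16 * h
  copy-weight ℓ κ-small {f} {U} f∈ U⊑ size≤ = bound (weight-bound U f∈ U⊑)
    where
    open ≤-Reasoning
    ℓ′ V e e₂ d : ℕ
    ℓ′ = ℓ / r
    V = wsum q 1 (λ X → 𝟙 (X ⊑ᵇ U) * (𝟙 (ℓ′ <ᵇ size X) * cnt X))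
    e = 2 * size U
    e₂ = 2 * (r * suc ℓ′)
    d = e₂ ∸ e
    e+d : e + d ≡ e₂
    e+d = m+[n∸m]≡n (*-monoʳ-≤ 2 (≤-trans size≤ (<⇒≤ (<suc/* ℓ r))))
    l2 : ∀ a b c → 16 * a * (b * c) ≡ a * c * (16 * b)
    l2 = solve-∀
    W≤ : ∀ {κ} → r ^ e * weight U ≤ suc r ^ e * (h * Y ^ κ) → weight U ≤ 16 ^ suc ℓ′ * (h * Y ^ κ)
    W≤ {κ} w≤ = *-cancelˡ-≤ (r ^ e₂) ⦃ m^n≢0 r e₂ ⦄ (begin
        r ^ e₂ * weight U                              ≡⟨ trans (cong (λ z → r ^ z * weight U) (sym e+d)) (trans (cong (_* weight U) (^-distribˡ-+-* r e d)) (xy∙z≈y∙xz (r ^ e) (r ^ d) _)) ⟩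
        r ^ d * (r ^ e * weight U)                     ≤⟨ ^-monoˡ d (n≤1+n r) · w≤ ⟩
        suc r ^ d * (suc r ^ e * (h * Y ^ κ))          ≡⟨ trans (sym (xy∙z≈y∙xz (suc r ^ e) (suc r ^ d) _)) (cong (_* (h * Y ^ κ)) (trans (sym (^-distribˡ-+-* (suc r) e d)) (cong (suc r ^_) e+d))) ⟩
        suc r ^ e₂ * (h * Y ^ κ)                       ≤⟨ *-monoˡ-≤ (h * Y ^ κ) (ratio-pow (suc ℓ′)) ⟩
        16 ^ suc ℓ′ * r ^ e₂ * (h * Y ^ κ)             ≡⟨ xy∙z≈y∙xz (16 ^ suc ℓ′) (r ^ e₂) (h * Y ^ κ) ⟩
        r ^ e₂ * (16 ^ suc ℓ′ * (h * Y ^ κ))           ∎)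
    bound : (∃ λ κ → n * κ ≤ k * size U × r ^ e * weight U ≤ suc r ^ e * (h * Y ^ κ)) → Λ * V ≤ 16 * h
    bound (κ , κ≤ , w≤) = *-cancelˡ-≤ (Λ ^ ℓ′) ⦃ m^n≢0 Λ ℓ′ ⦄ (begin
        Λ ^ ℓ′ * (Λ * V)          ≡⟨ x∙yz≈yx∙z (Λ ^ ℓ′) Λ V ⟩
        Λ * Λ ^ ℓ′ * V            ≤⟨ tail-weight U ℓ′ ⟩
        weight U                  ≤⟨ W≤ {κ} w≤ ⟩
        16 * 16 ^ ℓ′ * (h * Y ^ κ) ≤⟨ *-monoʳ-≤ (16 * 16 ^ ℓ′) (*-monoʳ-≤ h (κ-small (≤-trans κ≤ (*-monoʳ-≤ k size≤)))) ⟩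
        16 * 16 ^ ℓ′ * (h * 2 ^ ℓ′) ≡⟨ l2 (16 ^ ℓ′) h (2 ^ ℓ′) ⟩
        16 ^ ℓ′ * 2 ^ ℓ′ * (16 * h) ≡⟨ cong (_* (16 * h)) (sym (^-distribʳ-* 16 2 ℓ′)) ⟩
        32 ^ ℓ′ * (16 * h)        ≤⟨ *-monoˡ-≤ (16 * h) (^-monoˡ ℓ′ 32≤Λ) ⟩
        Λ ^ ℓ′ * (16 * h)         ∎)

  step-weight : ∀ ℓ → (∀ {κ} → n * κ ≤ k * ℓ → Y ^ κ ≤ 2 ^ (ℓ / r)) → ∀ G {S} → S ∈ H → size (S ∖ G) ≤ ℓ →
    Λ * wsum q 1 (λ X → 𝟙 (X ⊑ᵇ S ∖ G) * (𝟙 (ℓ / r <ᵇ size X) * cnt X)) ≤ 16 * h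
  step-weight ℓ κ-small G {S} S∈ size≤ = go (∈-map⁻ _ S∈)
    where
    go : (∃ λ f → f ∈ fs × S ≡ vmap (closeᴱ k f) E) → Λ * wsum q 1 (λ X → 𝟙 (X ⊑ᵇ S ∖ G) * (𝟙 (ℓ / r <ᵇ size X) * cnt X)) ≤ 16 * h
    go (f , f∈ , refl) = copy-weight ℓ κ-small f∈ (∖-⊑ S G) size≤

  level : ℕ → ℕ
  level zero    = n * spread k
  level (suc i) = level i / r

  level-* : ∀ i → level i * r ^ i ≤ n * spread k
  level-* zero    = ≤-reflexive (*-identityʳ _)
  level-* (suc i) = ≤-trans (≤-reflexive (sym (*-assoc (level i / r) r (r ^ i)))) (≤-trans (*-monoˡ-≤ (r ^ i) (m/n*n≤m (level i) r)) (level-* i))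

  level-mono : ∀ i → level (suc i) ≤ level 1
  level-mono zero    = ≤-refl
  level-mono (suc i) = ≤-trans (m/n≤m (level (suc i)) r) (level-mono i)

  -- At first the fragments may be whole copies, and κ can be as large as the constant k * spread k;
  -- then Y^k ≤ r² ≤ 2^r and r² ≤ n keep the loss within 2^(ℓ/r). After one round the fragments have
  -- so few edges that n κ < n, and nothing is lost by cutting.
  κ-small : ∀ i {κ} → n * κ ≤ k * level i → Y ^ κ ≤ 2 ^ (level i / r)
  κ-small zero {κ} κ≤ = begin
      Y ^ κ                ≤⟨ ^-monoʳ {Y} (s≤s z≤n) (*-cancelˡ-≤ n ⦃ >-nonZero 1≤n ⦄ (≤-trans κ≤ (≤-reflexive (l k n (spread k))))) ⟩
      Y ^ (k * spread k)   ≡⟨ sym (^-*-assoc Y k (spread k)) ⟩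
      (Y ^ k) ^ spread k   ≤⟨ ^-monoˡ (spread k) Y^k≤r² ⟩
      (r * r) ^ spread k   ≤⟨ ^-monoˡ (spread k) (square≤2^ r 4≤r) ⟩
      (2 ^ r) ^ spread k   ≡⟨ ^-*-assoc 2 r (spread k) ⟩
      2 ^ (r * spread k)   ≤⟨ ^-monoʳ {2} {r * spread k} (s≤s z≤n) (≤/ (≤-trans (≤-reflexive (l′ r (spread k))) (*-monoˡ-≤ (spread k) r²≤n))) ⟩
      2 ^ (level 0 / r)    ∎
    where
    open ≤-Reasoning
    l : ∀ k n D → k * (n * D) ≡ n * (k * D)
    l = solve-∀
    l′ : ∀ r D → r * D * r ≡ r * r * D
    l′ = solve-∀
    Y^k≤r² : Y ^ k ≤ r * r
    Y^k≤r² = ≤-trans (≤-trans (≤-reflexive (sym (*-identityˡ _))) (*-monoˡ-≤ (Y ^ k) (*-mono-≤ {1} {2 * k} {1} (≤-trans 1≤k (m≤m+n k _)) (1≤k · (1≤D · 1≤D))))) hyp₂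
      where 1≤D : 1 ≤ spread k
            1≤D = ≤-trans (s≤s z≤n) (m≤n+m 3 (4 * k))
  κ-small (suc i) {κ} κ≤ = subst (λ z → Y ^ z ≤ 2 ^ (level (suc i) / r)) (sym κ≡0) (^-pos (level (suc i) / r) (s≤s z≤n))
    where
    open ≤-Reasoning
    n*κ<n : n * κ < n * 1
    n*κ<n = *-cancelʳ-< r (n * κ) (n * 1) (begin-strict
        n * κ * r                ≤⟨ *-monoˡ-≤ r κ≤ ⟩
        k * level (suc i) * r    ≤⟨ *-monoˡ-≤ r (*-monoʳ-≤ k (level-mono i)) ⟩
        k * level 1 * r          ≡⟨ *-assoc k (level 1) r ⟩
        k * (level 1 * r)        ≤⟨ *-monoʳ-≤ k (m/n*n≤m (level 0) r) ⟩
        k * (n * spread k)       ≡⟨ l k n (spread k) ⟩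
        n * (k * spread k)       <⟨ *-monoʳ-< n ⦃ >-nonZero 1≤n ⦄ few ⟩
        n * r                    ≡⟨ cong (_* r) (sym (*-identityʳ n)) ⟩
        n * 1 * r                ∎)
      where l : ∀ k n D → k * (n * D) ≡ n * (k * D)
            l = solve-∀
    κ≡0 : κ ≡ 0
    κ≡0 = n<1⇒n≡0 (*-cancelˡ-< n κ 1 n*κ<n)

  -- The weights of membership and non-membership in the union of i exposed sets, as produced by
  -- `wsum-∪`.
  inW outW : ℕ → ℕ
  inW zero     = 0
  inW (suc i)  = inW i + outW i + q * inW i
  outW zero    = 1
  outW (suc i) = q * outW i

  in+out : ∀ i → inW i + outW i ≡ (1 + q) ^ i
  in+out zero    = refl
  in+out (suc i) = trans (l (inW i) (outW i) q) (cong ((1 + q) *_) (in+out i))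
    where l : ∀ a b q → a + b + q * a + q * b ≡ (1 + q) * (a + b)
          l = solve-∀

  -- The union bound: i sets of density 1/(1 + q) have a union of density at most i/(1 + q).
  inW-bound : ∀ i → inW i * (1 + q) ≤ i * (1 + q) ^ i
  inW-bound zero    = z≤n
  inW-bound (suc i) = begin
      (inW i + outW i + q * inW i) * (1 + q)       ≡⟨ cong (λ z → (z + q * inW i) * (1 + q)) (in+out i) ⟩
      (Q + q * inW i) * (1 + q)                    ≡⟨ l1 Q q (inW i) ⟩
      (1 + q) * Q + q * (inW i * (1 + q))          ≤⟨ +-monoʳ-≤ ((1 + q) * Q) (*-mono-≤ (n≤1+n q) (inW-bound i)) ⟩
      (1 + q) * Q + (1 + q) * (i * Q)              ≡⟨ l2 (1 + q) Q i ⟩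
      suc i * ((1 + q) * Q)                        ∎
    where
    open ≤-Reasoning
    Q : ℕ
    Q = (1 + q) ^ i
    l1 : ∀ Q q a → (Q + q * a) * (1 + q) ≡ (1 + q) * Q + q * (a * (1 + q))
    l1 = solve-∀
    l2 : ∀ a Q i → a * Q + a * (i * Q) ≡ (1 + i) * (a * Q)
    l2 = solve-∀

  mass : ℕ → ℕ
  mass i = ((1 + q) ^ i) ^ M

  size-copy : ∀ {f} → f ∈ fs → size (vmap (closeᴱ k f) E) ≤ n * spread k
  size-copy {f} f∈ = begin
      size (vmap (closeᴱ k f) E)
    ≡⟨ size-vmap (closeᴱ k f) E ⟩
      ∑ E (λ e → 𝟙 (closeᴱ k f e))
    ≤⟨ ∑-edges≤ n (λ i j → 𝟙 (close k n (nth 0 f i) (nth 0 f j))) ⟩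
      ∑ (upTo n) (λ i → ∑ (upTo n) (λ j → 𝟙 (close k n (nth 0 f i) (nth 0 f j))))
    ≡⟨ trans (∑-cong (upTo n) λ i → reindex (λ q → 𝟙 (close k n (nth 0 f i) q))) (reindex (λ p → ∑ (upTo n) (λ q → 𝟙 (close k n p q)))) ⟩
      ∑ (upTo n) (λ p → ∑ (upTo n) (λ q → 𝟙 (close k n p q)))
    ≤⟨ ∑-mono∈ (upTo n) (λ m → close-row k n (∈-upTo⁻ m)) ⟩
      ∑ (upTo n) (λ _ → spread k)
    ≡⟨ trans (∑-const (upTo n) (spread k)) (cong (_* spread k) (length-upTo n)) ⟩
      n * spread k ∎
    where
    open ≤-Reasoning
    reindex : ∀ g → ∑ (upTo n) (g ∘ nth 0 f) ≡ ∑ (upTo n) g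
    reindex g = trans (sym (∑-map (nth 0 f) (upTo n) g)) (trans (cong (λ z → ∑ z g) (subst (λ z → map (nth 0 f) (upTo z) ≡ f) (fs-length f∈) (map-nth-upTo 0 f))) (∑-↭ g (fs-↭ f∈)))

  -- With nothing exposed, every copy is a fragment of itself.
  bad-start : bad (level 0) ∅ ≡ 0
  bad-start = trans (∑-cong∈ H λ {S} m → not-bad (S∈good m)) (∑-zero H)
    where
    not-bad : ∀ {b} → T b → 𝟙 (not b) ≡ 0
    not-bad {true} _ = refl
    S∈good : ∀ {S} → S ∈ H → T (good (level 0) ∅ S)
    S∈good {S} m with ∈-map⁻ _ m
    ... | f , f∈ , refl = good⁺ m (∖-⊑ S ∅) (≤-trans (size-mono (S ∖ ∅) S (∖-⊑ S ∅)) (size-copy f∈))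

  -- Given the set exposed before it, each round adds at most 16 h / Λ bad copies on average.
  rounds : ∀ i → Λ * wsum (inW i) (outW i) (bad (level i)) ≤ i * (16 * h * mass i)
  rounds zero    = ≤-reflexive (trans (cong (Λ *_) (trans (wsum-∅ (bad (level 0))) bad-start)) (*-zeroʳ Λ))
  rounds (suc i) = begin
      Λ * wsum (inW (suc i)) (outW (suc i)) (bad (level (suc i)))
    ≡⟨ cong (Λ *_) (sym (wsum-∪ q (inW i) (outW i) {M} (bad (level (suc i))))) ⟩
      Λ * wsum (inW i) (outW i) (λ G → wsum 1 q (λ W → bad (level (suc i)) (G ∪ W)))
    ≤⟨ *-monoʳ-≤ Λ (wsum-mono (inW i) (outW i) {M} λ G → fragment q (level i) (level (suc i)) G β (λ m s → ≤/ (≤-trans (≤-reflexive (*-comm _ Λ)) (step-weight (level i) (κ-small i) G m s)))) ⟩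
      Λ * wsum (inW i) (outW i) (λ G → (1 + q) ^ M * (bad (level i) G + β))
    ≡⟨ cong (Λ *_) (trans (wsum-*ˡ (inW i) (outW i) {M} ((1 + q) ^ M) _) (cong ((1 + q) ^ M *_) (trans (wsum-+ (inW i) (outW i) {M} _ _)
         (cong (wsum (inW i) (outW i) (bad (level i)) +_) (trans (wsum-const (inW i) (outW i) M β) (cong (λ z → z ^ M * β) (in+out i))))))) ⟩
      Λ * ((1 + q) ^ M * (wsum (inW i) (outW i) (bad (level i)) + mass i * β))
    ≡⟨ l1 Λ ((1 + q) ^ M) _ (mass i) β ⟩
      (1 + q) ^ M * (Λ * wsum (inW i) (outW i) (bad (level i)) + mass i * (β * Λ))
    ≤⟨ *-monoʳ-≤ ((1 + q) ^ M) (+-mono-≤ (rounds i) (*-monoʳ-≤ (mass i) (m/n*n≤m (16 * h) Λ))) ⟩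
      (1 + q) ^ M * (i * (16 * h * mass i) + mass i * (16 * h))
    ≡⟨ l2 ((1 + q) ^ M) i (16 * h) (mass i) ⟩
      suc i * (16 * h * ((1 + q) ^ M * mass i))
    ≡⟨ cong (λ z → suc i * (16 * h * z)) (sym (^-distribʳ-* (1 + q) ((1 + q) ^ i) M)) ⟩
      suc i * (16 * h * mass (suc i)) ∎
    where
    open ≤-Reasoning
    β : ℕ
    -- Rounding down is harmless, because the quantity bounded by β is a natural number.
    β = 16 * h / Λ
    l1 : ∀ L p w x b → L * (p * (w + x * b)) ≡ p * (L * w + x * (b * L))
    l1 = solve-∀
    l2 : ∀ p i h x → p * (i * (h * x) + x * h) ≡ (1 + i) * (h * (p * x))
    l2 = solve-∀

  contains : Vec Bool M → Bool
  contains G = any (λ S → S ⊑ᵇ G) H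

  1≤h : 1 ≤ h
  1≤h = length-blockPerms-pos As

  ∖-empty⇒⊑ : ∀ {m} (s g : Vec Bool m) → size (s ∖ g) ≤ 0 → s ⊑ g
  ∖-empty⇒⊑ [] [] _ = tt
  ∖-empty⇒⊑ (true  ∷ s) (true  ∷ g) p = ∖-empty⇒⊑ s g p
  ∖-empty⇒⊑ (false ∷ s) (b     ∷ g) p = ∖-empty⇒⊑ s g p

  -- A good copy at level 0 would exhibit a copy inside G, so when there is none all h copies are
  -- bad. Hence a small average of `bad 0` makes a missing copy unlikely.
  missing≤bad : ∀ G → h * 𝟙 (not (contains G)) ≤ bad 0 G
  missing≤bad G = ≤-trans (≤-reflexive (trans (cong (_* 𝟙 (not (contains G))) (sym (length-map _ fs))) (sym (∑-const H _))))
    (∑-mono H λ S → 𝟙-mono {not (contains G)} λ t → T-not⁺ λ g → let S′ , m , _ , s = good⁻ {0} {G} {S} g in T-not⁻ t (T-any⁺ _ m (∖-empty⇒⊑ S′ G s)))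

  covering : ∀ a → n * spread k < r ^ a → Λ * wsum (inW a) (outW a) (λ G → 𝟙 (not (contains G))) ≤ 16 * a * mass a
  covering a small = *-cancelˡ-≤ h ⦃ >-nonZero 1≤h ⦄ (begin
      h * (Λ * wsum (inW a) (outW a) (λ G → 𝟙 (not (contains G))))
    ≡⟨ trans (x∙yz≈y∙xz h Λ _) (cong (Λ *_) (sym (wsum-*ˡ (inW a) (outW a) {M} h _))) ⟩
      Λ * wsum (inW a) (outW a) (λ G → h * 𝟙 (not (contains G)))
    ≤⟨ *-monoʳ-≤ Λ (wsum-mono (inW a) (outW a) {M} missing≤bad) ⟩
      Λ * wsum (inW a) (outW a) (bad 0)
    ≡⟨ cong (λ z → Λ * wsum (inW a) (outW a) (bad z)) (sym level-a) ⟩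
      Λ * wsum (inW a) (outW a) (bad (level a))
    ≤⟨ rounds a ⟩
      a * (16 * h * mass a)
    ≡⟨ l2 a h (mass a) ⟩
      h * (16 * a * mass a) ∎)
    where
    open ≤-Reasoning
    l2 : ∀ a b c → a * (16 * b * c) ≡ b * (16 * a * c)
    l2 = solve-∀
    level-a : level a ≡ 0
    level-a = n<1⇒n≡0 (*-cancelʳ-< (r ^ a) (level a) 1 (≤-<-trans (level-* a) (subst (n * spread k <_) (sym (*-identityˡ _)) small)))

-- Random orderings

prefix : ∀ M → ℕ → Vec Bool M
prefix zero    t       = []
prefix (suc M) zero    = false ∷ prefix M zero
prefix (suc M) (suc t) = true ∷ prefix M t

size-prefix : ∀ M {t} → t ≤ M → size (prefix M t) ≡ t
size-prefix zero    z≤n     = refl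
size-prefix (suc M) z≤n     = size-prefix M z≤n
size-prefix (suc M) (s≤s h) = cong suc (size-prefix M h)

module _ {A : Set} where
  sub : ∀ {M} → Vec Bool M → List A → List A
  sub []          xs       = []
  sub (b ∷ v)     []       = []
  sub (true  ∷ v) (x ∷ xs) = x ∷ sub v xs
  sub (false ∷ v) (x ∷ xs) = sub v xs

  sub-els : ∀ xs v → sub v xs ≡ els xs v
  sub-els []       []          = refl
  sub-els (x ∷ xs) (true  ∷ v) = cong (x ∷_) (sub-els xs v)
  sub-els (x ∷ xs) (false ∷ v) = sub-els xs v

  insertAll-↭ : ∀ {x : A} {ys σ} → σ ∈ insertAll x ys → σ ↭ x ∷ ys
  insertAll-↭ {ys = []}     (here refl) = ↭-refl
  insertAll-↭ {ys = y ∷ ys} (here refl) = ↭-refl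
  insertAll-↭ {ys = y ∷ ys} (there m) with ∈-map⁻ (y ∷_) m
  ... | τ , m′ , refl = ↭-trans (↭-prep y (insertAll-↭ m′)) (↭-swap y _ ↭-refl)

∈-perms⇒↭ : ∀ {A : Set} (xs : List A) {σ} → σ ∈ perms xs → σ ↭ xs
∈-perms⇒↭ []       (here refl) = ↭-refl
∈-perms⇒↭ (x ∷ xs) m with ∈-concatMap-elim (insertAll x) (perms xs) m
... | τ , mτ , mσ = ↭-trans (insertAll-↭ mσ) (↭-prep x (∈-perms⇒↭ xs mτ))

∈-insertAll : ∀ {A : Set} (x : A) ys zs → ys ++ x ∷ zs ∈ insertAll x (ys ++ zs)
∈-insertAll x []       []       = here refl
∈-insertAll x []       (z ∷ zs) = here refl
∈-insertAll x (y ∷ ys) zs       = there (∈-map⁺ (y ∷_) (∈-insertAll x ys zs))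

↭⇒∈-perms : ∀ {A : Set} {xs : List A} {σ} → σ ↭ xs → σ ∈ perms xs
↭⇒∈-perms {xs = xs} = go xs
  where
  go : ∀ xs {σ} → σ ↭ xs → σ ∈ perms xs
  go []       π rewrite ↭-empty-inv π = here refl
  go (x ∷ xs) {σ} π = insert (∈-∃++ (∈-resp-↭ (↭-sym π) (here refl))) π
    where
    insert : (∃₂ λ ys zs → σ ≡ ys ++ [ x ] ++ zs) → σ ↭ x ∷ xs → σ ∈ perms (x ∷ xs)
    insert (ys , zs , refl) π = ∈-concatMap-intro (insertAll x) (go xs (drop-mid ys [] π)) (∈-insertAll x ys zs)

module _ {A : Set} where
  Invariant : (List A → ℕ) → Set
  Invariant F = ∀ {xs ys} → xs ↭ ys → F xs ≡ F ys

  addIf : Bool → A → List A → List A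
  addIf b x xs = if b then x ∷ xs else xs

  addIf-↭ : ∀ b x {xs ys} → xs ↭ ys → addIf b x xs ↭ addIf b x ys
  addIf-↭ true  x π = ↭-prep x π
  addIf-↭ false x π = π

  addIf-comm : ∀ b c x y xs → addIf b x (addIf c y xs) ↭ addIf c y (addIf b x xs)
  addIf-comm true  true  x y xs = ↭-swap x y ↭-refl
  addIf-comm true  false x y xs = ↭-refl
  addIf-comm false c     x y xs = ↭-refl

  sub-∷ : ∀ {M} b (v : Vec Bool M) x xs → sub (b ∷ v) (x ∷ xs) ≡ addIf b x (sub v xs)
  sub-∷ true  v x xs = refl
  sub-∷ false v x xs = refl

  -- Inserting x into a list and reading the entries at D amounts to deleting one coordinate of D,
  -- whose bit says whether x is read.
  deletions : ∀ {M} → Vec Bool (suc M) → List (Bool × Vec Bool M)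
  deletions {zero}  (b ∷ []) = (b , []) ∷ []
  deletions {suc M} (b ∷ v)  = (b , v) ∷ map (λ p → proj₁ p , b ∷ proj₂ p) (deletions v)

  ∑-insertAll : ∀ F → Invariant F → ∀ x ys {M} (D : Vec Bool (suc M)) → length ys ≡ M →
    ∑ (insertAll x ys) (λ σ → F (sub D σ)) ≡ ∑ (deletions D) (λ p → F (addIf (proj₁ p) x (sub (proj₂ p) ys)))
  ∑-insertAll F inv x []       (b ∷ []) refl = cong (λ z → F z + 0) (sub-∷ b [] x [])
  ∑-insertAll F inv x (y ∷ ys) (b ∷ v) refl = cong₂ _+_ (cong F (sub-∷ b v x (y ∷ ys)))
    (begin
      ∑ (map (y ∷_) (insertAll x ys)) (λ σ → F (sub (b ∷ v) σ))
    ≡⟨ trans (∑-map _ (insertAll x ys) _) (∑-cong (insertAll x ys) λ σ → cong F (sub-∷ b v y σ)) ⟩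
      ∑ (insertAll x ys) (λ σ → F (addIf b y (sub v σ)))
    ≡⟨ ∑-insertAll (F ∘ addIf b y) (inv ∘ addIf-↭ b y) x ys v refl ⟩
      ∑ (deletions v) (λ p → F (addIf b y (addIf (proj₁ p) x (sub (proj₂ p) ys))))
    ≡⟨ ∑-cong (deletions v) (λ p → trans (inv (addIf-comm b (proj₁ p) y x _)) (cong (λ z → F (addIf (proj₁ p) x z)) (sym (sub-∷ b (proj₂ p) y ys)))) ⟩
      ∑ (deletions v) (λ p → F (addIf (proj₁ p) x (sub (b ∷ proj₂ p) (y ∷ ys))))
    ≡⟨ sym (∑-map _ (deletions v) _) ⟩
      ∑ (map (λ p → proj₁ p , b ∷ proj₂ p) (deletions v)) (λ p → F (addIf (proj₁ p) x (sub (proj₂ p) (y ∷ ys)))) ∎)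
    where open ≡-Reasoning

  ∑-deletions : ∀ {M} (D : Vec Bool (suc M)) (f : Bool → ℕ → ℕ) →
    ∑ (deletions D) (λ p → f (proj₁ p) (size (proj₂ p))) ≡ size D * f true (pred (size D)) + (suc M ∸ size D) * f false (size D)
  ∑-deletions {zero} (true  ∷ []) f = sym (+-identityʳ _)
  ∑-deletions {zero} (false ∷ []) f = refl
  ∑-deletions {suc M} (b ∷ v) f = trans (cong (f b (size v) +_) (trans (∑-map _ (deletions v) _) (∑-deletions v (λ c s → f c (𝟙 b + s))))) (go b (size v) (size≤ v))
    where
    l1 : ∀ a b c → a + (b + c) ≡ a + b + c
    l1 = solve-∀
    l2 : ∀ a b c → a + (b + c) ≡ b + (a + c)
    l2 = solve-∀
    go : ∀ b s → s ≤ suc M → f b s + (s * f true (𝟙 b + pred s) + (suc M ∸ s) * f false (𝟙 b + s)) ≡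
         (𝟙 b + s) * f true (pred (𝟙 b + s)) + (suc (suc M) ∸ (𝟙 b + s)) * f false (𝟙 b + s)
    go true  zero    h = cong (_+ suc M * f false 1) (sym (+-identityʳ (f true 0)))
    go true  (suc s) h = l1 (f true (suc s)) (suc s * f true (suc s)) _
    go false s       h = trans (l2 (f false s) (s * f true (pred s)) _) (cong (λ z → s * f true (pred s) + z * f false s) (sym (+-∸-assoc 1 h)))

  -- For d ≤ length xs this is d! (length xs - d)! times the sum of F over the d-element sublists; d
  -- and `suc (length xs) ∸ d` count the selected and the other positions available to x.
  subsetSum : List A → ℕ → (List A → ℕ) → ℕ
  subsetSum []       d F = F []
  subsetSum (x ∷ xs) d F = d * subsetSum xs (pred d) (F ∘ (x ∷_)) + (suc (length xs) ∸ d) * subsetSum xs d F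

  -- In a uniformly random order all sets of positions of the same size look alike to an F that
  -- ignores order, so D enters only through its size and can be exchanged for an initial segment.
  ∑-perms-sub : ∀ xs F → Invariant F → ∀ (D : Vec Bool (length xs)) → ∑ (perms xs) (λ σ → F (sub D σ)) ≡ subsetSum xs (size D) F
  ∑-perms-sub []       F inv [] = +-identityʳ _
  ∑-perms-sub (x ∷ xs) F inv D = begin
      ∑ (perms (x ∷ xs)) (λ σ → F (sub D σ))
    ≡⟨ ∑-concatMap (insertAll x) (perms xs) _ ⟩
      ∑ (perms xs) (λ ys → ∑ (insertAll x ys) (λ σ → F (sub D σ)))
    ≡⟨ ∑-cong∈ (perms xs) (λ {ys} m → ∑-insertAll F inv x ys D (↭-length (∈-perms⇒↭ xs m))) ⟩
      ∑ (perms xs) (λ ys → ∑ (deletions D) (λ p → F (addIf (proj₁ p) x (sub (proj₂ p) ys))))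
    ≡⟨ ∑-swap (perms xs) (deletions D) _ ⟩
      ∑ (deletions D) (λ p → ∑ (perms xs) (λ ys → F (addIf (proj₁ p) x (sub (proj₂ p) ys))))
    ≡⟨ ∑-cong (deletions D) (λ p → ∑-perms-sub xs (F ∘ addIf (proj₁ p) x) (inv ∘ addIf-↭ (proj₁ p) x) (proj₂ p)) ⟩
      ∑ (deletions D) (λ p → subsetSum xs (size (proj₂ p)) (F ∘ addIf (proj₁ p) x))
    ≡⟨ ∑-deletions D (λ b s → subsetSum xs s (F ∘ addIf b x)) ⟩
      subsetSum (x ∷ xs) (size D) F ∎
    where open ≡-Reasoning

  sub-prefix : ∀ {M} t (σ : List A) → length σ ≡ M → sub (prefix M t) σ ≡ take t σ
  sub-prefix zero    []      refl = refl
  sub-prefix (suc t) []      refl = refl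
  sub-prefix zero    (x ∷ σ) refl = sub-prefix zero σ refl
  sub-prefix (suc t) (x ∷ σ) refl = cong (x ∷_) (sub-prefix t σ refl)

  ∑-perms-take : ∀ xs F → Invariant F → ∀ {t} → t ≤ length xs → ∑ (perms xs) (F ∘ take t) ≡ subsetSum xs t F
  ∑-perms-take xs F inv {t} h = trans (∑-cong∈ (perms xs) λ {σ} m → cong F (sym (sub-prefix t σ (↭-length (∈-perms⇒↭ xs m)))))
    (trans (∑-perms-sub xs F inv (prefix (length xs) t)) (cong (λ z → subsetSum xs z F) (size-prefix (length xs) h)))

  wsum-sub-↭ : ∀ α β F → Invariant F → ∀ {xs ys : List A} → xs ↭ ys →
    wsum α β {length xs} (λ D → F (sub D xs)) ≡ wsum α β {length ys} (λ D → F (sub D ys))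
  wsum-sub-↭ α β F inv ↭ε = refl
  wsum-sub-↭ α β F inv (prep x π) = cong₂ (λ a b → α * a + β * b) (wsum-sub-↭ α β (F ∘ (x ∷_)) (inv ∘ ↭-prep x) π) (wsum-sub-↭ α β F inv π)
  wsum-sub-↭ α β F inv {_ ∷ _ ∷ xs} {_ ∷ _ ∷ ys} (swap x y π) = trans
    (cong₂ (λ a b → α * a + β * b)
      (cong₂ (λ a b → α * a + β * b) (trans (wsum-cong α β {length xs} λ D → inv (↭-swap x y ↭-refl)) (wsum-sub-↭ α β (λ l → F (y ∷ x ∷ l)) (λ σ → inv (↭-prep y (↭-prep x σ))) π))
                                     (wsum-sub-↭ α β (F ∘ (x ∷_)) (inv ∘ ↭-prep x) π))
      (cong₂ (λ a b → α * a + β * b) (wsum-sub-↭ α β (F ∘ (y ∷_)) (inv ∘ ↭-prep y) π) (wsum-sub-↭ α β F inv π)))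
    (l α β _ _ _ _)
    where
    l : ∀ α β a b c d → α * (α * a + β * b) + β * (α * c + β * d) ≡ α * (α * a + β * c) + β * (α * b + β * d)
    l = solve-∀
  wsum-sub-↭ α β F inv (π ↭↭ ρ) = trans (wsum-sub-↭ α β F inv π) (wsum-sub-↭ α β F inv ρ)

wsum-size : ∀ α β M → wsum α β {M} size * (α + β) ≡ M * α * (α + β) ^ M
wsum-size α β zero    = refl
wsum-size α β (suc M) = begin
    (α * wsum α β {M} (λ v → 1 + size v) + β * wsum α β {M} size) * (α + β)
  ≡⟨ cong (λ z → (α * z + β * wsum α β {M} size) * (α + β)) (trans (wsum-+ α β {M} (λ _ → 1) size) (cong (_+ wsum α β {M} size) (trans (wsum-const α β M 1) (*-identityʳ _)))) ⟩
    (α * (X + wsum α β {M} size) + β * wsum α β {M} size) * (α + β)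
  ≡⟨ l1 α β X (wsum α β {M} size) ⟩
    (α + β) * (α * X + wsum α β {M} size * (α + β))
  ≡⟨ cong (λ z → (α + β) * (α * X + z)) (wsum-size α β M) ⟩
    (α + β) * (α * X + M * α * X)
  ≡⟨ l2 α (α + β) X M ⟩
    suc M * α * ((α + β) * X) ∎
  where
  open ≡-Reasoning
  X : ℕ
  X = (α + β) ^ M
  l1 : ∀ α β X s → (α * (X + s) + β * s) * (α + β) ≡ (α + β) * (α * X + s * (α + β))
  l1 = solve-∀
  l2 : ∀ α q X M → q * (α * X + M * α * X) ≡ (1 + M) * α * (q * X)
  l2 = solve-∀

markov : ∀ α β M t → suc t * wsum α β {M} (λ D → 𝟙 (t <ᵇ size D)) ≤ wsum α β {M} size
markov α β M t = ≤-trans (≤-reflexive (sym (wsum-*ˡ α β {M} (suc t) _))) (wsum-mono α β {M} λ D → each (size D))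
  where
  each : ∀ s → suc t * 𝟙 (t <ᵇ s) ≤ s
  each s with t <ᵇ s in e
  ... | true  = ≤-trans (≤-reflexive (*-identityʳ (suc t))) (<ᵇ⇒< t s (subst T (sym e) tt))
  ... | false = ≤-trans (≤-reflexive (*-zeroʳ (suc t))) z≤n

Monotone : ∀ {A : Set} → (List A → Bool) → Set
Monotone p = ∀ {xs ys} → (∀ {e} → e ∈ xs → e ∈ ys) → T (p xs) → T (p ys)

∈-take-≤ : ∀ {A : Set} {d t} (σ : List A) {e} → d ≤ t → e ∈ take d σ → e ∈ take t σ
∈-take-≤ σ h m = ∈-take-mono σ h m

-- The binomial random set is realised as the entries of a random order at random positions D. If
-- |D| ≤ t, these can be replaced by the first |D| entries, which lie among the first t, and
-- monotonicity applies; the case |D| > t is the error term.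
transfer : ∀ {A : Set} (E : List A) (p : List A → Bool) → Monotone p → ∀ α β {t} → t ≤ length E →
  length (perms E) * wsum α β {length E} (λ D → 𝟙 (p (sub D E))) ≤
  (α + β) ^ length E * ∑ (perms E) (λ σ → 𝟙 (p (take t σ))) + length (perms E) * wsum α β {length E} (λ D → 𝟙 (t <ᵇ size D))
transfer E p mono α β {t} t≤ = begin
    N * wsum α β {M} (λ D → F (sub D E))
  ≡⟨ sym (trans (∑-cong∈ (perms E) λ {σ} m → wsum-σ (∈-perms⇒↭ E m)) (∑-const (perms E) (wsum α β {M} (λ D → F (sub D E))))) ⟩
    ∑ (perms E) (λ σ → wsum α β {M} (λ D → F (sub D σ)))
  ≡⟨ sym (wsum-∑ α β {M} (perms E) _) ⟩
    wsum α β {M} (λ D → ∑ (perms E) (λ σ → F (sub D σ)))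
  ≤⟨ wsum-mono α β {M} each ⟩
    wsum α β {M} (λ D → ∑ (perms E) (F ∘ take t) + N * 𝟙 (t <ᵇ size D))
  ≡⟨ trans (wsum-+ α β {M} _ _) (cong₂ _+_ (wsum-const α β M _) (wsum-*ˡ α β {M} N _)) ⟩
    (α + β) ^ M * ∑ (perms E) (F ∘ take t) + N * wsum α β {M} (λ D → 𝟙 (t <ᵇ size D)) ∎
  where
  open ≤-Reasoning
  M N : ℕ
  M = length E
  N = length (perms E)
  F : List _ → ℕ
  F l = 𝟙 (p l)
  inv : Invariant F
  inv π = ≤-antisym (𝟙-mono (mono (∈-resp-↭ π))) (𝟙-mono (mono (∈-resp-↭ (↭-sym π))))
  wsum-σ : ∀ {σ} → σ ↭ E → wsum α β {M} (λ D → F (sub D σ)) ≡ wsum α β {M} (λ D → F (sub D E))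
  wsum-σ {σ} π = subst (λ z → wsum α β {z} (λ D → F (sub D σ)) ≡ wsum α β {M} (λ D → F (sub D E))) (↭-length π) (wsum-sub-↭ α β F inv π)
  each : ∀ D → ∑ (perms E) (λ σ → F (sub D σ)) ≤ ∑ (perms E) (F ∘ take t) + N * 𝟙 (t <ᵇ size D)
  each D with t <? size D
  ... | no ¬h = ≤-trans (≤-trans (≤-reflexive (trans (∑-perms-sub E F inv D) (sym (∑-perms-take E F inv (size≤ D)))))
                  (∑-mono (perms E) λ σ → 𝟙-mono (mono (∈-take-≤ σ (≮⇒≥ ¬h))))) (m≤m+n _ _)
  ... | yes h = ≤-trans (≤-trans (∑-mono (perms E) λ σ → 𝟙≤1 (p (sub D σ))) (≤-reflexive (trans (∑-const (perms E) 1) (cong (N *_) (sym (𝟙-T (<⇒<ᵇ h))))))) (m≤n+m _ (∑ (perms E) (F ∘ take t)))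

unit : ∀ M → ℕ → Vec Bool M
unit zero    i       = []
unit (suc M) zero    = true ∷ prefix M 0
unit (suc M) (suc i) = false ∷ unit M i

size-unit : ∀ M {i} → i < M → size (unit M i) ≡ 1
size-unit (suc M) {zero}  _       = cong suc (size-prefix M z≤n)
size-unit (suc M) {suc i} (s≤s h) = size-unit M h

∑-take-suc : ∀ {A : Set} (g : A → ℕ) σ i → ∑ (take (suc i) σ) g ≡ ∑ (take i σ) g + ∑ (sub (unit (length σ) i) σ) g
∑-take-suc g []      zero    = refl
∑-take-suc g []      (suc i) = refl
∑-take-suc g (x ∷ σ) zero    = cong (λ z → g x + ∑ z g) (sym (sub-prefix′ σ))
  where
  sub-prefix′ : ∀ σ → sub (prefix (length σ) 0) σ ≡ []
  sub-prefix′ []      = refl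
  sub-prefix′ (x ∷ σ) = sub-prefix′ σ
∑-take-suc g (x ∷ σ) (suc i) = trans (cong (g x +_) (∑-take-suc g σ i)) (sym (+-assoc (g x) _ _))

-- By symmetry every position contributes the same amount `a`, and all positions together contribute
-- ∑ E g for each order.
average : ∀ {A : Set} (E : List A) (g : A → ℕ) {t} → t ≤ length E →
  length E * ∑ (perms E) (λ σ → ∑ (take t σ) g) ≡ t * (length (perms E) * ∑ E g)
average E g {t} t≤ = begin
    M * B t            ≡⟨ cong (M *_) (linear t t≤) ⟩
    M * (t * a)        ≡⟨ x∙yz≈y∙xz M t a ⟩
    t * (M * a)        ≡⟨ cong (t *_) (trans (sym (linear M ≤-refl)) whole) ⟩
    t * (length (perms E) * ∑ E g) ∎
  where
  open ≡-Reasoning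
  M : ℕ
  M = length E
  F : List _ → ℕ
  F x∙yz≈y∙xz = ∑ x∙yz≈y∙xz g
  inv : Invariant F
  inv π = ∑-↭ g π
  B : ℕ → ℕ
  B t = ∑ (perms E) (λ σ → ∑ (take t σ) g)
  a : ℕ
  a = subsetSum E 1 F
  linear : ∀ t → t ≤ M → B t ≡ t * a
  linear zero    h = ∑-zero (perms E)
  linear (suc t) h = begin
      ∑ (perms E) (λ σ → ∑ (take (suc t) σ) g)
    ≡⟨ ∑-cong∈ (perms E) (λ {σ} m → trans (∑-take-suc g σ t) (cong (λ z → ∑ (take t σ) g + ∑ (sub (unit z t) σ) g) (↭-length (∈-perms⇒↭ E m)))) ⟩
      ∑ (perms E) (λ σ → ∑ (take t σ) g + F (sub (unit M t) σ))
    ≡⟨ ∑-+ (perms E) _ _ ⟩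
      B t + ∑ (perms E) (λ σ → F (sub (unit M t) σ))
    ≡⟨ cong₂ _+_ (linear t (<⇒≤ h)) (trans (∑-perms-sub E F inv (unit M t)) (cong (λ z → subsetSum E z F) (size-unit M h))) ⟩
      t * a + a
    ≡⟨ +-comm (t * a) a ⟩
      suc t * a ∎
  whole : B M ≡ length (perms E) * ∑ E g
  whole = trans (∑-cong∈ (perms E) λ {σ} m → trans (cong F (whole-list (∈-perms⇒↭ E m))) (∑-↭ g (∈-perms⇒↭ E m))) (∑-const (perms E) _)
    where
    whole-list : ∀ {σ} → σ ↭ E → take M σ ≡ σ
    whole-list {σ} π = take-all M σ (≤-reflexive (↭-length π))

-- Markov's inequality applied to `average`.
overBudget : ∀ {A : Set} (E : List A) (p : A → Bool) b {t} → t ≤ length E →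
  length E * (suc b * ∑ (perms E) (λ σ → 𝟙 (b <ᵇ ∑ (take t σ) (λ e → 𝟙 (p e))))) ≤ t * (length (perms E) * ∑ E (λ e → 𝟙 (p e)))
overBudget E p b {t} t≤ = ≤-trans (*-monoʳ-≤ (length E) (≤-trans (≤-reflexive (sym (∑-*ˡ (perms E) (suc b) _))) (∑-mono (perms E) λ σ → each (∑ (take t σ) (λ e → 𝟙 (p e))))))
  (≤-reflexive (average E (λ e → 𝟙 (p e)) t≤))
  where
  each : ∀ s → suc b * 𝟙 (b <ᵇ s) ≤ s
  each s with b <ᵇ s in e
  ... | true  = ≤-trans (≤-reflexive (*-identityʳ (suc b))) (<ᵇ⇒< b s (subst T (sym e) tt))
  ... | false = ≤-trans (≤-reflexive (*-zeroʳ (suc b))) z≤n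

-- From a copy to the power of a Hamilton cycle.

adj⁺ : ∀ {n} (G : List (Edge n)) {e} u v → e ∈ G → T (joins e (toℕ u) (toℕ v)) → T (adj G u v)
adj⁺ G u v m t = T-any⁺ (λ e → joins e (toℕ u) (toℕ v)) m t

adj⁻ : ∀ {n} (G : List (Edge n)) u v → T (adj G u v) → ∃ λ e → e ∈ G × T (joins e (toℕ u) (toℕ v))
adj⁻ G u v t = T-any⁻ (λ e → joins e (toℕ u) (toℕ v)) G t

adj-sym : ∀ {n} (G : List (Edge n)) u v → T (adj G u v) → T (adj G v u)
adj-sym G u v t = let e , m , j = adj⁻ G u v t in adj⁺ G v u m (joins⁺ e (toℕ v) (toℕ u) (⊎-swap (joins⁻ e (toℕ u) (toℕ v) j)))

∈-at : ∀ {n} (p : List (Fin n)) i {u} → u ∈ at p i → i < length p × toℕ u ≡ nth 0 (map toℕ p) i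
∈-at (x ∷ p) zero    (here refl) = s≤s z≤n , refl
∈-at (x ∷ p) (suc i) m = let a , b = ∈-at p i m in s≤s a , b

T-if⁺ : ∀ {b c} → (T b → T c) → T (if b then c else true)
T-if⁺ {true}  h = h tt
T-if⁺ {false} h = tt

-- Listing the vertices by their positions under f gives the Hamilton cycle, and the index condition
-- in `powerCycleOn` implies closeness of the two positions.
powHamCycle : ∀ k n {f} → f ↭ upTo n → (G : List (Edge n)) →
  (∀ {e} → e ∈ allEdges n → T (closeᴱ k f e) → T (adj G (proj₁ e) (proj₂ e))) → T (hasPowHamCycle k n G)
powHamCycle k n {f} π G edges with inverse π
... | p , p↭ , fp with ↭-map-inv toℕ (subst (_↭ p) (sym (map-toℕ-allFin n)) (↭-sym p↭))
... | p′ , refl , σ = T-any⁺ (powerCycleOn k G) (↭⇒∈-perms (↭-sym σ))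
  (T-all⁺ _ (upTo n) λ {i} mi → T-all⁺ _ (upTo n) λ {j} mj → T-if⁺ λ c →
    T-all⁺ _ (at p′ i) λ {u} mu → T-all⁺ _ (at p′ j) λ {v} mv → connect i j u v c mu mv)
  where
  position : ∀ {i u} → u ∈ at p′ i → nth 0 f (toℕ u) ≡ i
  position {i} {u} m with ∈-at p′ i m
  ... | i< , e = trans (cong (nth 0 f) e) (trans (sym (nth-map 0 0 (nth 0 f) (map toℕ p′) i<′))
                   (trans (cong (λ z → nth 0 z i) fp) (nth-upTo n (subst (i <_) (trans (↭-length p↭) (length-upTo n)) i<′))))
    where
    i<′ : i < length (map toℕ p′)
    i<′ = subst (i <_) (sym (length-map toℕ p′)) i<
  cyc : ∀ i j → i < j → T ((j ∸ i ≤ᵇ k) ∨ (n ∸ (j ∸ i) ≤ᵇ k)) → T (close k n i j)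
  cyc i j i<j t with T-∨⁻ {j ∸ i ≤ᵇ k} t
  ... | inj₁ a = close⁺ k n i j (inj₁ (≤-trans (<⇒≤ i<j) (m≤m+n j k) , ∸≤⇒≤+ j i (≤ᵇ⇒≤ (j ∸ i) k a)))
  ... | inj₂ b = close⁺ k n i j (inj₂ (inj₁ (begin
        i + n               ≤⟨ +-monoʳ-≤ i (∸≤⇒≤+ n (j ∸ i) (≤ᵇ⇒≤ (n ∸ (j ∸ i)) k b)) ⟩
        i + (j ∸ i + k)     ≡⟨ trans (sym (+-assoc i (j ∸ i) k)) (cong (_+ k) (m+[n∸m]≡n (<⇒≤ i<j))) ⟩
        j + k               ∎)))
    where open ≤-Reasoning
  connect : ∀ i j u v → T ((i <ᵇ j) ∧ ((j ∸ i ≤ᵇ k) ∨ (n ∸ (j ∸ i) ≤ᵇ k))) → u ∈ at p′ i → v ∈ at p′ j → T (adj G u v)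
  connect i j u v c mu mv with T-∧⁻ {i <ᵇ j} c
  ... | c₁ , c₂ with position mu | position mv
  ... | eu | ev with <-cmp (toℕ u) (toℕ v)
  ...   | tri< u<v _ _ = edges (∈-allEdges u v u<v) (subst₂ (λ x y → T (close k n x y)) (sym eu) (sym ev) (cyc i j (<ᵇ⇒< i j c₁) c₂))
  ...   | tri> _ _ v<u = adj-sym G v u (edges (∈-allEdges v u v<u) (subst₂ (λ x y → T (close k n x y)) (sym ev) (sym eu) (close-sym k n i j (cyc i j (<ᵇ⇒< i j c₁) c₂))))
  ...   | tri≈ _ u≡v _ = contradiction (trans (sym eu) (trans (cong (nth 0 f) u≡v) ev)) (<⇒≢ (<ᵇ⇒< i j c₁))

-- The strategy

buy : ∀ {n} → (Edge n → Bool) → Strategy n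
buy γ s []           = false
buy γ s (e ∷ [])     = γ e
buy γ s (e ∷ e′ ∷ h) = buy γ s (e′ ∷ h)

buy-∷ʳ : ∀ {n} (γ : Edge n → Bool) s h e → buy γ s (h ∷ʳ e) ≡ γ e
buy-∷ʳ γ s []          e = refl
buy-∷ʳ γ s (x ∷ [])    e = refl
buy-∷ʳ γ s (x ∷ y ∷ h) e = buy-∷ʳ γ s (y ∷ h) e

-- If at most b of the presented edges satisfy γ, the budget never runs out before such an edge is
-- presented.
runFrom-∈ : ∀ {n} (γ : Edge n → Bool) s b h es {e} → ∑ es (λ e → 𝟙 (γ e)) ≤ b → e ∈ es → T (γ e) → e ∈ runFrom (buy γ) s b h es
runFrom-∈ γ s zero    h es {e} le m t = contradiction (≤-trans (≤-reflexive (sym (𝟙-T t))) (≤-trans (∑-∈ (λ e → 𝟙 (γ e)) m) le)) λ ()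
runFrom-∈ γ s (suc b) h (x ∷ es) {e} le m t rewrite buy-∷ʳ γ s h x with γ x in eq | m
... | true  | here refl = here refl
... | true  | there m′  = there (runFrom-∈ γ s b (h ∷ʳ x) es (s≤s⁻¹ le) m′ t)
... | false | here refl = ⊥-elim (subst T eq t)
... | false | there m′  = runFrom-∈ γ s (suc b) (h ∷ʳ x) es le m′ t

interval : ℕ → ℕ → List ℕ
interval s N = applyUpTo (s +_) N

applyUpTo-cong : ∀ {f g : ℕ → ℕ} → (∀ i → f i ≡ g i) → ∀ n → applyUpTo f n ≡ applyUpTo g n
applyUpTo-cong h zero    = refl
applyUpTo-cong h (suc n) = cong₂ _∷_ (h 0) (applyUpTo-cong (h ∘ suc) n)

interval-++ : ∀ s a b → interval s a ++ interval (s + a) b ≡ interval s (a + b)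
interval-++ s zero    b = cong (λ z → interval z b) (+-identityʳ s)
interval-++ s (suc a) b = cong ((s + 0) ∷_) (begin
    applyUpTo (λ i → s + suc i) a ++ interval (s + suc a) b  ≡⟨ cong₂ _++_ (applyUpTo-cong (+-suc s) a) (cong (λ z → interval z b) (+-suc s a)) ⟩
    interval (suc s) a ++ interval (suc s + a) b             ≡⟨ interval-++ (suc s) a b ⟩
    interval (suc s) (a + b)                                 ≡⟨ sym (applyUpTo-cong (+-suc s) (a + b)) ⟩
    applyUpTo (λ i → s + suc i) (a + b)                      ∎)
  where open ≡-Reasoning

equalBlocks : ℕ → ℕ → ℕ → List (List ℕ)
equalBlocks m zero    s = []
equalBlocks m (suc c) s = interval s m ∷ equalBlocks m c (s + m)

-- The number of vertices need not be a multiple of m; the first block takes the remainder.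
blocks : ℕ → ℕ → ℕ → List (List ℕ)
blocks m e c = interval 0 (m + e) ∷ equalBlocks m c (m + e)

concat-equalBlocks : ∀ m c s → concat (equalBlocks m c s) ≡ interval s (c * m)
concat-equalBlocks m zero    s = refl
concat-equalBlocks m (suc c) s = trans (cong (interval s m ++_) (concat-equalBlocks m c (s + m))) (interval-++ s m (c * m))

concat-blocks : ∀ m e c → concat (blocks m e c) ≡ upTo (m + e + c * m)
concat-blocks m e c = trans (cong (interval 0 (m + e) ++_) (concat-equalBlocks m c (m + e))) (interval-++ 0 (m + e) (c * m))

length-interval : ∀ s N → length (interval s N) ≡ N
length-interval s N = length-applyUpTo (s +_) N

∈-interval : ∀ s N {q} → q ∈ interval s N → s ≤ q × q ≤ s + N
∈-interval s N m with ∈-applyUpTo⁻ (s +_) m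
... | i , i<N , refl = m≤m+n s i , +-monoʳ-≤ s (<⇒≤ i<N)

blocks-big : ∀ m e c → All (λ A → m ≤ length A) (blocks m e c)
blocks-big m e c = subst (m ≤_) (sym (length-interval 0 (m + e))) (m≤m+n m e) ∷ go c (m + e)
  where
  go : ∀ c s → All (λ A → m ≤ length A) (equalBlocks m c s)
  go zero    s = []
  go (suc c) s = ≤-reflexive (sym (length-interval s m)) ∷ go c (s + m)

-- Entry i of f is the position of vertex s + i.
Displaced : ℕ → ℕ → List ℕ → Set
Displaced w s []      = ⊤
Displaced w s (q ∷ f) = (q ≤ s + w × s ≤ q + w) × Displaced w (suc s) f

Displaced-++ : ∀ w s g h → Displaced w s g → Displaced w (s + length g) h → Displaced w s (g ++ h)
Displaced-++ w s []      h dg dh = subst (λ z → Displaced w z h) (+-identityʳ s) dh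
Displaced-++ w s (q ∷ g) h (d , dg) dh = d , Displaced-++ w (suc s) g h dg (subst (λ z → Displaced w z h) (+-suc s (length g)) dh)

Displaced-nth : ∀ w s f {x} → Displaced w s f → x < length f → nth 0 f x ≤ s + x + w × s + x ≤ nth 0 f x + w
Displaced-nth w s (q ∷ f) {zero}  ((a , b) , _) _ = subst (λ z → q ≤ z + w) (sym (+-identityʳ s)) a , subst (_≤ q + w) (sym (+-identityʳ s)) b
Displaced-nth w s (q ∷ f) {suc x} (_ , d) (s≤s h) = subst (λ z → nth 0 f x ≤ z + w × z ≤ nth 0 f x + w) (sym (+-suc s x)) (Displaced-nth w (suc s) f d h)

Displaced-block : ∀ w lo N s g → N ≤ w → lo ≤ s → s + length g ≤ lo + N → (∀ {q} → q ∈ g → lo ≤ q × q ≤ lo + N) → Displaced w s g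
Displaced-block w lo N s []      N≤w lo≤s fit range = tt
Displaced-block w lo N s (q ∷ g) N≤w lo≤s fit range =
  (≤-trans (proj₂ (range (here refl))) (+-mono-≤ lo≤s N≤w) , ≤-trans (≤-trans (m≤m+n s _) fit) (+-mono-≤ (proj₁ (range (here refl))) N≤w)) ,
  Displaced-block w lo N (suc s) g N≤w (≤-trans lo≤s (n≤1+n s)) (≤-trans (≤-reflexive (sym (+-suc s (length g)))) fit) (range ∘ there)

-- Every position stays in the block of its vertex, and the longest block, the first, has length m +
-- e ≤ 2 * m.
blocks-displaced : ∀ m e c {f} → e ≤ m → f ∈ blockPerms (blocks m e c) → Displaced (2 * m) 0 f
blocks-displaced m e c {f} e≤m mf = cons 0 (m + e) (≤-trans (+-monoʳ-≤ m e≤m) (≤-reflexive (cong (m +_) (sym (+-identityʳ m))))) (equalBlocks m c (m + e)) (go c (m + e)) mf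
  where
  cons : ∀ s N → N ≤ 2 * m → ∀ As → (∀ {h} → h ∈ blockPerms As → Displaced (2 * m) (s + N) h) →
         ∀ {f} → f ∈ blockPerms (interval s N ∷ As) → Displaced (2 * m) s f
  cons s N N≤ As rest mf with ∈-blockPerms⁻ {interval s N} {As} mf
  ... | g , h , mg , mh , refl = Displaced-++ (2 * m) s g h
        (Displaced-block (2 * m) s N s g N≤ ≤-refl (+-monoʳ-≤ s (≤-reflexive lg)) (λ q∈ → ∈-interval s N (∈-resp-↭ g↭ q∈)))
        (subst (λ z → Displaced (2 * m) (s + z) h) (sym lg) (rest mh))
    where
    g↭ : g ↭ interval s N
    g↭ = ∈-sel⇒↭ {length (interval s N)} {interval s N} refl mg
    lg : length g ≡ N
    lg = trans (↭-length g↭) (length-interval s N)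
  go : ∀ c s {h} → h ∈ blockPerms (equalBlocks m c s) → Displaced (2 * m) s h
  go zero    s (here refl) = tt
  go (suc c) s mh = cons s m (m≤m+n m _) (equalBlocks m c (s + m)) (go c (s + m)) mh

-- The triangle inequality, with a displacement of at most w at either end.
Close-displaced : ∀ k w n {a b x y} → a ≤ x + w → x ≤ a + w → b ≤ y + w → y ≤ b + w → Close k n a b → Close (w + w + k) n x y
Close-displaced k w n {a} {b} {x} {y} a≤ x≤ b≤ y≤ = λ where
    (inj₁ (p , q)) → inj₁ (chain 0 x≤ p b≤ , chain 0 y≤ q a≤)
    (inj₂ (inj₁ p)) → inj₂ (inj₁ (shift n x≤ p b≤))
    (inj₂ (inj₂ p)) → inj₂ (inj₂ (shift n y≤ p a≤))
  where
  l : ∀ y w k → y + w + k + w ≡ y + (w + w + k)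
  l = solve-∀
  l′ : ∀ a n w → a + w + n ≡ a + n + w
  l′ = solve-∀
  chain : ∀ (_ : ℕ) {x a b y} → x ≤ a + w → a ≤ b + k → b ≤ y + w → x ≤ y + (w + w + k)
  chain _ {x} {a} {b} {y} p q r = ≤-trans p (≤-trans (+-monoˡ-≤ w (≤-trans q (+-monoˡ-≤ k r))) (≤-reflexive (l y w k)))
  shift : ∀ n {x a b y} → x ≤ a + w → a + n ≤ b + k → b ≤ y + w → x + n ≤ y + (w + w + k)
  shift n {x} {a} {b} {y} p q r = ≤-trans (+-monoˡ-≤ n p) (≤-trans (≤-reflexive (l′ a n w)) (≤-trans (+-monoˡ-≤ w (≤-trans q (+-monoˡ-≤ k r))) (≤-reflexive (l y w k))))

blocksOf : ℕ → ℕ → List (List ℕ)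
blocksOf n zero      = []
blocksOf n m@(suc _) = blocks m (n % m) (pred (n / m))

-- A copy is given by the map f from vertices to positions; its edges are those with closeᴱ k f.
copies : ℕ → ℕ → List (List ℕ)
copies n m = blockPerms (blocksOf n m)

blocksOf-spec : ∀ {n m} → 1 ≤ m → m ≤ n → concat (blocksOf n m) ≡ upTo n × All (λ A → m ≤ length A) (blocksOf n m) ×
  (∀ {f} → f ∈ copies n m → Displaced (2 * m) 0 f)
blocksOf-spec {n} {m@(suc _)} _ m≤n = trans (concat-blocks m (n % m) (pred (n / m))) (cong upTo eq) , blocks-big m (n % m) (pred (n / m)) ,
  λ mf → blocks-displaced m (n % m) (pred (n / m)) (<⇒≤ (m%n<n n m)) mf
  where
  l : ∀ m e c → m + e + c * m ≡ e + suc c * m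
  l = solve-∀
  1≤n/m : 1 ≤ n / m
  1≤n/m = ≤/ (≤-trans (≤-reflexive (*-identityˡ m)) m≤n)
  eq : m + n % m + pred (n / m) * m ≡ n
  eq = trans (l m (n % m) (pred (n / m))) (trans (cong (λ z → n % m + z * m) (suc-pred (n / m) ⦃ >-nonZero 1≤n/m ⦄)) (sym (m≡m%n+[m/n]*n n m)))

-- Containment of a copy in all presented edges, before any purchasing decision: a monotone
-- property, as `transfer` requires.
embeds : ∀ k n → ℕ → List (Edge n) → Bool
embeds k n m l = any (λ f → all (λ e → not (closeᴱ k f e) ∨ adj l (proj₁ e) (proj₂ e)) (allEdges n)) (copies n m)

embeds-mono : ∀ k n m → Monotone (embeds k n m)
embeds-mono k n m {xs} {ys} sub t with T-any⁻ _ (copies n m) t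
... | f , mf , h = T-any⁺ _ mf (T-all⁺ _ (allEdges n) λ {e} me → imp (closeᴱ k f e) (mono e) (T-all⁻ _ h me))
  where
  imp : ∀ c {a b} → (T a → T b) → T (not c ∨ a) → T (not c ∨ b)
  imp true  h = h
  imp false h = id
  mono : ∀ e → T (adj xs (proj₁ e) (proj₂ e)) → T (adj ys (proj₁ e) (proj₂ e))
  mono e t = let e′ , m , j = adj⁻ xs (proj₁ e) (proj₂ e) t in adj⁺ ys (proj₁ e) (proj₂ e) (sub m) j

admissible : ∀ {n} → ℕ → Edge n → Bool
admissible {n} d e = close d n (src e) (tgt e)

-- A copy moves each vertex by at most 2m, so all its edges are admissible; if the admissible edges
-- among the first t fit into the budget, all of them are bought.
wins : ∀ k n m t b s σ → 1 ≤ m → m ≤ n → σ ↭ allEdges n →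
  𝟙 (embeds k n m (take t σ)) ≤ 𝟙 (hasPowHamCycle k n (purchased (buy (admissible (2 * m + 2 * m + k))) s t b σ)) + 𝟙 (b <ᵇ ∑ (take t σ) (λ e → 𝟙 (admissible (2 * m + 2 * m + k) e)))
wins k n m t b s σ 1≤m m≤n π with b <? ∑ (take t σ) (λ e → 𝟙 (admissible (2 * m + 2 * m + k) e))
... | yes h = ≤-trans (𝟙≤1 (embeds k n m (take t σ))) (≤-trans (≤-reflexive (sym (𝟙-T (<⇒<ᵇ h)))) (m≤n+m _ (𝟙 (hasPowHamCycle k n (purchased (buy (admissible (2 * m + 2 * m + k))) s t b σ)))))
... | no ¬h = ≤-trans (𝟙-mono {embeds k n m (take t σ)} win) (m≤m+n _ _)
  where
  γ : Edge n → Bool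
  γ = admissible (2 * m + 2 * m + k)
  G : List (Edge n)
  G = purchased (buy γ) s t b σ
  win : T (embeds k n m (take t σ)) → T (hasPowHamCycle k n G)
  win t′ with T-any⁻ _ (copies n m) t′ | blocksOf-spec {n} {m} 1≤m m≤n
  ... | f , mf , h | cat , _ , disp = powHamCycle k n f↭ G λ {e} me c → bought e c (imp c (T-all⁻ _ h me))
    where
    f↭ : f ↭ upTo n
    f↭ = subst (f ↭_) cat (blockPerms-↭ (blocksOf n m) mf)
    imp : ∀ {c a} → T c → T (not c ∨ a) → T a
    imp {true} _ h = h
    near : ∀ x → x < n → nth 0 f x ≤ x + 2 * m × x ≤ nth 0 f x + 2 * m
    near x h = Displaced-nth (2 * m) 0 f (disp mf) (subst (x <_) (sym (trans (↭-length f↭) (length-upTo n))) h)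
    allowed : ∀ e → T (closeᴱ k f e) → T (γ e)
    allowed e c = let a , b = near (src e) (toℕ<n (proj₁ e)) ; a′ , b′ = near (tgt e) (toℕ<n (proj₂ e)) in
      close⁺ (2 * m + 2 * m + k) n (src e) (tgt e) (Close-displaced k (2 * m) n a b a′ b′ (close⁻ k n (nth 0 f (src e)) (nth 0 f (tgt e)) c))
    same : ∀ e e′ → T (closeᴱ k f e) → T (joins e′ (src e) (tgt e)) → T (closeᴱ k f e′)
    same e e′ c j with joins⁻ e′ (src e) (tgt e) j
    ... | inj₁ (p , q) = subst₂ (λ x y → T (close k n (nth 0 f x) (nth 0 f y))) (sym p) (sym q) c
    ... | inj₂ (p , q) = subst₂ (λ x y → T (close k n (nth 0 f x) (nth 0 f y))) (sym p) (sym q) (close-sym k n (nth 0 f (src e)) (nth 0 f (tgt e)) c)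
    bought : ∀ e → T (closeᴱ k f e) → T (adj (take t σ) (proj₁ e) (proj₂ e)) → T (adj G (proj₁ e) (proj₂ e))
    bought e c a = let e′ , m , j = adj⁻ (take t σ) (proj₁ e) (proj₂ e) a in
      adj⁺ G (proj₁ e) (proj₂ e) (runFrom-∈ γ s b [] (take t σ) (≮⇒≥ ¬h) m (allowed e′ (same e e′ c j))) j

-- Success probability for given parameters.

*-pow-cancel : ∀ {a b} k t → 1 ≤ t → (a * t) ^ k ≤ b * t ^ k → a ^ k ≤ b
*-pow-cancel {a} {b} k t 1≤t h = *-cancelʳ-≤ (a ^ k) b (t ^ k) ⦃ >-nonZero (^-pos k 1≤t) ⦄ (≤-trans (≤-reflexive (sym (^-distribʳ-* a t k))) h)

x≤x^k : ∀ {x k} → 1 ≤ x → 1 ≤ k → x ≤ x ^ k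
x≤x^k {x} {suc k} 1≤x _ = ≤-trans (≤-reflexive (sym (*-identityʳ x))) (*-monoʳ-≤ x (^-pos k 1≤x))

square-cancel : ∀ {a b} → a * a ≤ b * b → a ≤ b
square-cancel {a} {b} h with a ≤? b
... | yes p = p
... | no ¬p = contradiction (*-mono-< (≰⇒> ¬p) (≰⇒> ¬p)) (≤⇒≯ h)

module Core (k n t r Λ a : ℕ) (2≤k : 2 ≤ k) (1≤t : 1 ≤ t) (t≤M : t ≤ length (allEdges n)) (r²≤n : r * r ≤ n)
  (32≤Λ : 32 ≤ Λ) (1≤a : 1 ≤ a) (enough : n * spread k < r ^ a)
  (dense : (34 * k * (k * (spread k * spread k)) * (Λ * Λ) * a * (n * n)) ^ k ≤ r * r * t ^ k) where

  private
    M D h₀ q Y z : ℕ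
    M = length (allEdges n)
    D = spread k
    h₀ = k * (D * D)
    instance
      t≢0 : NonZero t
      t≢0 = >-nonZero 1≤t
    -- The union of `a` sets of density 1/(1 + q) has expected size at most a M / (1 + q) ≤ t / Λ,
    -- so it exceeds t with probability at most 1/Λ.
    q = Λ * a * M / t
    Y = 1 + 16 * (Λ * q)
    -- The single bound z^k ≤ r² yields both moment hypotheses: k ≥ 2 turns it into z ≤ r, which
    -- gives `hyp₁`, and for `hyp₂` it suffices that the factor in front of Y is at most its k-th
    -- power.
    z = 2 * k * h₀ * Y
    1≤k : 1 ≤ k
    1≤k = ≤-trans (s≤s z≤n) 2≤k
    1≤Λ : 1 ≤ Λ
    1≤Λ = ≤-trans (s≤s z≤n) 32≤Λ
    1≤M : 1 ≤ M
    1≤M = ≤-trans 1≤t t≤M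
    1≤n : 1 ≤ n
    1≤n = ≰⇒> λ n≤0 → contradiction (≤-trans 1≤M (≤-trans (edges≤square n) (*-mono-≤ n≤0 n≤0))) λ ()
    3≤D : 3 ≤ D
    3≤D = m≤n+m 3 (4 * k)
    1≤D : 1 ≤ D
    1≤D = ≤-trans (s≤s z≤n) 3≤D
    1≤h₀ : 1 ≤ h₀
    1≤h₀ = 1≤k · (1≤D · 1≤D)
    1≤Y : 1 ≤ Y
    1≤Y = s≤s z≤n

    -- The summand 1 of `Y` is absorbed through t ≤ M, turning 16 into 17; with the 2 in `z` this
    -- gives the 34 of `dense`.
    Yt≤ : Y * t ≤ 17 * (Λ * Λ) * a * (n * n)
    Yt≤ = begin
        Y * t                                       ≡⟨ l1 Λ q t ⟩
        t + 16 * Λ * (q * t)                        ≤⟨ +-mono-≤ t≤ (*-monoʳ-≤ (16 * Λ) (m/n*n≤m (Λ * a * M) t)) ⟩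
        Λ * Λ * a * M + 16 * Λ * (Λ * a * M)        ≡⟨ l2 Λ a M ⟩
        17 * (Λ * Λ) * a * M                        ≤⟨ *-monoʳ-≤ (17 * (Λ * Λ) * a) (edges≤square n) ⟩
        17 * (Λ * Λ) * a * (n * n)                  ∎
      where
      open ≤-Reasoning
      l1 : ∀ L q t → (1 + 16 * (L * q)) * t ≡ t + 16 * L * (q * t)
      l1 = solve-∀
      l2 : ∀ L a M → L * L * a * M + 16 * L * (L * a * M) ≡ 17 * (L * L) * a * M
      l2 = solve-∀
      t≤ : t ≤ Λ * Λ * a * M
      t≤ = ≤-trans t≤M (≤-trans (≤-reflexive (sym (*-identityˡ M))) (*-monoˡ-≤ M ((1≤Λ · 1≤Λ) · 1≤a)))

    z^k≤r² : z ^ k ≤ r * r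
    z^k≤r² = *-pow-cancel k t 1≤t (≤-trans (^-monoˡ k (begin
        2 * k * h₀ * Y * t                                ≡⟨ *-assoc (2 * k * h₀) Y t ⟩
        2 * k * h₀ * (Y * t)                              ≤⟨ *-monoʳ-≤ (2 * k * h₀) Yt≤ ⟩
        2 * k * h₀ * (17 * (Λ * Λ) * a * (n * n))         ≡⟨ l k h₀ (Λ * Λ) a (n * n) ⟩
        34 * k * h₀ * (Λ * Λ) * a * (n * n)               ∎)) dense)
      where
      open ≤-Reasoning
      l : ∀ k h L a n → 2 * k * h * (17 * L * a * n) ≡ 34 * k * h * L * a * n
      l = solve-∀

    base : ℕ
    base = 2 * k * h₀
    1≤base : 1 ≤ base
    1≤base = *-mono-≤ {1} {2 * k} {1} (≤-trans 1≤k (m≤m+n k _)) 1≤h₀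
    1≤z : 1 ≤ z
    1≤z = 1≤base · 1≤Y
    z≤r : z ≤ r
    z≤r = square-cancel (≤-trans (≤-trans (≤-reflexive (cong (z *_) (sym (*-identityʳ z)))) (^-monoʳ 1≤z 2≤k)) z^k≤r²)
    hyp₁ : 2 * h₀ * Y ≤ r
    hyp₁ = ≤-trans (*-monoˡ-≤ Y (*-monoˡ-≤ h₀ (*-monoʳ-≤ 2 1≤k))) z≤r
    hyp₂ : 2 * k * h₀ * Y ^ k ≤ r * r
    hyp₂ = ≤-trans (*-monoˡ-≤ (Y ^ k) (x≤x^k 1≤base 1≤k)) (≤-trans (≤-reflexive (sym (^-distribʳ-* base Y k))) z^k≤r²)
    few : k * D < r
    few = ≤-trans (begin
        suc (k * D)                ≤⟨ +-monoˡ-≤ (k * D) (1≤k · 1≤D) ⟩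
        k * D + k * D              ≡⟨ l k D ⟩
        2 * k * (1 * (1 * D)) * 1  ≤⟨ *-mono-≤ (*-monoʳ-≤ (2 * k) (1≤k · *-monoˡ-≤ D 1≤D)) 1≤Y ⟩
        z                          ∎) z≤r
      where
      open ≤-Reasoning
      l : ∀ k D → k * D + k * D ≡ 2 * k * (1 * (1 * D)) * 1
      l = solve-∀
    4≤r : 4 ≤ r
    4≤r = ≤-trans (s≤s (1≤k · 3≤D)) few
    1≤r² : 1 ≤ r * r
    1≤r² = ≤-trans (s≤s z≤n) 4≤r · ≤-trans (s≤s z≤n) 4≤r
    spec : concat (blocksOf n (r * r)) ≡ upTo n × All (λ A → r * r ≤ length A) (blocksOf n (r * r)) × (∀ {f} → f ∈ copies n (r * r) → Displaced (2 * (r * r)) 0 f)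
    spec = blocksOf-spec 1≤r² r²≤n

  open Rounds n k r Λ q (blocksOf n (r * r)) (proj₁ spec) (proj₁ (proj₂ spec)) 1≤n 1≤k 4≤r 32≤Λ r²≤n few hyp₁ hyp₂ using (inW; outW; mass; in+out; inW-bound; contains; covering; H)

  private
    α β X : ℕ
    α = inW a
    β = outW a
    X = (α + β) ^ M
    X≡ : mass a ≡ X
    X≡ = cong (_^ M) (sym (in+out a))
    1≤X : 1 ≤ X
    1≤X = subst (1 ≤_) X≡ (^-pos M (^-pos a (s≤s z≤n)))
    over miss hitW : ℕ
    over = wsum α β {M} (λ D → 𝟙 (t <ᵇ size D))
    miss = wsum α β {M} (λ D → 𝟙 (not (embeds k n (r * r) (sub D (allEdges n)))))
    hitW = wsum α β {M} (λ D → 𝟙 (embeds k n (r * r) (sub D (allEdges n))))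

    contains⇒embeds : ∀ D → T (contains D) → T (embeds k n (r * r) (sub D (allEdges n)))
    contains⇒embeds D c with T-any⁻ (λ S → S ⊑ᵇ D) H c
    ... | S , mS , S⊑ with ∈-map⁻ _ mS
    ... | f , mf , refl = T-any⁺ _ mf (T-all⁺ _ (allEdges n) λ {e} me → imp (closeᴱ k f e) λ t → adj⁺ (sub D (allEdges n)) (proj₁ e) (proj₂ e)
            (subst (e ∈_) (sym (sub-els (allEdges n) D)) (∈-els⁺ (closeᴱ k f) (allEdges n) D S⊑ me t)) (joins⁺ e (src e) (tgt e) (inj₁ (refl , refl))))
      where
      imp : ∀ c {b} → (T c → T b) → T (not c ∨ b)
      imp true  h = h tt
      imp false h = tt

    miss-bound : Λ * miss ≤ 16 * a * X
    miss-bound = ≤-trans (*-monoʳ-≤ Λ (wsum-mono α β {M} λ D → 𝟙-mono {not (embeds k n (r * r) (sub D (allEdges n)))} λ t → T-not⁺ λ c → T-not⁻ t (contains⇒embeds D c)))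
      (≤-trans (covering a enough) (≤-reflexive (cong (16 * a *_) X≡)))

    hit+miss : X ≡ hitW + miss
    hit+miss = trans (sym (trans (wsum-cong α β {M} λ D → 𝟙-+not (embeds k n (r * r) (sub D (allEdges n)))) (trans (wsum-const α β M 1) (*-identityʳ X)))) (wsum-+ α β {M} _ _)

    over-bound : Λ * over ≤ X
    over-bound = *-cancelˡ-≤ (a * M) ⦃ >-nonZero (1≤a · 1≤M) ⦄ (begin
        a * M * (Λ * over)            ≡⟨ l1 a M Λ over ⟩
        Λ * a * M * over              ≤⟨ *-monoˡ-≤ over (<⇒≤ (<suc/* (Λ * a * M) t)) ⟩
        t * suc q * over              ≡⟨ xy∙z≈y∙xz t (suc q) over ⟩
        suc q * (t * over)            ≤⟨ *-monoʳ-≤ (suc q) (≤-trans (*-monoˡ-≤ over (n≤1+n t)) (markov α β M t)) ⟩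
        suc q * wsum α β {M} size     ≤⟨ sizes ⟩
        a * M * X                     ∎)
      where
      open ≤-Reasoning
      l1 : ∀ a M L o → a * M * (L * o) ≡ L * a * M * o
      l1 = solve-∀
      l4 : ∀ q M α X → q * (M * α * X) ≡ M * X * (α * q)
      l4 = solve-∀
      l5 : ∀ M X a s → M * X * (a * s) ≡ a * M * X * s
      l5 = solve-∀
      sizes : suc q * wsum α β {M} size ≤ a * M * X
      sizes = *-cancelʳ-≤ _ _ (α + β) ⦃ >-nonZero (subst (1 ≤_) (sym (in+out a)) (^-pos a (s≤s z≤n))) ⦄ (begin
          suc q * wsum α β {M} size * (α + β)      ≡⟨ trans (*-assoc (suc q) (wsum α β {M} size) (α + β)) (cong (suc q *_) (wsum-size α β M)) ⟩
          suc q * (M * α * X)                      ≡⟨ l4 (suc q) M α X ⟩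
          M * X * (α * suc q)                      ≤⟨ *-monoʳ-≤ (M * X) (inW-bound a) ⟩
          M * X * (a * (1 + q) ^ a)                ≡⟨ cong (λ z → M * X * (a * z)) (sym (in+out a)) ⟩
          M * X * (a * (α + β))                    ≡⟨ l5 M X a (α + β) ⟩
          a * M * X * (α + β)                      ∎)

  N₀ won : ℕ
  N₀ = length (perms (allEdges n))
  won = ∑ (perms (allEdges n)) (λ σ → 𝟙 (embeds k n (r * r) (take t σ)))

  -- The failure probability is at most 17 a / Λ: 16 a / Λ for a random set without a copy, and 1/Λ,
  -- rounded up to a / Λ, for one with more than t edges.
  core : Λ * N₀ ≤ Λ * won + 17 * a * N₀
  core = *-cancelˡ-≤ X ⦃ >-nonZero 1≤X ⦄ (begin
      X * (Λ * N₀)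
    ≡⟨ trans (cong (_* (Λ * N₀)) hit+miss) (l1 hitW miss Λ N₀) ⟩
      Λ * (N₀ * hitW) + N₀ * (Λ * miss)
    ≤⟨ +-mono-≤ (*-monoʳ-≤ Λ (transfer (allEdges n) (embeds k n (r * r)) (embeds-mono k n (r * r)) α β t≤M)) (*-monoʳ-≤ N₀ miss-bound) ⟩
      Λ * (X * won + N₀ * over) + N₀ * (16 * a * X)
    ≡⟨ l2 Λ X won N₀ over a ⟩
      Λ * X * won + N₀ * (Λ * over) + 16 * a * N₀ * X
    ≤⟨ +-monoˡ-≤ (16 * a * N₀ * X) (+-monoʳ-≤ (Λ * X * won) (*-monoʳ-≤ N₀ (≤-trans over-bound (≤-trans (≤-reflexive (sym (*-identityˡ X))) (*-monoˡ-≤ X 1≤a))))) ⟩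
      Λ * X * won + N₀ * (a * X) + 16 * a * N₀ * X
    ≡⟨ l3 Λ X won N₀ a ⟩
      X * (Λ * won + 17 * a * N₀) ∎)
    where
    open ≤-Reasoning
    l1 : ∀ h m L N → (h + m) * (L * N) ≡ L * (N * h) + N * (L * m)
    l1 = solve-∀
    l2 : ∀ L X w N o a → L * (X * w + N * o) + N * (16 * a * X) ≡ L * X * w + N * (L * o) + 16 * a * N * X
    l2 = solve-∀
    l3 : ∀ L X w N a → L * X * w + N * (a * X) + 16 * a * N * X ≡ X * (L * w + 17 * a * N)
    l3 = solve-∀

-- Choice of the parameters

-- If tower s ≤ n then s^(C s) ≤ n^(C/s), which is n^o(1) as s grows; the exponent s * s is also
-- small enough that O(s) rounds, each gaining s^s, reach past n.
tower : ℕ → ℕ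
tower s = s ^ (s * s)

tower-mono : ∀ {s s′} → suc s ≤ s′ → tower (suc s) ≤ tower s′
tower-mono {s} {s′} h = ≤-trans (^-monoˡ (suc s * suc s) h) (^-monoʳ (≤-trans (s≤s z≤n) h) (h · h))

tower-suc : ∀ s → tower (suc s) < tower (suc (suc s))
tower-suc s = begin-strict
    suc s ^ (suc s * suc s)                  ≤⟨ ^-monoˡ (suc s * suc s) (n≤1+n (suc s)) ⟩
    b ^ (suc s * suc s)                      <⟨ ^-monoʳ-< b (s≤s (s≤s z≤n)) (*-mono-< (n<1+n (suc s)) (n<1+n (suc s))) ⟩
    b ^ (b * b)                              ∎
  where
  open ≤-Reasoning
  b : ℕ
  b = suc (suc s)

-- Tends to infinity, while scale n ^ O(scale n) is n ^ o(1).
scale : ℕ → ℕ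
scale zero    = zero
scale (suc n) = if tower (suc (scale n)) ≤ᵇ suc n then suc (scale n) else scale n

scale-upper : ∀ n → n < tower (suc (scale n))
scale-upper zero = s≤s z≤n
scale-upper (suc n) with tower (suc (scale n)) ≤ᵇ suc n in e
... | true  = ≤-<-trans (scale-upper n) (tower-suc (scale n))
... | false = ≰⇒> λ h → subst T e (≤⇒≤ᵇ h)

scale-lower : ∀ n → tower (scale (suc n)) ≤ suc n
scale-lower n with tower (suc (scale n)) ≤ᵇ suc n in e
... | true  = ≤ᵇ⇒≤ (tower (suc (scale n))) (suc n) (subst T (sym e) tt)
scale-lower zero    | false = ⊥-elim (subst T e tt)
scale-lower (suc n) | false = ≤-trans (scale-lower n) (n≤1+n (suc n))

scale-grows : ∀ S n → tower S ≤ n → S ≤ scale n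
scale-grows S n h with S ≤? scale n
... | yes p = p
... | no ¬p = contradiction (<-≤-trans (scale-upper n) (≤-trans (tower-mono (≰⇒> ¬p)) h)) (<-irrefl refl)

searchRoot : ℕ → ℕ → ℕ → ℕ
searchRoot x y zero    = zero
searchRoot x y (suc u) = if suc u * suc u * x ≤ᵇ y then suc u else searchRoot x y u

searchRoot-≤ : ∀ x y u → searchRoot x y u * searchRoot x y u * x ≤ y
searchRoot-≤ x y zero    = z≤n
searchRoot-≤ x y (suc u) with suc u * suc u * x ≤ᵇ y in e
... | true  = ≤ᵇ⇒≤ (suc u * suc u * x) y (subst T (sym e) tt)
... | false = searchRoot-≤ x y u

searchRoot-max : ∀ x y u {r} → r ≤ u → r * r * x ≤ y → r ≤ searchRoot x y u
searchRoot-max x y zero    h _ = h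
searchRoot-max x y (suc u) {r} h g with suc u * suc u * x ≤ᵇ y in e
... | true  = h
... | false with m≤n⇒m<n∨m≡n h
...   | inj₁ lt   = searchRoot-max x y u (s≤s⁻¹ lt) g
...   | inj₂ refl = ⊥-elim (subst T e (≤⇒≤ᵇ g))

-- The integer part of the square root of y / x; for x ≥ 1 searching up to y is enough.
root : ℕ → ℕ → ℕ
root x y = searchRoot x y y

root-≤ : ∀ x y → root x y * root x y * x ≤ y
root-≤ x y = searchRoot-≤ x y y

r≤r*r : ∀ r → r ≤ r * r
r≤r*r zero    = z≤n
r≤r*r (suc r) = m≤m+n (suc r) _

root-max : ∀ {x y r} → 1 ≤ x → r * r * x ≤ y → r ≤ root x y
root-max {x} {y} {r} 1≤x h = searchRoot-max x y y (≤-trans (r≤r*r r) (≤-trans (≤-trans (≤-reflexive (sym (*-identityʳ (r * r)))) (*-monoʳ-≤ (r * r) 1≤x)) h)) h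

-- The next integer fails the test, and r + 1 ≤ 2 r.
root-4 : ∀ {x y} → 1 ≤ x → 1 ≤ root x y → y < 4 * (root x y * root x y) * x
root-4 {x} {y} 1≤x 1≤r = <-≤-trans (≰⇒> λ h → <-irrefl refl (root-max {x} {y} {suc r} 1≤x h)) (*-monoˡ-≤ x (begin
    suc r * suc r            ≤⟨ 2r · 2r ⟩
    (r + r) * (r + r)        ≡⟨ l r ⟩
    4 * (r * r)              ∎))
  where
  open ≤-Reasoning
  r : ℕ
  r = root x y
  2r : suc r ≤ r + r
  2r = +-monoˡ-≤ r 1≤r
  l : ∀ r → (r + r) * (r + r) ≡ 4 * (r * r)
  l = solve-∀

-- One more than the quotient, with the junk value 0 for divisor 0.
cdiv : ℕ → ℕ → ℕ
cdiv x zero    = zero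
cdiv x (suc d) = suc (x / suc d)

cdiv-lower : ∀ x {d} → 1 ≤ d → x ≤ cdiv x d * d
cdiv-lower x {suc d} _ = ≤-trans (<⇒≤ (<suc/* x (suc d))) (≤-reflexive (*-comm (suc d) _))

cdiv-upper : ∀ x {d} → 1 ≤ d → cdiv x d * d ≤ x + d
cdiv-upper x {suc d} _ = ≤-trans (+-monoʳ-≤ (suc d) (m/n*n≤m x (suc d))) (≤-reflexive (+-comm (suc d) x))

-- The choice of Λ makes 17 a / Λ equal to 1 / (2 (m + 1)); exhausted budgets account for at most
-- the same amount again.
finish : ∀ m N won lost Λ a S → 1 ≤ a → Λ ≡ 34 * suc m * a → Λ * N ≤ Λ * won + 17 * a * N → won ≤ S + lost → 2 * suc m * lost ≤ N →
  suc m * (N ∸ S) ≤ N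
finish m N won lost Λ a S 1≤a refl core won≤ lost≤ = begin
    suc m * (N ∸ S)            ≡⟨ *-distribˡ-∸ (suc m) N S ⟩
    suc m * N ∸ suc m * S      ≤⟨ m≤n+o⇒m∸n≤o (suc m * N) (suc m * S) (*-cancelˡ-≤ 2 (begin
        2 * (suc m * N)                          ≡⟨ sym (*-assoc 2 (suc m) N) ⟩
        2 * suc m * N                            ≤⟨ step ⟩
        2 * suc m * won + N                      ≤⟨ +-monoˡ-≤ N (*-monoʳ-≤ (2 * suc m) won≤) ⟩
        2 * suc m * (S + lost) + N               ≡⟨ cong (_+ N) (*-distribˡ-+ (2 * suc m) S lost) ⟩
        2 * suc m * S + 2 * suc m * lost + N     ≤⟨ +-monoˡ-≤ N (+-monoʳ-≤ (2 * suc m * S) lost≤) ⟩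
        2 * suc m * S + N + N                    ≡⟨ l2 (suc m) S N ⟩
        2 * (suc m * S + N)                      ∎)) ⟩
    N                          ∎
  where
  open ≤-Reasoning
  l1 : ∀ a m x → 17 * a * (2 * m * x) ≡ 34 * m * a * x
  l1 = solve-∀
  l2 : ∀ m S N → 2 * m * S + N + N ≡ 2 * (m * S + N)
  l2 = solve-∀
  step : 2 * suc m * N ≤ 2 * suc m * won + N
  step = *-cancelˡ-≤ (17 * a) ⦃ >-nonZero (*-mono-≤ {1} {17} (s≤s z≤n) 1≤a) ⦄ (begin
      17 * a * (2 * suc m * N)                   ≡⟨ l1 a (suc m) N ⟩
      34 * suc m * a * N                         ≤⟨ core ⟩
      34 * suc m * a * won + 17 * a * N          ≡⟨ cong (_+ 17 * a * N) (sym (l1 a (suc m) won)) ⟩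
      17 * a * (2 * suc m * won) + 17 * a * N    ≡⟨ sym (*-distribˡ-+ (17 * a) _ N) ⟩
      17 * a * (2 * suc m * won + N)             ∎)

successes-0 : ∀ k n t b (S : Strategy n) → successes k n 0 t b S ≡ ∑ (orderings n) (λ σ → 𝟙 (hasPowHamCycle k n (purchased S 0 t b σ)))
successes-0 k n t b S = trans (+-identityʳ _) (count-≡∑ _ (orderings n))

module Params (k : ℕ) (2≤k : 2 ≤ k) (t : ℕ → ℕ) (t≤M : ∀ n → t n ≤ length (allEdges n)) (ω : OmegaBound k t) where

  private
    k′ D h₀ : ℕ
    k′ = k ∸ 1
    D = spread k
    h₀ = k * (D * D)
    1≤k : 1 ≤ k
    1≤k = ≤-trans (s≤s z≤n) 2≤k
    k≡ : k ≡ suc k′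
    k≡ = sym (m+[n∸m]≡n 1≤k)
    exponent : 2 * k ∸ 1 ≡ suc (2 * k′)
    exponent = trans (cong (λ z → 2 * z ∸ 1) k≡) (cong pred (l k′))
      where l : ∀ x → 2 * suc x ≡ suc (suc (2 * x))
            l = solve-∀

  -- A square g² with g = s^(2s), split evenly in the dense range: one factor g lengthens the blocks
  -- to absorb constants that grow with the number of rounds, the other keeps the expected number of
  -- purchases below the budget.
  gap : ℕ → ℕ
  gap n = scale n ^ (4 * scale n)

  -- Below this density the budget allows buying every edge.
  sparse : ℕ → Bool
  sparse n = t n ^ k <ᵇ n ^ (2 * k ∸ 1) * gap n

  -- Its square is the block length: the largest square up to n in the sparse range, otherwise about
  -- 4 g (n²/t)^k, with g the square root of `gap n`.
  side : ℕ → ℕ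
  side n = if sparse n then root 1 n else root (t n ^ k) (4 * scale n ^ (2 * scale n) * n ^ (2 * k))

  budget : ℕ → ℕ
  budget n = cdiv (n ^ (2 * k ∸ 1) * gap n) (t n ^ (k ∸ 1))

  reach : ℕ → ℕ
  reach n = 2 * (side n * side n) + 2 * (side n * side n) + k

  strategy : (n : ℕ) → Strategy n
  strategy n = buy (admissible (reach n))

  t≤n² : ∀ n → t n ≤ n ^ 2
  t≤n² n = ≤-trans (t≤M n) (≤-trans (edges≤square n) (≤-reflexive (cong (n *_) (sym (*-identityʳ n)))))

  ω₁ : ℕ
  ω₁ = proj₁ (ω 1)

  t-pos : ∀ {n} → 1 ≤ n → ω₁ ≤ n → 1 ≤ t n
  t-pos {n} 1≤n h with t n in e
  ... | suc _ = s≤s z≤n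
  ... | zero  = contradiction (≤-trans (≤-trans (^-pos (2 * k ∸ 1) 1≤n) (≤-reflexive (sym (*-identityˡ _)))) (subst (λ z → 1 * n ^ (2 * k ∸ 1) ≤ z ^ k) e (proj₂ (ω 1) n h)))
                (subst (λ z → ¬ 1 ≤ 0 ^ z) (sym k≡) λ ())

  t^k′≤ : ∀ {n} → 1 ≤ n → t n ^ (k ∸ 1) ≤ n ^ (2 * k ∸ 1)
  t^k′≤ {n} 1≤n = begin
      t n ^ k′              ≤⟨ ^-monoˡ k′ (t≤n² n) ⟩
      (n ^ 2) ^ k′          ≡⟨ ^-*-assoc n 2 k′ ⟩
      n ^ (2 * k′)          ≤⟨ ^-monoʳ 1≤n (n≤1+n (2 * k′)) ⟩
      n ^ suc (2 * k′)      ≡⟨ cong (n ^_) (sym exponent) ⟩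
      n ^ (2 * k ∸ 1)       ∎
    where open ≤-Reasoning

  t^k≡ : ∀ n → t n ^ k ≡ t n * t n ^ (k ∸ 1)
  t^k≡ n = cong (t n ^_) k≡

  n^2k≡ : ∀ n → n ^ (2 * k) ≡ n * n ^ (2 * k ∸ 1)
  n^2k≡ n = cong (n ^_) (trans (trans (cong (2 *_) k≡) (l k′)) (cong suc (sym exponent)))
    where l : ∀ x → 2 * suc x ≡ suc (suc (2 * x))
          l = solve-∀

  scale-≤ : ∀ {n} → 1 ≤ n → tower (scale n) ≤ n
  scale-≤ {suc n} _ = scale-lower n

  gap-pos : ∀ n → 1 ≤ scale n → 1 ≤ gap n
  gap-pos n h = ^-pos (4 * scale n) h

  -- For s = scale n ≥ 2 the base is at most s^(4s+1) ≤ s^(5s), so 5 (q + 1) ≤ s brings the power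
  -- below s^(s²) ≤ n.
  gap-small : ∀ q {n} → 1 ≤ n → 5 * suc q ≤ scale n → (1 + gap n) ^ suc q ≤ n
  gap-small q {n} 1≤n h = begin
      (1 + gap n) ^ suc q              ≤⟨ ^-monoˡ (suc q) (≤-trans (+-monoˡ-≤ (gap n) (gap-pos n 1≤s)) (≤-trans (≤-reflexive (cong (gap n +_) (sym (+-identityʳ (gap n))))) (*-monoˡ-≤ (gap n) 2≤s))) ⟩
      (s ^ suc (4 * s)) ^ suc q        ≡⟨ ^-*-assoc s (suc (4 * s)) (suc q) ⟩
      s ^ (suc (4 * s) * suc q)        ≤⟨ ^-monoʳ 1≤s (≤-trans (*-monoˡ-≤ (suc q) (+-monoˡ-≤ (4 * s) 1≤s)) (≤-trans (≤-reflexive (l s (suc q))) (*-monoʳ-≤ s h))) ⟩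
      tower s                          ≤⟨ scale-≤ 1≤n ⟩
      n                                ∎
    where
    open ≤-Reasoning
    s : ℕ
    s = scale n
    2≤s : 2 ≤ s
    2≤s = ≤-trans (≤-trans (s≤s (s≤s z≤n)) (m≤m*n 5 (suc q))) h
    1≤s : 1 ≤ s
    1≤s = ≤-trans (s≤s z≤n) 2≤s
    l : ∀ s q → (s + 4 * s) * q ≡ s * (5 * q)
    l = solve-∀

  budget-bound : BudgetBound k t budget
  budget-bound p q = N , λ n N≤n → upper n N≤n , lower n N≤n
    where
    N : ℕ
    N = 1 + ω₁ + tower (5 * suc q)
    1≤ : ∀ {n} → N ≤ n → 1 ≤ n
    1≤ h = ≤-trans (s≤s z≤n) h
    t≥1 : ∀ {n} → N ≤ n → 1 ≤ t n
    t≥1 h = t-pos (1≤ h) (≤-trans (≤-trans (n≤1+n ω₁) (m≤m+n (1 + ω₁) _)) h)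
    s≥ : ∀ {n} → N ≤ n → 5 * suc q ≤ scale n
    s≥ {n} h = scale-grows (5 * suc q) n (≤-trans (m≤n+m _ (1 + ω₁)) h)
    upper : ∀ n → N ≤ n → (budget n * t n ^ (k ∸ 1)) ^ suc q ≤ n ^ ((2 * k ∸ 1) * suc q + suc p)
    upper n h = begin
        (budget n * t n ^ (k ∸ 1)) ^ suc q         ≤⟨ ^-monoˡ (suc q) (≤-trans (cdiv-upper (n ^ e * gap n) (^-pos (k ∸ 1) (t≥1 h))) (+-monoʳ-≤ (n ^ e * gap n) (t^k′≤ (1≤ h)))) ⟩
        (n ^ e * gap n + n ^ e) ^ suc q            ≡⟨ cong (_^ suc q) (l (n ^ e) (gap n)) ⟩
        (n ^ e * (1 + gap n)) ^ suc q              ≡⟨ trans (^-distribʳ-* (n ^ e) (1 + gap n) (suc q)) (cong (_* (1 + gap n) ^ suc q) (^-*-assoc n e (suc q))) ⟩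
        n ^ (e * suc q) * (1 + gap n) ^ suc q      ≤⟨ *-monoʳ-≤ (n ^ (e * suc q)) (≤-trans (gap-small q (1≤ h) (s≥ h)) (x≤x^k {k = suc p} (1≤ h) (s≤s z≤n))) ⟩
        n ^ (e * suc q) * n ^ suc p                ≡⟨ sym (^-distribˡ-+-* n (e * suc q) (suc p)) ⟩
        n ^ (e * suc q + suc p)                    ∎
      where
      open ≤-Reasoning
      e : ℕ
      e = 2 * k ∸ 1
      l : ∀ a g → a * g + a ≡ a * (1 + g)
      l = solve-∀
    lower : ∀ n → N ≤ n → n ^ ((2 * k ∸ 1) * suc q) ≤ (budget n * t n ^ (k ∸ 1)) ^ suc q * n ^ suc p
    lower n h = begin
        n ^ (e * suc q)                                      ≡⟨ sym (^-*-assoc n e (suc q)) ⟩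
        (n ^ e) ^ suc q                                      ≤⟨ ^-monoˡ (suc q) (≤-trans (≤-trans (≤-reflexive (sym (*-identityʳ (n ^ e)))) (*-monoʳ-≤ (n ^ e) (gap-pos n (≤-trans (s≤s z≤n) (s≥ h))))) (cdiv-lower (n ^ e * gap n) (^-pos (k ∸ 1) (t≥1 h)))) ⟩
        (budget n * t n ^ (k ∸ 1)) ^ suc q                   ≡⟨ sym (*-identityʳ _) ⟩
        (budget n * t n ^ (k ∸ 1)) ^ suc q * 1               ≤⟨ *-monoʳ-≤ ((budget n * t n ^ (k ∸ 1)) ^ suc q) (^-pos (suc p) (1≤ h)) ⟩
        (budget n * t n ^ (k ∸ 1)) ^ suc q * n ^ suc p       ∎
      where
      open ≤-Reasoning
      e : ℕ
      e = 2 * k ∸ 1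

  constant : ℕ → ℕ → ℕ
  constant Λ a = 34 * k * (k * (spread k * spread k)) * (Λ * Λ) * a

  -- Λ is proportional to the number of rounds, so Λ² a is cubic in it.
  constant-scale : ∀ m s → constant (34 * m * (8 * s)) (8 * s) ≡ constant (34 * m * 8) 8 * s ^ 3
  constant-scale m s = l (34 * k * (k * (spread k * spread k))) (34 * m) s
    where l : ∀ K v s → K * (v * (8 * s) * (v * (8 * s))) * (8 * s) ≡ K * (v * 8 * (v * 8)) * 8 * (s * (s * (s * 1)))
          l = solve-∀

  Works : ℕ → ℕ → Set
  Works m n = suc m * (total n 0 ∸ successes k n 0 (t n) (budget n) (strategy n)) ≤ total n 0

  lost : ℕ → ℕ
  lost n = ∑ (perms (allEdges n)) (λ σ → 𝟙 (budget n <ᵇ ∑ (take (t n) σ) (λ e → 𝟙 (admissible (reach n) e))))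

  works : ∀ m n a → 1 ≤ a → 1 ≤ t n → 1 ≤ side n → side n * side n ≤ n → n * spread k < side n ^ a →
    (constant (34 * suc m * a) a * (n * n)) ^ k ≤ side n * side n * t n ^ k → 2 * suc m * lost n ≤ length (perms (allEdges n)) → Works m n
  works m n a 1≤a 1≤t 1≤r r²≤n enough dense few = subst₂ (λ x y → suc m * (x ∸ y) ≤ x) (sym (*-identityˡ _)) (sym (successes-0 k n (t n) (budget n) (strategy n)))
    (finish m N₀ won (lost n) Λ a _ 1≤a refl core
      (≤-trans (∑-mono∈ (perms (allEdges n)) λ {σ} mσ → wins k n (side n * side n) (t n) (budget n) 0 σ (1≤r · 1≤r) r²≤n (∈-perms⇒↭ (allEdges n) mσ)) (≤-reflexive (∑-+ (perms (allEdges n)) _ _))) few)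
    where
    Λ : ℕ
    Λ = 34 * suc m * a
    32≤Λ : 32 ≤ Λ
    32≤Λ = ≤-trans (m≤m+n 32 2) (*-mono-≤ (m≤m*n 34 (suc m)) 1≤a)
    open Core k n (t n) (side n) Λ a 2≤k 1≤t (t≤M n) r²≤n 32≤Λ 1≤a enough dense

  side-sparse : ∀ {n} → T (sparse n) → side n ≡ root 1 n
  side-sparse {n} h with sparse n
  ... | true = refl

  side-dense : ∀ {n} → ¬ T (sparse n) → side n ≡ root (t n ^ k) (4 * scale n ^ (2 * scale n) * n ^ (2 * k))
  side-dense {n} h with sparse n
  ... | true  = contradiction tt h
  ... | false = refl

  budget-lower : ∀ {n} → 1 ≤ t n → n ^ (2 * k ∸ 1) * gap n ≤ budget n * t n ^ (k ∸ 1)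
  budget-lower {n} 1≤t = cdiv-lower (n ^ (2 * k ∸ 1) * gap n) (^-pos (k ∸ 1) 1≤t)

  -- In the sparse range t^k < n^(2k-1) * gap n, so the budget is at least t and every edge could be
  -- bought.
  nothing-lost : ∀ {n} → T (sparse n) → 1 ≤ t n → lost n ≡ 0
  nothing-lost {n} h 1≤t = trans (∑-cong (perms (allEdges n)) λ σ → zero-𝟙 (λ c → <⇒≱ (<ᵇ⇒< (budget n) _ c) (≤-trans (count≤t σ) t≤b))) (∑-zero (perms (allEdges n)))
    where
    zero-𝟙 : ∀ {b} → ¬ T b → 𝟙 b ≡ 0
    zero-𝟙 {true}  h = contradiction tt h
    zero-𝟙 {false} h = refl
    count≤t : ∀ σ → ∑ (take (t n) σ) (λ e → 𝟙 (admissible (reach n) e)) ≤ t n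
    count≤t σ = ≤-trans (∑-mono (take (t n) σ) λ e → 𝟙≤1 (admissible (reach n) e)) (≤-trans (≤-reflexive (sym (length-∑1 (take (t n) σ)))) (≤-trans (≤-reflexive (length-take (t n) σ)) (m⊓n≤m (t n) (length σ))))
    t≤b : t n ≤ budget n
    t≤b = *-cancelʳ-≤ (t n) (budget n) (t n ^ (k ∸ 1)) ⦃ >-nonZero (^-pos (k ∸ 1) 1≤t) ⦄
      (≤-trans (≤-reflexive (sym (t^k≡ n))) (≤-trans (<⇒≤ (<ᵇ⇒< (t n ^ k) _ h)) (budget-lower 1≤t)))

  -- The factor 4 compensates for n < 4 r², with r² the block length.
  C-sparse : ℕ → ℕ
  C-sparse m = 4 * constant (34 * suc m * 3) 3 ^ k

  -- Since r is at least √n / 2 and exceeds any constant for large n, three rounds suffice. Hence Λ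
  -- depends only on m, and the constant in the density condition is one that `ω` can supply.
  sparse-works : ∀ m n → T (sparse n) → 16 * (D * D) ≤ n → C-sparse m * n ^ (2 * k ∸ 1) ≤ t n ^ k → 1 ≤ t n → Works m n
  sparse-works m n sp big large 1≤t = works m n 3 (s≤s z≤n) 1≤t 1≤r r²≤n enough dense
      (≤-trans (≤-reflexive (trans (cong (2 * suc m *_) (nothing-lost sp 1≤t)) (*-zeroʳ (2 * suc m)))) z≤n)
    where
    open ≤-Reasoning
    r c e : ℕ
    r = side n
    c = constant (34 * suc m * 3) 3
    e = 2 * k ∸ 1
    r≡ : r ≡ root 1 n
    r≡ = side-sparse sp
    4D≤r : 4 * D ≤ r
    4D≤r = subst (4 * D ≤_) (sym r≡) (root-max ≤-refl (≤-trans (≤-reflexive (l D)) big))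
      where l : ∀ D → 4 * D * (4 * D) * 1 ≡ 16 * (D * D)
            l = solve-∀
    1≤r : 1 ≤ r
    1≤r = ≤-trans (≤-trans (s≤s z≤n) (*-mono-≤ {1} {4} {1} (s≤s z≤n) (≤-trans (s≤s z≤n) (m≤n+m 3 (4 * k))))) 4D≤r
    r²≤n : r * r ≤ n
    r²≤n = subst (λ z → z * z ≤ n) (sym r≡) (≤-trans (≤-reflexive (sym (*-identityʳ _))) (root-≤ 1 n))
    n<4r² : n < 4 * (r * r)
    n<4r² = subst (λ z → n < 4 * (z * z)) (sym r≡) (<-≤-trans (root-4 ≤-refl (subst (1 ≤_) r≡ 1≤r)) (≤-reflexive (*-identityʳ _)))
    enough : n * D < r ^ 3
    enough = begin-strict
        n * D                  <⟨ *-monoˡ-< D ⦃ >-nonZero (≤-trans (s≤s z≤n) (m≤n+m 3 (4 * k))) ⦄ n<4r² ⟩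
        4 * (r * r) * D        ≡⟨ l r D ⟩
        r * r * (4 * D)        ≤⟨ *-monoʳ-≤ (r * r) 4D≤r ⟩
        r * r * r              ≡⟨ l′ r ⟩
        r ^ 3                  ∎
      where
      l : ∀ r D → 4 * (r * r) * D ≡ r * r * (4 * D)
      l = solve-∀
      l′ : ∀ r → r * r * r ≡ r * (r * (r * 1))
      l′ = solve-∀
    dense : (c * (n * n)) ^ k ≤ r * r * t n ^ k
    dense = *-cancelˡ-≤ 4 (begin
        4 * (c * (n * n)) ^ k           ≡⟨ cong (4 *_) (trans (^-distribʳ-* c (n * n) k) (cong (c ^ k *_) (trans (cong (_^ k) (cong (n *_) (sym (*-identityʳ n)))) (trans (^-*-assoc n 2 k) (n^2k≡ n))))) ⟩
        4 * (c ^ k * (n * n ^ e))       ≡⟨ l (c ^ k) n (n ^ e) ⟩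
        n * (4 * c ^ k * n ^ e)         ≤⟨ <⇒≤ n<4r² · large ⟩
        4 * (r * r) * t n ^ k           ≡⟨ *-assoc 4 (r * r) _ ⟩
        4 * (r * r * t n ^ k)           ∎)
      where
      l : ∀ c n x → 4 * (c * (n * x)) ≡ n * (4 * c * x)
      l = solve-∀

  -- Each summand is a lower bound that `scale n` must meet; the last two serve the budget estimate
  -- and the density condition.
  S-dense : ℕ → ℕ
  S-dense m = 2 + D + 2 * k + 272 * (2 * suc m) + constant (34 * suc m * 8) 8

  -- The number of rounds is 8 s with s = scale n, so Λ grows with n; the factor g in the block
  -- length makes up for it.
  dense-works : ∀ m n → ¬ T (sparse n) → 2 ≤ n → S-dense m ≤ scale n → 1 ≤ t n → Works m n
  dense-works m n ds 2≤n big 1≤t = works m n (8 * s) (*-mono-≤ {1} {8} (s≤s z≤n) 1≤s) 1≤t 1≤r r²≤n enough dense few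
    where
    open ≤-Reasoning
    s r e g c b t′ Ω L : ℕ
    s = scale n
    r = side n
    e = 2 * k ∸ 1
    g = s ^ (2 * s)
    c = constant (34 * suc m * (8 * s)) (8 * s)
    b = budget n
    t′ = t n ^ (k ∸ 1)
    Ω = length (perms (allEdges n))
    L = lost n
    x₁ x₂ x₃ x₄ : ℕ
    x₁ = 2 + D
    x₂ = 2 * k
    x₃ = 272 * (2 * suc m)
    x₄ = constant (34 * suc m * 8) 8
    123≤s : x₁ + x₂ + x₃ ≤ s
    123≤s = ≤-trans (m≤m+n _ x₄) big
    12≤s : x₁ + x₂ ≤ s
    12≤s = ≤-trans (m≤m+n _ x₃) 123≤s
    2≤s : 2 ≤ s
    2≤s = ≤-trans (m≤m+n 2 D) (≤-trans (m≤m+n x₁ x₂) 12≤s)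
    1≤s : 1 ≤ s
    1≤s = ≤-trans (s≤s z≤n) 2≤s
    D≤s : D ≤ s
    D≤s = ≤-trans (m≤n+m D 2) (≤-trans (m≤m+n x₁ x₂) 12≤s)
    2k≤s : 2 * k ≤ s
    2k≤s = ≤-trans (m≤n+m x₂ x₁) 12≤s
    x₃≤s : x₃ ≤ s
    x₃≤s = ≤-trans (m≤n+m x₃ (x₁ + x₂)) 123≤s
    x₄≤s : x₄ ≤ s
    x₄≤s = ≤-trans (m≤n+m x₄ (x₁ + x₂ + x₃)) big
    1≤n : 1 ≤ n
    1≤n = ≤-trans (s≤s z≤n) 2≤n
    1≤tk : 1 ≤ t n ^ k
    1≤tk = ^-pos k 1≤t
    1≤g : 1 ≤ g
    1≤g = ^-pos (2 * s) 1≤s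
    gap≡ : gap n ≡ g * g
    gap≡ = trans (cong (s ^_) (l s)) (^-distribˡ-+-* s (2 * s) (2 * s))
      where l : ∀ s → 4 * s ≡ 2 * s + 2 * s
            l = solve-∀
    s≤g : s ≤ g
    s≤g = x≤x^k 1≤s (≤-trans 1≤s (m≤m+n s _))
    r≡ : r ≡ root (t n ^ k) (4 * g * n ^ (2 * k))
    r≡ = side-dense ds
    dense₀ : n ^ e * gap n ≤ t n ^ k
    dense₀ = ≮⇒≥ λ h → ds (<⇒<ᵇ h)
    r²t : r * r * t n ^ k ≤ 4 * g * n ^ (2 * k)
    r²t = subst (λ z → z * z * t n ^ k ≤ 4 * g * n ^ (2 * k)) (sym r≡) (root-≤ (t n ^ k) _)
    s^s≤r : s ^ s ≤ r
    s^s≤r = subst (s ^ s ≤_) (sym r≡) (root-max 1≤tk (begin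
        s ^ s * s ^ s * t n ^ k        ≡⟨ cong (_* t n ^ k) (trans (sym (^-distribˡ-+-* s s s)) (cong (s ^_) (cong (s +_) (sym (+-identityʳ s))))) ⟩
        g * t n ^ k                    ≤⟨ *-monoʳ-≤ g (≤-trans (^-monoˡ k (t≤n² n)) (≤-reflexive (^-*-assoc n 2 k))) ⟩
        g * n ^ (2 * k)                ≤⟨ *-monoˡ-≤ (n ^ (2 * k)) (m≤m+n g _) ⟩
        4 * g * n ^ (2 * k)            ∎))
    s≤r : s ≤ r
    s≤r = ≤-trans (x≤x^k 1≤s 1≤s) s^s≤r
    1≤r : 1 ≤ r
    1≤r = ≤-trans 1≤s s≤r
    4r²t : 4 * g * n ^ (2 * k) ≤ 4 * (r * r) * t n ^ k
    4r²t = subst (λ z → 4 * g * n ^ (2 * k) ≤ 4 * (z * z) * t n ^ k) (sym r≡) (<⇒≤ (root-4 1≤tk (subst (1 ≤_) r≡ 1≤r)))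
    4≤g : 4 ≤ g
    4≤g = ≤-trans (^-monoʳ {2} {2} {2 * s} (s≤s z≤n) (*-monoʳ-≤ 2 1≤s)) (^-monoˡ (2 * s) 2≤s)
    -- Density above the gap gives r² ≤ 4 n / g, and g ≥ 4.
    r²≤n : r * r ≤ n
    r²≤n = *-cancelʳ-≤ (r * r) n (n ^ e * gap n) ⦃ >-nonZero (^-pos e 1≤n · gap-pos n 1≤s) ⦄ (begin
        r * r * (n ^ e * gap n)       ≤⟨ *-monoʳ-≤ (r * r) dense₀ ⟩
        r * r * t n ^ k               ≤⟨ r²t ⟩
        4 * g * n ^ (2 * k)           ≤⟨ *-monoˡ-≤ (n ^ (2 * k)) (*-monoˡ-≤ g 4≤g) ⟩
        g * g * n ^ (2 * k)           ≡⟨ cong₂ _*_ (sym gap≡) (n^2k≡ n) ⟩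
        gap n * (n * n ^ e)           ≡⟨ l (gap n) n (n ^ e) ⟩
        n * (n ^ e * gap n)           ∎)
      where l : ∀ g n x → g * (n * x) ≡ n * (x * g)
            l = solve-∀
    -- A constant times s³, with the constant at most s; therefore c^k ≤ s^(4k) ≤ s^(2s) = g.
    c≤s⁴ : c ≤ s ^ 4
    c≤s⁴ = ≤-trans (≤-reflexive (constant-scale (suc m) s)) (*-monoˡ-≤ (s ^ 3) x₄≤s)
    dense : (c * (n * n)) ^ k ≤ r * r * t n ^ k
    dense = *-cancelˡ-≤ 4 (begin
        4 * (c * (n * n)) ^ k              ≡⟨ cong (4 *_) (trans (^-distribʳ-* c (n * n) k) (cong (c ^ k *_) (trans (cong (_^ k) (cong (n *_) (sym (*-identityʳ n)))) (^-*-assoc n 2 k)))) ⟩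
        4 * (c ^ k * n ^ (2 * k))          ≤⟨ *-monoʳ-≤ 4 (*-monoˡ-≤ (n ^ (2 * k)) (≤-trans (^-monoˡ k c≤s⁴) (≤-trans (≤-reflexive (^-*-assoc s 4 k)) (^-monoʳ 1≤s (≤-trans (≤-reflexive (l k)) (*-monoʳ-≤ 2 2k≤s)))))) ⟩
        4 * (g * n ^ (2 * k))              ≡⟨ sym (*-assoc 4 g _) ⟩
        4 * g * n ^ (2 * k)                ≤⟨ 4r²t ⟩
        4 * (r * r) * t n ^ k              ≡⟨ *-assoc 4 (r * r) _ ⟩
        4 * (r * r * t n ^ k)              ∎)
      where l : ∀ k → 4 * k ≡ 2 * (2 * k)
            l = solve-∀
    -- On one side n < (s + 1)^((s+1)²) ≤ s^(2 (s+1)²), on the other r ≥ s^s; the exponent 8 s²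
    -- leaves room for D as well once s ≥ 2.
    enough : n * D < r ^ (8 * s)
    enough = begin-strict
        n * D                                     <⟨ *-monoˡ-< D ⦃ >-nonZero (≤-trans (s≤s z≤n) (m≤n+m 3 (4 * k))) ⦄ (scale-upper n) ⟩
        suc s ^ (suc s * suc s) * D               ≤⟨ *-mono-≤ (^-monoˡ (suc s * suc s) suc-s≤s²) D≤s ⟩
        (s ^ 2) ^ (suc s * suc s) * s             ≡⟨ trans (cong (_* s) (^-*-assoc s 2 (suc s * suc s))) (*-comm _ s) ⟩
        s ^ suc (2 * (suc s * suc s))             ≤⟨ ^-monoʳ 1≤s exps ⟩
        s ^ (s * (8 * s))                         ≡⟨ sym (^-*-assoc s s (8 * s)) ⟩
        (s ^ s) ^ (8 * s)                         ≤⟨ ^-monoˡ (8 * s) s^s≤r ⟩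
        r ^ (8 * s)                               ∎
      where
      suc-s≤s² : suc s ≤ s ^ 2
      suc-s≤s² = ≤-trans (+-monoˡ-≤ s 1≤s) (≤-trans (≤-reflexive (l s)) (*-monoʳ-≤ s (≤-trans 2≤s (≤-reflexive (sym (*-identityʳ s))))))
        where l : ∀ s → s + s ≡ s * 2
              l = solve-∀
      exps : suc (2 * (suc s * suc s)) ≤ s * (8 * s)
      exps with m≤n⇒∃[o]m+o≡n 2≤s
      ... | d , eq = subst (λ z → suc (2 * (suc z * suc z)) ≤ z * (8 * z)) eq (≤-trans (m≤m+n _ (6 * (d * d) + 20 * d + 13)) (≤-reflexive (l d)))
        where l : ∀ d → 1 + 2 * ((1 + (2 + d)) * (1 + (2 + d))) + (6 * (d * d) + 20 * d + 13) ≡ (2 + d) * (8 * (2 + d))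
              l = solve-∀
    Γ : ℕ
    Γ = ∑ (allEdges n) (λ ε → 𝟙 (admissible (reach n) ε))
    Γ≤ : Γ ≤ n * (17 * (r * r))
    Γ≤ = begin
        Γ                                                            ≤⟨ ∑-edges≤ n (λ i j → 𝟙 (close (reach n) n i j)) ⟩
        ∑ (upTo n) (λ i → ∑ (upTo n) (λ j → 𝟙 (close (reach n) n i j))) ≤⟨ ∑-mono∈ (upTo n) (λ mi → close-row (reach n) n (∈-upTo⁻ mi)) ⟩
        ∑ (upTo n) (λ _ → spread (reach n))                          ≡⟨ trans (∑-const (upTo n) _) (cong (_* spread (reach n)) (length-upTo n)) ⟩
        n * spread (reach n)                                         ≡⟨ cong (n *_) (l (r * r) k) ⟩
        n * (16 * (r * r) + D)                                       ≤⟨ *-monoʳ-≤ n (+-monoʳ-≤ (16 * (r * r)) (≤-trans D≤s (≤-trans s≤r (r≤r*r r)))) ⟩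
        n * (16 * (r * r) + r * r)                                   ≡⟨ cong (n *_) (l′ (r * r)) ⟩
        n * (17 * (r * r))                                           ∎
      where
      l : ∀ x k → 4 * (2 * x + 2 * x + k) + 3 ≡ 16 * x + (4 * k + 3)
      l = solve-∀
      l′ : ∀ x → 16 * x + x ≡ 17 * x
      l′ = solve-∀
    nbL : n * (suc b * L) ≤ t n * (Ω * (68 * (r * r)))
    nbL = *-cancelˡ-≤ n ⦃ >-nonZero 1≤n ⦄ (begin
        n * (n * (suc b * L))                       ≡⟨ sym (*-assoc n n _) ⟩
        n * n * (suc b * L)                         ≤⟨ *-monoˡ-≤ (suc b * L) (square≤4*edges n 2≤n) ⟩
        4 * length (allEdges n) * (suc b * L)       ≡⟨ *-assoc 4 (length (allEdges n)) _ ⟩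
        4 * (length (allEdges n) * (suc b * L))     ≤⟨ *-monoʳ-≤ 4 (overBudget (allEdges n) (admissible (reach n)) b (t≤M n)) ⟩
        4 * (t n * (Ω * Γ))                         ≤⟨ *-monoʳ-≤ 4 (*-monoʳ-≤ (t n) (*-monoʳ-≤ Ω Γ≤)) ⟩
        4 * (t n * (Ω * (n * (17 * (r * r)))))      ≡⟨ l (t n) Ω n (r * r) ⟩
        n * (t n * (Ω * (68 * (r * r))))            ∎)
      where l : ∀ t o n x → 4 * (t * (o * (n * (17 * x)))) ≡ n * (t * (o * (68 * x)))
            l = solve-∀
    -- The budget overflows with probability at most 272 / g. Here 272 = 4 · 17 · 4, from n² ≤ 4 M,
    -- from the count `Γ≤` of admissible edges, and from the 4 in `side`.
    gL : g * L ≤ 272 * Ω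
    gL = *-cancelˡ-≤ (g * n ^ (2 * k)) ⦃ >-nonZero (1≤g · ^-pos (2 * k) 1≤n) ⦄ (begin
        g * n ^ (2 * k) * (g * L)                       ≡⟨ cong (λ z → g * z * (g * L)) (n^2k≡ n) ⟩
        g * (n * n ^ e) * (g * L)                       ≡⟨ l1 g n (n ^ e) L ⟩
        n * (n ^ e * (g * g) * L)                       ≡⟨ cong (λ z → n * (n ^ e * z * L)) (sym gap≡) ⟩
        n * (n ^ e * gap n * L)                         ≤⟨ *-monoʳ-≤ n (*-monoˡ-≤ L (≤-trans (budget-lower 1≤t) (*-monoˡ-≤ t′ (n≤1+n b)))) ⟩
        n * (suc b * t′ * L)                            ≡⟨ l2 n (suc b) t′ L ⟩
        t′ * (n * (suc b * L))                          ≤⟨ *-monoʳ-≤ t′ nbL ⟩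
        t′ * (t n * (Ω * (68 * (r * r))))               ≡⟨ l3 t′ (t n) Ω (r * r) ⟩
        68 * Ω * (r * r * (t n * t′))                   ≡⟨ cong (λ z → 68 * Ω * (r * r * z)) (sym (t^k≡ n)) ⟩
        68 * Ω * (r * r * t n ^ k)                      ≤⟨ *-monoʳ-≤ (68 * Ω) r²t ⟩
        68 * Ω * (4 * g * n ^ (2 * k))                  ≡⟨ l4 Ω g (n ^ (2 * k)) ⟩
        g * n ^ (2 * k) * (272 * Ω)                     ∎)
      where
      l1 : ∀ g n x L → g * (n * x) * (g * L) ≡ n * (x * (g * g) * L)
      l1 = solve-∀
      l2 : ∀ n b t L → n * (b * t * L) ≡ t * (n * (b * L))
      l2 = solve-∀
      l3 : ∀ t′ t o x → t′ * (t * (o * (68 * x))) ≡ 68 * o * (x * (t * t′))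
      l3 = solve-∀
      l4 : ∀ o g x → 68 * o * (4 * g * x) ≡ g * x * (272 * o)
      l4 = solve-∀
    few : 2 * suc m * L ≤ Ω
    few = *-cancelˡ-≤ 272 (≤-trans (≤-reflexive (sym (*-assoc 272 (2 * suc m) L))) (≤-trans (*-monoˡ-≤ L (≤-trans x₃≤s s≤g)) gL))

  successful : Successful k t budget (λ _ → 0) strategy
  successful m = 2 + ω₁ + 16 * (D * D) + proj₁ (ω (C-sparse m)) + tower (S-dense m) , λ n h →
    let 2≤n , ω₁≤n , D≤n , ω≤n , tower≤n = summands ω₁ (16 * (D * D)) (proj₁ (ω (C-sparse m))) (tower (S-dense m)) h
        1≤t = t-pos (≤-trans (s≤s z≤n) 2≤n) ω₁≤n
    in case T? (sparse n) of λ where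
      (yes sp) → sparse-works m n sp D≤n (proj₂ (ω (C-sparse m)) n ω≤n) 1≤t
      (no ¬sp) → dense-works m n ¬sp 2≤n (scale-grows (S-dense m) n tower≤n) 1≤t
    where
    summands : ∀ a b c d {n} → 2 + a + b + c + d ≤ n → 2 ≤ n × a ≤ n × b ≤ n × c ≤ n × d ≤ n
    summands a b c d h = ≤-trans (m≤m+n 2 a) u₂ , ≤-trans (m≤n+m a 2) u₂ , ≤-trans (m≤n+m b (2 + a)) u₁ , ≤-trans (m≤n+m c (2 + a + b)) u₀ , ≤-trans (m≤n+m d (2 + a + b + c)) h
      where
      u₀ = ≤-trans (m≤m+n (2 + a + b + c) d) h
      u₁ = ≤-trans (m≤m+n (2 + a + b) c) u₀
      u₂ = ≤-trans (m≤m+n (2 + a) b) u₁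

theorem1p7 : (k : ℕ) → 2 ≤ k → (t : ℕ → ℕ) → (∀ n → t n ≤ length (allEdges n)) → OmegaBound k t →
    ∃ λ (b : ℕ → ℕ) → BudgetBound k t b ×
    ∃ λ (R : ℕ → ℕ) → ∃ λ (S : (n : ℕ) → Strategy n) → Successful k t b R S
theorem1p7 k 2≤k t t≤M ω = budget , budget-bound , (λ _ → 0) , strategy , successful
  where open Params k 2≤k t t≤M ω
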